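{- Let $k\ge 2$ and $l\ge 2$ be fixed integers and $n\to\infty$. If $2\le l<2k$, then $$ex(n,P_l,C_{2k})\ge (1+o(1))\frac12 (k-1)_{\lfloor l/2\rfloor}\, n^{\lceil l/2\rceil}.$$ If $l\ge 2k$, then $$ex(n,P_l,C_{2k})\ge (1+o(1))\max\left\{\left(\frac{n}{\lfloor l/2\rfloor}\right)^{\lceil l/2\rceil},\ \left(\frac{k-1}{4(k-2)^{k+2}}\right)^{\lceil l/2\rceil}(k-1)_{\lfloor l/2\rfloor}\, n^{\lceil l/2\rceil}\right\}.$$
   Context: $C_k$ denotes the cycle with $k$ vertices and $P_l$ the path with $l$ vertices. $ex(n,H,F)$ is the maximum number of subgraphs isomorphic to $H$ in an $n$-vertex graph containing no subgraph isomorphic to $F$. For positive integers $m,j$, $(m)_j=m(m-1)\cdots(m-j+1)$. -}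

module Defs where

open import Algebra.Definitions.RawSemiring using (_^_)
open import Data.Empty using (⊥)
open import Data.Fin using (Fin; zero; suc; fromℕ)
open import Data.Fin.Properties using (all?; any?) renaming (_≟_ to _≟ᶠ_)
open import Data.Fin.Subset using (Subset; inside; outside; _∈_; _∪_; ⁅_⁆)
open import Data.Fin.Subset.Properties using (_∈?_)
open import Data.Integer using (+_)
open import Data.List using (List; []; _∷_; length; map; filter; allFin; cartesianProduct; cartesianProductWith)
open import Data.List.Extrema.Nat using (max)
open import Data.List.Membership.Propositional using () renaming (_∈_ to _∈ᴸ_; lose to loseᴸ)
open import Data.List.Membership.Propositional.Properties using (∈-allFin; ∈-cartesianProductWith⁺; ∈-cartesianProduct⁺)
open import Data.List.Relation.Unary.All using ([]; _∷_)
open import Data.List.Relation.Unary.Any as Any using (here; there)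
open import Data.List.Relation.Unary.AllPairs using ([]; _∷_)
open import Data.List.Relation.Unary.Unique.Propositional using (Unique)
open import Data.List.Relation.Unary.Unique.Propositional.Properties using (allFin⁺; cartesianProduct⁺; cartesianProductWith⁺)
open import Data.Nat as ℕ using (ℕ; zero; suc; _∸_; ⌊_/2⌋; ⌈_/2⌉)
open import Data.Nat.Combinatorics using (_P_)
open import Data.Product using (∃; ∃-syntax; _×_; _,_; proj₁; proj₂)
open import Data.Rational as ℚ using (ℚ; 0ℚ; 1ℚ; _/_)
open import Data.Vec as Vec using (Vec; lookup)
open import Relation.Binary.PropositionalEquality using (_≡_; refl)
open import Relation.Nullary using (Dec; yes; no; ¬_)
open import Relation.Nullary.Decidable using (map′; ¬?; _×-dec_; _→-dec_)
open import Relation.Unary using (Decidable)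

private
  variable
    A : Set
    h n : ℕ

------------------------------------------------------------------------
-- Finite simple graphs

-- N ◃ G adds to G a new vertex `zero` whose neighbourhood is N, the old
-- vertices being shifted by `suc`.  Every simple graph on Fin n is
-- represented exactly once.
infixr 5 _◃_

data Graph : ℕ → Set where
  ∅   : Graph 0
  _◃_ : Subset n → Graph n → Graph (suc n)

Adj : Graph n → Fin n → Fin n → Set
Adj (N ◃ G) zero    zero    = ⊥
Adj (N ◃ G) zero    (suc j) = j ∈ N
Adj (N ◃ G) (suc i) zero    = i ∈ N
Adj (N ◃ G) (suc i) (suc j) = Adj G i j

adj? : (G : Graph n) (i j : Fin n) → Dec (Adj G i j)
adj? (N ◃ G) zero    zero    = no λ ()
adj? (N ◃ G) zero    (suc j) = j ∈? N
adj? (N ◃ G) (suc i) zero    = i ∈? N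
adj? (N ◃ G) (suc i) (suc j) = adj? G i j

adj-irrefl : (G : Graph n) (i : Fin n) → ¬ Adj G i i
adj-irrefl (N ◃ G) zero    ()
adj-irrefl (N ◃ G) (suc i) a = adj-irrefl G i a

adj-sym : (G : Graph n) (i j : Fin n) → Adj G i j → Adj G j i
adj-sym (N ◃ G) zero    (suc j) a = a
adj-sym (N ◃ G) (suc i) zero    a = a
adj-sym (N ◃ G) (suc i) (suc j) a = adj-sym G i j a

path : (l : ℕ) → Graph l
path 0             = ∅
path 1             = Vec.[] ◃ ∅
path (suc (suc l)) = ⁅ zero ⁆ ◃ path (suc l)

-- A path on k - 1 vertices together with one vertex joined to both its
-- ends.  This is the cycle with k vertices for k ≥ 3.
cycle : (k : ℕ) → Graph k
cycle 0             = ∅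
cycle 1             = Vec.[] ◃ ∅
cycle (suc (suc k)) = (⁅ zero ⁆ ∪ ⁅ fromℕ k ⁆) ◃ path (suc k)

------------------------------------------------------------------------
-- Exhaustive, repetition-free enumerations

vecs : List A → (n : ℕ) → List (Vec A n)
vecs xs zero    = Vec.[] ∷ []
vecs xs (suc n) = cartesianProductWith Vec._∷_ xs (vecs xs n)

subsets : (n : ℕ) → List (Subset n)
subsets = vecs (outside ∷ inside ∷ [])

graphs : (n : ℕ) → List (Graph n)
graphs zero    = ∅ ∷ []
graphs (suc n) = cartesianProductWith _◃_ (subsets n) (graphs n)

∈-vecs : (xs : List A) → (∀ x → x ∈ᴸ xs) → (v : Vec A n) → v ∈ᴸ vecs xs n
∈-vecs xs ∈xs Vec.[]       = here refl
∈-vecs xs ∈xs (x Vec.∷ v) =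
  ∈-cartesianProductWith⁺ Vec._∷_ (∈xs x) (∈-vecs xs ∈xs v)

vecs-unique : {xs : List A} → Unique xs → (n : ℕ) → Unique (vecs xs n)
vecs-unique u zero    = [] ∷ []
vecs-unique u (suc n) =
  cartesianProductWith⁺ Vec._∷_ (λ { refl → refl , refl }) u (vecs-unique u n)

∈-subsets : (S : Subset n) → S ∈ᴸ subsets n
∈-subsets = ∈-vecs _ λ { outside → here refl ; inside → there (here refl) }

subsets-unique : (n : ℕ) → Unique (subsets n)
subsets-unique = vecs-unique (((λ ()) ∷ []) ∷ [] ∷ [])

∈-graphs : (G : Graph n) → G ∈ᴸ graphs n
∈-graphs ∅       = here refl
∈-graphs (N ◃ G) = ∈-cartesianProductWith⁺ _◃_ (∈-subsets N) (∈-graphs G)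

graphs-unique : (n : ℕ) → Unique (graphs n)
graphs-unique zero    = [] ∷ []
graphs-unique (suc n) =
  cartesianProductWith⁺ _◃_ (λ { refl → refl , refl })
    (subsets-unique n) (graphs-unique n)

search : {P : A → Set} (xs : List A) → (∀ x → x ∈ᴸ xs) → Decidable P → Dec (∃ P)
search xs ∈xs P? =
  map′ Any.satisfied (λ (x , px) → loseᴸ (∈xs x) px) (Any.any? P? xs)

------------------------------------------------------------------------
-- Subgraphs, copies and the generalized Turán number

-- A candidate subgraph of a graph on Fin n: a vertex set and an edge set,
-- the latter given as a graph on all of Fin n.
Candidate : ℕ → Set
Candidate n = Subset n × Graph n

candidates : (n : ℕ) → List (Candidate n)
candidates n = cartesianProduct (subsets n) (graphs n)

∈-candidates : (X : Candidate n) → X ∈ᴸ candidates n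
∈-candidates (S , K) = ∈-cartesianProduct⁺ (∈-subsets S) (∈-graphs K)

candidates-unique : (n : ℕ) → Unique (candidates n)
candidates-unique n = cartesianProduct⁺ (subsets-unique n) (graphs-unique n)

IsSubgraph : Graph n → Candidate n → Set
IsSubgraph G (S , K) = ∀ i j → Adj K i j → i ∈ S × j ∈ S × Adj G i j

isSubgraph? : (G : Graph n) → Decidable (IsSubgraph G)
isSubgraph? G (S , K) = all? λ i → all? λ j →
  adj? K i j →-dec (i ∈? S ×-dec j ∈? S ×-dec adj? G i j)

record IsIso (H : Graph h) (X : Candidate n) (f : Vec (Fin n) h) : Set where
  field
    injective  : ∀ i j → lookup f i ≡ lookup f j → i ≡ j
    into       : ∀ i → lookup f i ∈ proj₁ X
    onto       : ∀ v → v ∈ proj₁ X → ∃[ i ] lookup f i ≡ v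
    preserves  : ∀ i j → Adj H i j → Adj (proj₂ X) (lookup f i) (lookup f j)
    reflects   : ∀ i j → Adj (proj₂ X) (lookup f i) (lookup f j) → Adj H i j

isIso? : (H : Graph h) (X : Candidate n) → Decidable (IsIso H X)
isIso? H (S , K) f = map′
  (λ (a , b , c , d , e) → record
    { injective = a ; into = b ; onto = c ; preserves = d ; reflects = e })
  (λ iso → let open IsIso iso in injective , into , onto , preserves , reflects)
  ( (all? λ i → all? λ j → (lookup f i ≟ᶠ lookup f j) →-dec (i ≟ᶠ j))
    ×-dec (all? λ i → lookup f i ∈? S)
    ×-dec (all? λ v → (v ∈? S) →-dec (any? λ i → lookup f i ≟ᶠ v))
    ×-dec (all? λ i → all? λ j → adj? H i j →-dec adj? K (lookup f i) (lookup f j))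
    ×-dec (all? λ i → all? λ j → adj? K (lookup f i) (lookup f j) →-dec adj? H i j))

Isomorphic : Graph h → Candidate n → Set
Isomorphic H X = ∃[ f ] IsIso H X f

isomorphic? : (H : Graph h) → Decidable (Isomorphic {n = n} H)
isomorphic? H X = search (vecs (allFin _) _) (∈-vecs _ ∈-allFin) (isIso? H X)

-- X is a subgraph of G isomorphic to H.
IsCopy : Graph h → Graph n → Candidate n → Set
IsCopy H G X = IsSubgraph G X × Isomorphic H X

isCopy? : (H : Graph h) (G : Graph n) → Decidable (IsCopy H G)
isCopy? H G X = isSubgraph? G X ×-dec isomorphic? H X

copies : Graph h → Graph n → ℕ
copies H G = length (filter (isCopy? H G) (candidates _))

Free : Graph h → Graph n → Set
Free F G = ¬ (∃[ X ] IsCopy F G X)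

free? : (F : Graph h) → Decidable (Free {n = n} F)
free? F G = ¬? (search (candidates _) ∈-candidates (isCopy? F G))

-- The value is 0 by convention if no graph on n vertices is F-free.
ex : {h f : ℕ} → ℕ → Graph h → Graph f → ℕ
ex n H F = max 0 (map (copies H) (filter (free? F) (graphs n)))

------------------------------------------------------------------------
-- Asymptotics

ℕ→ℚ : ℕ → ℚ
ℕ→ℚ m = + m / 1

TendsToZero : (ℕ → ℚ) → Set
TendsToZero o =
  ∀ ε → 0ℚ ℚ.< ε → ∃[ N ] (∀ n → N ℕ.≤ n → ℚ.∣ o n ∣ ℚ.< ε)

-- a n ≥ (1 + o(1)) b n  as n → ∞
infix 4 _≳_

_≳_ : (ℕ → ℚ) → (ℕ → ℚ) → Set
a ≳ b = ∃[ o ] TendsToZero o ×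
  (∃[ N ] (∀ n → N ℕ.≤ n → (1ℚ ℚ.+ o n) ℚ.* b n ℚ.≤ a n))

------------------------------------------------------------------------
-- The lower bounds

infixr 8 _^ℚ_

_^ℚ_ : ℚ → ℕ → ℚ
_^ℚ_ = _^_ ℚ.+-*-rawSemiring

-- Quotient of natural numbers, with a ÷ 0 = 0.
infixl 7 _÷_

_÷_ : ℕ → ℕ → ℚ
a ÷ zero    = 0ℚ
a ÷ (suc b) = + a / suc b

-- m P j is the falling factorial m (m - 1) ⋯ (m - j + 1), which is 0 for
-- j > m.
shortPathBound : (k l n : ℕ) → ℚ
shortPathBound k l n =
  ℚ.½ ℚ.* ℕ→ℚ ((k ∸ 1) P ⌊ l /2⌋) ℚ.* ℕ→ℚ n ^ℚ ⌈ l /2⌉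

blowUpBound : (l n : ℕ) → ℚ
blowUpBound l n = (n ÷ ⌊ l /2⌋) ^ℚ ⌈ l /2⌉

-- For k = 2 the denominator vanishes.  When 2k ≤ l the value given to the
-- quotient is immaterial, since the factor (k - 1) P ⌊ l /2⌋ is then 0.
sparseBound : (k l n : ℕ) → ℚ
sparseBound k l n =
  ((k ∸ 1) ÷ (4 ℕ.* (k ∸ 2) ℕ.^ (k ℕ.+ 2))) ^ℚ ⌈ l /2⌉
    ℚ.* ℕ→ℚ ((k ∸ 1) P ⌊ l /2⌋) ℚ.* ℕ→ℚ n ^ℚ ⌈ l /2⌉

{-# OPTIONS --safe #-}
module Submission where

-- All three bounds come from counting the paths of an explicit graph, each copy
-- of a path being traversed by exactly two embeddings.
--
-- For l < 2k the graph is the complete bipartite graph with parts of size k − 1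
-- and n − k + 1: each cycle on 2k vertices would use k vertices of the small part.
--
-- For l ≥ 2k the second term of the maximum vanishes, because ⌊l/2⌋ > k − 1.  Write
-- j = ⌊l/2⌋.  If k ≥ 3, blow up every second vertex of a path with j hubs and
-- j − 1 vertices in between; its only cycles have length 4, and there are paths
-- that visit the first and the last class twice, hence pass through j + 1
-- vertices outside the hubs.  If k = 2, take the points (x, y) over a prime field,
-- joined when y + y′ = x x′, with x restricted to an initial segment.  For l = 5
-- this count may fall short of its optimum n³/2 by a factor of at most 4, so a
-- prime is needed in an interval (48t, 84t], shorter than that of Bertrand's
-- postulate; it comes from Erdős' estimate of the central binomial coefficient
-- C(84t, 42t), with the primes in (42t, 48t] bounded by C(48t, 6t).

-- For l ≥ 2k the required constant has no factor 1/2, whereas counting embeddings loses one to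
-- reversals. So the number of embeddings must be at least twice `blowUpBound`; the surplus of the
-- constructions also swallows every lower-order term, and the error term in this range is simply 0.
--
-- Write p = c √n. For l = 5 the polarity graph has about c^6 n³ embedded paths if c ≤ 1, and about
-- n³ / c^4 if c ≥ 1 and x takes only n / p values. Twice the required number is n³ / 4, so c must
-- lie between 4^(-1/6) ≈ 0.794 and 4^(1/4) ≈ 1.414, a ratio of about 1.78. This dictates the
-- interval (48t, 84t] of ratio 1.75, placed at 0.8 √n to 1.4 √n. Other l are easier: for l = 2j + 1
-- the allowed loss is j^(j+1) / 2, smallest at j = 2, and for even l there is a spare factor of
-- order √n.

-- Binomial coefficients: identities, Leibniz' triangle, size estimates.

module Binomial where

  open import Data.Nat using (ℕ; zero; suc; _+_; _*_; _^_; _∸_; _!; _≤_; _<_; z≤n; s≤s; >-nonZero)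
  open import Data.Nat.Properties
  open import Data.Nat.Divisibility
  open import Data.Nat.Tactic.RingSolver using (solve-∀)
  open import Relation.Binary.PropositionalEquality

  -- bin a b is the binomial coefficient C (a + b) a.
  bin : ℕ → ℕ → ℕ
  bin zero    b       = 1
  bin (suc a) zero    = 1
  bin (suc a) (suc b) = bin a (suc b) + bin (suc a) b

  bin-zeroʳ : ∀ a → bin a 0 ≡ 1
  bin-zeroʳ zero    = refl
  bin-zeroʳ (suc a) = refl

  bin-sym : ∀ a b → bin a b ≡ bin b a
  bin-sym zero    b       = sym (bin-zeroʳ b)
  bin-sym (suc a) zero    = refl
  bin-sym (suc a) (suc b) = trans (cong₂ _+_ (bin-sym a (suc b)) (bin-sym (suc a) b)) (+-comm (bin (suc b) a) _)

  bin-! : ∀ a b → bin a b * (a ! * b !) ≡ (a + b) !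
  bin-! zero b = trans (+-identityʳ _) (+-identityʳ _)
  bin-! (suc a) zero = trans (+-identityʳ _) (trans (*-identityʳ _) (cong _! (cong suc (sym (+-identityʳ a)))))
  bin-! (suc a) (suc b) = begin
    (x + y) * (suc a * a ! * (suc b * b !))
      ≡⟨ lem x y (suc a) (suc b) (a !) (b !) ⟩
    suc a * (x * (a ! * suc b !)) + suc b * (y * (suc a ! * b !))
      ≡⟨ cong₂ (λ u v → suc a * u + suc b * v) (bin-! a (suc b)) (bin-! (suc a) b) ⟩
    suc a * (a + suc b) ! + suc b * suc (a + b) !
      ≡⟨ cong (λ n → suc a * n ! + suc b * suc (a + b) !) (+-suc a b) ⟩
    suc a * suc (a + b) ! + suc b * suc (a + b) !
      ≡⟨ *-distribʳ-+ (suc (a + b) !) (suc a) (suc b) ⟨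
    (suc a + suc b) * suc (a + b) !
      ≡⟨ cong (λ n → (suc a + suc b) * n !) (+-suc a b) ⟨
    (suc a + suc b) ! ∎
    where
    open ≡-Reasoning
    x = bin a (suc b)
    y = bin (suc a) b
    lem : ∀ x y a b u v → (x + y) * (a * u * (b * v)) ≡ a * (x * (u * (b * v))) + b * (y * (a * u * v))
    lem = solve-∀

  bin-absorb : ∀ a b → suc a * bin (suc a) b ≡ suc (a + b) * bin a b
  bin-absorb a b = *-cancelʳ-≡ _ _ (a ! * b !) {{m*n≢0 _ _ {{a !≢0}} {{b !≢0}}}} (begin
    suc a * bin (suc a) b * (a ! * b !)    ≡⟨ lem (suc a) (bin (suc a) b) (a !) (b !) ⟩
    bin (suc a) b * (suc a ! * b !)        ≡⟨ bin-! (suc a) b ⟩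
    suc (a + b) * (a + b) !                ≡⟨ cong (suc (a + b) *_) (bin-! a b) ⟨
    suc (a + b) * (bin a b * (a ! * b !))  ≡⟨ *-assoc (suc (a + b)) (bin a b) _ ⟨
    suc (a + b) * bin a b * (a ! * b !)    ∎)
    where
    open ≡-Reasoning
    lem : ∀ s x u v → s * x * (u * v) ≡ x * (s * u * v)
    lem = solve-∀

  bin-absorbʳ : ∀ a b → suc b * bin a (suc b) ≡ suc (a + b) * bin a b
  bin-absorbʳ a b = trans (cong (suc b *_) (bin-sym a (suc b)))
    (trans (bin-absorb b a) (cong₂ (λ n x → suc n * x) (+-comm b a) (bin-sym b a)))

  bin>0 : ∀ a b → 0 < bin a b
  bin>0 zero    b       = s≤s z≤n
  bin>0 (suc a) zero    = s≤s z≤n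
  bin>0 (suc a) (suc b) = ≤-trans (bin>0 a (suc b)) (m≤m+n _ _)

  -- The numbers 1 / ((a + b + 1) C(a + b, a)) form Leibniz' harmonic triangle:
  -- each is the difference of two of its neighbours, so D times it is an
  -- integer as soon as D / 1, …, D / N are.
  leibniz : ∀ {D N} → (∀ m → 0 < m → m ≤ N → m ∣ D) →
    ∀ a b → suc (a + b) ≤ N → suc (a + b) * bin a b ∣ D
  leibniz {D} c zero b le = subst (_∣ D) (sym (*-identityʳ (suc b))) (c (suc b) (s≤s z≤n) le)
  leibniz {D} {N} c (suc a) b le
    with leibniz {D} {N} c a b (≤-trans (n≤1+n _) le)
       | leibniz {D} {N} c a (suc b) (subst (λ x → suc x ≤ N) (sym (+-suc a b)) le)
  ... | divides q₁ e₁ | divides q₂ e₂ = divides (q₁ ∸ q₂) (sym (begin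
    (q₁ ∸ q₂) * (suc (suc (a + b)) * Y)  ≡⟨ *-assoc (q₁ ∸ q₂) _ Y ⟨
    (q₁ ∸ q₂) * suc (suc (a + b)) * Y    ≡⟨ cong (_* Y) step ⟩
    q₁ * suc a * Y                       ≡⟨ *-assoc q₁ (suc a) Y ⟩
    q₁ * (suc a * Y)                     ≡⟨ cong (q₁ *_) (bin-absorb a b) ⟩
    q₁ * (suc (a + b) * bin a b)         ≡⟨ e₁ ⟨
    D                                    ∎))
    where
    open ≡-Reasoning
    X = bin a (suc b)
    Y = bin (suc a) b
    q₂-eq : q₂ * suc (suc (a + b)) ≡ q₁ * suc b
    q₂-eq = *-cancelʳ-≡ _ _ X {{>-nonZero (bin>0 a (suc b))}} (begin
      q₂ * suc (suc (a + b)) * X      ≡⟨ *-assoc q₂ _ X ⟩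
      q₂ * (suc (suc (a + b)) * X)    ≡⟨ cong (λ n → q₂ * (suc n * X)) (+-suc a b) ⟨
      q₂ * (suc (a + suc b) * X)      ≡⟨ e₂ ⟨
      D                               ≡⟨ e₁ ⟩
      q₁ * (suc (a + b) * bin a b)    ≡⟨ cong (q₁ *_) (bin-absorbʳ a b) ⟨
      q₁ * (suc b * X)                ≡⟨ *-assoc q₁ (suc b) X ⟨
      q₁ * suc b * X                  ∎)
    step : (q₁ ∸ q₂) * suc (suc (a + b)) ≡ q₁ * suc a
    step = begin
      (q₁ ∸ q₂) * suc (suc (a + b))                   ≡⟨ *-distribʳ-∸ (suc (suc (a + b))) q₁ q₂ ⟩
      q₁ * suc (suc (a + b)) ∸ q₂ * suc (suc (a + b)) ≡⟨ cong₂ _∸_ (lem q₁ a b) q₂-eq ⟩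
      q₁ * suc a + q₁ * suc b ∸ q₁ * suc b            ≡⟨ m+n∸n≡m (q₁ * suc a) (q₁ * suc b) ⟩
      q₁ * suc a ∎
      where
      lem : ∀ q a b → q * suc (suc (a + b)) ≡ q * suc a + q * suc b
      lem = solve-∀

  -- The left side is a single term of the binomial expansion. It is the largest one when x : y = a
  -- : b, which is why it is applied with weights 1 : 7 to C(48t, 6t).
  bin-^-≤ : ∀ x y a b → bin a b * (x ^ a * y ^ b) ≤ (x + y) ^ (a + b)
  bin-^-≤ x y zero b = ≤-trans (≤-reflexive (trans (+-identityʳ _) (+-identityʳ _))) (^-monoˡ-≤ b (m≤n+m y x))
  bin-^-≤ x y (suc a) zero = ≤-trans (≤-reflexive (trans (+-identityʳ _) (*-identityʳ _)))
    (≤-trans (^-monoˡ-≤ (suc a) (m≤m+n x y)) (≤-reflexive (cong ((x + y) ^_) (cong suc (sym (+-identityʳ a))))))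
  bin-^-≤ x y (suc a) (suc b) = begin
    (p + q) * (x * x ^ a * (y * y ^ b))
      ≡⟨ lem p q x y (x ^ a) (y ^ b) ⟩
    x * (p * (x ^ a * y ^ suc b)) + y * (q * (x ^ suc a * y ^ b))
      ≤⟨ +-mono-≤ (*-monoʳ-≤ x (bin-^-≤ x y a (suc b))) (*-monoʳ-≤ y (bin-^-≤ x y (suc a) b)) ⟩
    x * (x + y) ^ (a + suc b) + y * (x + y) ^ (suc a + b)
      ≡⟨ cong (λ n → x * (x + y) ^ (a + suc b) + y * (x + y) ^ n) (+-suc a b) ⟨
    x * (x + y) ^ (a + suc b) + y * (x + y) ^ (a + suc b)
      ≡⟨ *-distribʳ-+ _ x y ⟨
    (x + y) * (x + y) ^ (a + suc b) ∎
    where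
    open ≤-Reasoning
    p = bin a (suc b)
    q = bin (suc a) b
    lem : ∀ p q x y u v → (p + q) * (x * u * (y * v)) ≡ x * (p * (u * (y * v))) + y * (q * (x * u * v))
    lem = solve-∀

  -- From m to m + 1 the right side grows by the factor 2 (2m + 3) / (m + 1), which exceeds 4.
  4^≤central : ∀ m → 4 ^ m ≤ suc (m + m) * bin m m
  4^≤central zero    = s≤s z≤n
  4^≤central (suc m) = *-cancelˡ-≤ (suc m) (begin
    suc m * (4 * 4 ^ m)                               ≤⟨ *-monoʳ-≤ (suc m) (*-monoʳ-≤ 4 (4^≤central m)) ⟩
    suc m * (4 * (suc (m + m) * b))                   ≤⟨ m≤m+n _ (2 * (suc (m + m) * b)) ⟩
    suc m * (4 * (suc (m + m) * b)) + 2 * (suc (m + m) * b) ≡⟨ lem₁ m b ⟩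
    (m + m + 3) * (2 * (suc (m + m) * b))             ≡⟨ cong ((m + m + 3) *_) central-suc ⟨
    (m + m + 3) * (suc m * bin (suc m) (suc m))       ≡⟨ lem₂ m (bin (suc m) (suc m)) ⟩
    suc m * (suc (suc m + suc m) * bin (suc m) (suc m)) ∎)
    where
    open ≤-Reasoning
    b = bin m m
    lem₁ : ∀ m b → suc m * (4 * (suc (m + m) * b)) + 2 * (suc (m + m) * b) ≡ (m + m + 3) * (2 * (suc (m + m) * b))
    lem₁ = solve-∀
    lem₂ : ∀ m b → (m + m + 3) * (suc m * b) ≡ suc m * (suc (suc m + suc m) * b)
    lem₂ = solve-∀
    lem₃ : ∀ m x → suc m * (x + x) ≡ 2 * (suc m * x)
    lem₃ = solve-∀
    central-suc : suc m * bin (suc m) (suc m) ≡ 2 * (suc (m + m) * b)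
    central-suc = trans (cong (λ z → suc m * (z + bin (suc m) m)) (bin-sym m (suc m)))
      (trans (lem₃ m (bin (suc m) m)) (cong (2 *_) (bin-absorb m m)))

-- Prime powers dividing binomial coefficients.

module PrimeDivisors where

  open Binomial
  open import Data.Empty using (⊥-elim)
  open import Data.Nat using (ℕ; zero; suc; _+_; _*_; _^_; _!; _≤_; _<_; z≤n; s≤s; NonZero; >-nonZero; >-nonZero⁻¹)
  open import Data.Nat.Properties
  open import Data.Nat.Divisibility
  open import Data.Nat.Induction using (<-rec)
  open import Data.Nat.Primality using (Prime; prime?; ¬prime[0]; ¬prime[1]; prime⇒nonZero; prime⇒nonTrivial; prime⇒irreducible; euclidsLemma)
  open import Data.Nat.Primality.Factorisation using (factorise)
  open import Data.Nat.Base using (nonTrivial⇒n>1)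
  open import Data.Nat.Tactic.RingSolver using (solve-∀)
  open import Data.List using ([]; _∷_)
  open import Data.Nat.ListAction using (product)
  open import Data.List.Relation.Unary.All using (_∷_)
  open import Data.Product using (∃-syntax; _×_; _,_; proj₁; proj₂)
  open import Data.Sum using (_⊎_; inj₁; inj₂)
  open import Relation.Nullary using (yes; no; contradiction)
  open import Relation.Binary.PropositionalEquality

  prime>1 : ∀ {p} → Prime p → 1 < p
  prime>1 {p} pp = nonTrivial⇒n>1 p {{prime⇒nonTrivial pp}}

  ∤1 : ∀ {p} → Prime p → p ∤ 1
  ∤1 pp d with refl ← ∣1⇒≡1 d = ¬prime[1] pp

  ∤* : ∀ {p m n} → Prime p → p ∤ m → p ∤ n → p ∤ m * n
  ∤* {p} {m} {n} pp a b d with euclidsLemma m n pp d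
  ... | inj₁ x = a x
  ... | inj₂ y = b y

  ∤! : ∀ {p} → Prime p → ∀ n → n < p → p ∤ n !
  ∤! pp zero    lt = ∤1 pp
  ∤! pp (suc n) lt = ∤* pp (>⇒∤ lt) (∤! pp n (<-trans (n<1+n n) lt))

  prime∣prime : ∀ {p q} → Prime p → Prime q → p ∣ q → p ≡ q
  prime∣prime pp pq d with prime⇒irreducible pq d
  ... | inj₁ refl = ⊥-elim (¬prime[1] pp)
  ... | inj₂ e    = e

  ∃-primeDivisor : ∀ n → 1 < n → ∃[ p ] Prime p × p ∣ n
  ∃-primeDivisor n 1<n with factorise n {{>-nonZero (<⇒≤ 1<n)}}
  ... | record { factors = []     ; isFactorisation = e } = contradiction e (λ { refl → <-irrefl refl 1<n })
  ... | record { factors = q ∷ qs ; isFactorisation = e ; factorsPrime = pq ∷ _ } =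
    q , pq , divides (product qs) (trans e (*-comm q _))

  p-free-part : ∀ {p} → Prime p → ∀ n → 0 < n → ∃[ e ] ∃[ m ] n ≡ p ^ e * m × p ∤ m
  p-free-part {p} pp = <-rec _ go
    where
    go : ∀ n → (∀ {m} → m < n → 0 < m → ∃[ e ] ∃[ m' ] m ≡ p ^ e * m' × p ∤ m') →
         0 < n → ∃[ e ] ∃[ m ] n ≡ p ^ e * m × p ∤ m
    go n rec 0<n with p ∣? n
    ... | no p∤n = 0 , n , sym (+-identityʳ n) , p∤n
    ... | yes p∣n =
      let instance
            _ = prime⇒nonTrivial pp
            _ = >-nonZero 0<n
          e , m , eq , p∤m = rec (quotient-< p∣n) (>-nonZero⁻¹ _ {{quotient≢0 p∣n}})
      in suc e , m , trans (m∣n⇒n≡m*quotient p∣n) (trans (cong (p *_) eq) (sym (*-assoc p (p ^ e) m))) , p∤m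

  ^-∣-^* : ∀ {p} → Prime p → ∀ e v {u} → p ∤ u → p ^ e ∣ p ^ v * u → e ≤ v
  ^-∣-^* pp zero    v       p∤u d = z≤n
  ^-∣-^* {p} pp (suc e) zero {u} p∤u d =
    ⊥-elim (p∤u (subst (p ∣_) (+-identityʳ u) (∣-trans (m∣m*n (p ^ e)) d)))
  ^-∣-^* {p} pp (suc e) (suc v) {u} p∤u d = s≤s (^-∣-^* pp e v p∤u
    (*-cancelˡ-∣ p {{prime⇒nonZero pp}} (subst (p * p ^ e ∣_) (*-assoc p (p ^ v) u) d)))

  -- A discrete intermediate value argument, which stands in for integer logarithms, fourth roots
  -- and square roots.
  bracket : (f : ℕ → ℕ) → ∀ {n} → f 0 ≤ n → ∀ b → n < f b → ∃[ q ] f q ≤ n × n < f (suc q)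
  bracket f f0 zero    lt = contradiction f0 (<⇒≱ lt)
  bracket f {n} f0 (suc b) lt with f b ≤? n
  ... | yes le = b , le , lt
  ... | no ¬le = bracket f f0 b (≰⇒> ¬le)

  n<p^n : ∀ {p} → 1 < p → ∀ n → n < p ^ n
  n<p^n lt zero = s≤s z≤n
  n<p^n {p} lt (suc n) = begin-strict
    suc n         ≤⟨ m≤m+n (suc n) n ⟩
    suc n + n     <⟨ ≤-reflexive (lem n) ⟩
    2 * suc n     ≤⟨ *-mono-≤ lt (n<p^n lt n) ⟩
    p * p ^ n     ∎
    where
    open ≤-Reasoning
    lem : ∀ n → suc (suc n + n) ≡ 2 * suc n
    lem = solve-∀

  -- A substitute for lcm(1, ..., n) in which only the exponent of p is controlled: u is the product
  -- of the p-free parts of 1, ..., n.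
  commonMultiple : ∀ {p} → Prime p → ∀ v n → n < p ^ suc v →
    ∃[ u ] p ∤ u × (∀ m → 0 < m → m ≤ n → m ∣ p ^ v * u)
  commonMultiple pp v zero    lt = 1 , ∤1 pp , λ m 0<m m≤0 → contradiction 0<m (≤⇒≯ m≤0)
  commonMultiple {p} pp v (suc n) lt
    with commonMultiple pp v n (<-trans (n<1+n n) lt) | p-free-part pp (suc n) (s≤s z≤n)
  ... | u , p∤u , all | i , m' , eq , p∤m' = u * m' , ∤* pp p∤u p∤m' , go
    where
    1+n≤p^v : p ^ i < p ^ suc v
    1+n≤p^v = ≤-<-trans (∣⇒≤ (divides m' (trans eq (*-comm (p ^ i) m')))) lt
    i≤v : i ≤ v
    i≤v with i ≤? v
    ... | yes h = h
    ... | no  h = contradiction (^-monoʳ-≤ p {{prime⇒nonZero pp}} (≰⇒> h)) (<⇒≱ 1+n≤p^v)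
    p^i∣p^v : p ^ i ∣ p ^ v
    p^i∣p^v = m≤n⇒m^o∣n^o i≤v
      where
      m≤n⇒m^o∣n^o : ∀ {i v} → i ≤ v → p ^ i ∣ p ^ v
      m≤n⇒m^o∣n^o z≤n = 1∣ _
      m≤n⇒m^o∣n^o (s≤s le) = *-monoʳ-∣ p (m≤n⇒m^o∣n^o le)
    go : ∀ m → 0 < m → m ≤ suc n → m ∣ p ^ v * (u * m')
    go m 0<m m≤1+n with m≤n⇒m<n∨m≡n m≤1+n
    ... | inj₁ (s≤s m≤n) = subst (m ∣_) (*-assoc (p ^ v) u m') (∣m⇒∣m*n m' (all m 0<m m≤n))
    ... | inj₂ refl = subst (_∣ p ^ v * (u * m')) (sym eq) (*-pres-∣ p^i∣p^v (n∣m*n u))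

  -- By `leibniz`, (a + b + 1) C(a + b, a) divides a common multiple p^v u of 1, ..., a + b + 1 with
  -- p^v ≤ a + b + 1 and p not dividing u. This takes the place of Legendre's formula for the
  -- exponent of p in a factorial.
  prime^∣bin⇒≤ : ∀ {p} → Prime p → ∀ e a b → p ^ e ∣ bin a b → p ^ e ≤ suc (a + b)
  prime^∣bin⇒≤ {p} pp e a b d
    with bracket (p ^_) {suc (a + b)} (s≤s z≤n) (suc (a + b)) (n<p^n (prime>1 pp) _)
  ... | v , p^v≤ , <p^ with commonMultiple pp v (suc (a + b)) <p^
  ... | u , p∤u , all = ≤-trans (^-monoʳ-≤ p {{prime⇒nonZero pp}} (^-∣-^* pp e v p∤u
    (∣-trans d (∣-trans (n∣m*n (suc (a + b))) (leibniz all a b ≤-refl))))) p^v≤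

  ∏ : (ℕ → ℕ) → ℕ → ℕ
  ∏ f zero    = 1
  ∏ f (suc n) = ∏ f n * f n

  -- The largest candidate prime is stripped from X with its full power, and the cofactor has only
  -- smaller prime divisors. Thus f has to cap prime powers only.
  ≤-∏ : ∀ {f} → (∀ i → 0 < f i) → ∀ N X → 0 < X → (∀ p → Prime p → p ∣ X → p < N) →
    (∀ p e → Prime p → p ^ e ∣ X → p ^ e ≤ f p) → X ≤ ∏ f N
  ≤-∏ pos zero X 0<X small bound with X ≤? 1
  ... | yes le = le
  ... | no  gt with ∃-primeDivisor X (≰⇒> gt)
  ...   | p , pp , d = contradiction (small p pp d) λ ()
  ≤-∏ {f} pos (suc N) X 0<X small bound with prime? N
  ... | no ¬pN = ≤-trans (≤-∏ pos N X 0<X small' bound) (m≤m*n (∏ f N) (f N) {{>-nonZero (pos N)}})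
    where
    small' : ∀ p → Prime p → p ∣ X → p < N
    small' p pp d = ≤∧≢⇒< (≤-pred (small p pp d)) λ { refl → ¬pN pp }
  ... | yes pN with p-free-part pN X 0<X
  ...   | e , zero , eq , N∤Y = contradiction (N ∣0) N∤Y
  ...   | e , Y@(suc _) , eq , N∤Y = begin
    X           ≡⟨ eq ⟩
    N ^ e * Y   ≤⟨ *-mono-≤ (bound N e pN (divides Y (trans eq (*-comm (N ^ e) Y))))
                     (≤-∏ pos N Y (s≤s z≤n) small' λ p e' pp d → bound p e' pp (∣-trans d Y∣X)) ⟩
    f N * ∏ f N ≡⟨ *-comm (f N) _ ⟩
    ∏ f N * f N ∎
    where
    open ≤-Reasoning
    Y∣X : Y ∣ X
    Y∣X = divides (N ^ e) eq
    small' : ∀ p → Prime p → p ∣ Y → p < N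
    small' p pp d = ≤∧≢⇒< (≤-pred (small p pp (∣-trans d Y∣X))) λ { refl → N∤Y d }

  ∤-∏ : ∀ {f p} → Prime p → (∀ i → f i ≡ 1 ⊎ f i ≡ i × Prime i) → ∀ N → N ≤ p → p ∤ ∏ f N
  ∤-∏ pp dich zero    le = ∤1 pp
  ∤-∏ {f} {p} pp dich (suc N) le = ∤* pp (∤-∏ pp dich N (<⇒≤ le)) ∤fN
    where
    ∤fN : p ∤ f N
    ∤fN d with dich N
    ... | inj₁ e = ∤1 pp (subst (p ∣_) e d)
    ... | inj₂ (e , pN) = <⇒≢ le (sym (prime∣prime pp pN (subst (p ∣_) e d)))

  -- A new prime N divides no product of smaller primes, so it must divide the cofactor q of the
  -- product collected so far.
  ∏-∣ : ∀ {f X} → (∀ i → f i ≡ 1 ⊎ f i ≡ i × Prime i × i ∣ X) → ∀ N → ∏ f N ∣ X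
  ∏-∣ dich zero = 1∣ _
  ∏-∣ {f} {X} dich (suc N) with dich N | ∏-∣ {f} {X} dich N
  ... | inj₁ e | h = subst (_∣ X) (sym (trans (cong (∏ f N *_) e) (*-identityʳ _))) h
  ... | inj₂ (e , pN , N∣X) | divides q eq
    with euclidsLemma q (∏ f N) pN (subst (N ∣_) eq N∣X)
  ...   | inj₁ (divides r eq') = divides r (trans eq (trans (cong (_* ∏ f N) eq')
          (trans (*-assoc r N _) (cong (r *_) (trans (*-comm N _) (cong (∏ f N *_) (sym e)))))))
  ...   | inj₂ d = contradiction d (∤-∏ pN dich' N ≤-refl)
    where
    dich' : ∀ i → f i ≡ 1 ⊎ f i ≡ i × Prime i
    dich' i with dich i
    ... | inj₁ e = inj₁ e
    ... | inj₂ (e , p , _) = inj₂ (e , p)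

  ∏-cong-≤ : ∀ {f g} N → (∀ i → i < N → f i ≤ g i) → ∏ f N ≤ ∏ g N
  ∏-cong-≤ zero    h = ≤-refl
  ∏-cong-≤ (suc N) h = *-mono-≤ (∏-cong-≤ N (λ i lt → h i (<-trans lt (n<1+n N)))) (h N ≤-refl)

  ∏-* : ∀ f g N → ∏ (λ i → f i * g i) N ≡ ∏ f N * ∏ g N
  ∏-* f g zero    = refl
  ∏-* f g (suc N) = trans (cong (_* (f N * g N)) (∏-* f g N)) (lem (∏ f N) (∏ g N) (f N) (g N))
    where
    lem : ∀ a b c d → a * b * (c * d) ≡ a * c * (b * d)
    lem = solve-∀

  ∏-tail : ∀ {f} s k → (∀ i → s ≤ i → f i ≤ 1) → ∏ f (k + s) ≤ ∏ f s
  ∏-tail s zero    h = ≤-refl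
  ∏-tail {f} s (suc k) h = ≤-trans (*-mono-≤ (∏-tail s k h) (h (k + s) (m≤n+m s k))) (≤-reflexive (*-identityʳ _))

  ∏-const : ∀ c N → ∏ (λ _ → c) N ≡ c ^ N
  ∏-const c zero    = refl
  ∏-const c (suc N) = trans (cong (_* c) (∏-const c N)) (*-comm (c ^ N) c)

  n∣n! : ∀ n → .{{NonZero n}} → n ∣ n !
  n∣n! (suc n) = m∣m*n (n !)

  prime∣bin : ∀ {p} → Prime p → ∀ a b → a < p → b < p → p ≤ a + b → p ∣ bin a b
  prime∣bin {p} pp a b a<p b<p p≤ with euclidsLemma (bin a b) (a ! * b !) pp
      (subst (p ∣_) (sym (bin-! a b)) (∣-trans (n∣n! p {{prime⇒nonZero pp}}) (m≤n⇒m!∣n! p≤)))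
  ... | inj₁ d = d
  ... | inj₂ d = contradiction d (∤* pp (∤! pp a a<p) (∤! pp b b<p))

  -- The new factors p c + 1, ..., p c + u are prime to p, so they all go into w and leave z alone.
  !-shift : ∀ {p} → Prime p → ∀ c z {w} → (p * c) ! ≡ z * w → p ∤ w →
    ∀ u → u < p → ∃[ w' ] (p * c + u) ! ≡ z * w' × p ∤ w'
  !-shift {p} pp c z {w} eq p∤w zero lt = w , trans (cong _! (+-identityʳ (p * c))) eq , p∤w
  !-shift {p} pp c z eq p∤w (suc u) lt with !-shift pp c z eq p∤w u (<-trans (n<1+n u) lt)
  ... | w' , eq' , p∤w' = suc (p * c + u) * w' ,
    trans (cong _! (+-suc (p * c) u))
      (trans (cong (suc (p * c + u) *_) eq') (lem (suc (p * c + u)) z w')) ,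
    ∤* pp (λ d → >⇒∤ lt (∣m+n∣m⇒∣n (subst (p ∣_) (sym (+-suc (p * c) u)) d) (m∣m*n c))) p∤w'
    where
    lem : ∀ a b c → a * (b * c) ≡ b * (a * c)
    lem = solve-∀

  -- With m = p + u, the prime p divides (2m)! exactly twice and m! exactly once.
  prime∤central : ∀ {p} → Prime p → ∀ u → 2 < p → u + u < p → p ∤ bin (p + u) (p + u)
  prime∤central {zero} pp u 2<p 2u<p d = ¬prime[0] pp
  prime∤central {p@(suc q)} pp u 2<p 2u<p d =
    p∤w₄ (subst (p ∣_) eq (∣m⇒∣m*n (w₂ * w₂) d))
    where
    u<p : u < p
    u<p = ≤-<-trans (m≤m+n u u) 2u<p
    w₁ : ∀ v → v < p → ∃[ w ] (p * 1 + v) ! ≡ p * w × p ∤ w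
    w₁ = !-shift pp 1 p {q !} (cong _! (*-identityʳ p)) (∤! pp q ≤-refl)
    w₂ = proj₁ (w₁ u u<p)
    w₂-eq : (p + u) ! ≡ p * w₂
    w₂-eq = trans (cong (λ n → (n + u) !) (sym (*-identityʳ p))) (proj₁ (proj₂ (w₁ u u<p)))
    wq = w₁ q ≤-refl
    [2p]! : (p * 2) ! ≡ p * p * (2 * proj₁ wq)
    [2p]! = begin
      (p * 2) !                      ≡⟨ cong _! (lem₁ q) ⟩
      suc (p * 1 + q) * (p * 1 + q) ! ≡⟨ cong (suc (p * 1 + q) *_) (proj₁ (proj₂ wq)) ⟩
      suc (p * 1 + q) * (p * proj₁ wq) ≡⟨ lem₂ q (proj₁ wq) ⟩
      p * p * (2 * proj₁ wq) ∎
      where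
      open ≡-Reasoning
      lem₁ : ∀ q → suc q * 2 ≡ suc (suc q * 1 + q)
      lem₁ = solve-∀
      lem₂ : ∀ q w → suc (suc q * 1 + q) * (suc q * w) ≡ suc q * suc q * (2 * w)
      lem₂ = solve-∀
    -- The cofactor of p² in (2p)! contains the 2 of the last factor 2p; `2<p` keeps it prime to p.
    w₃ = !-shift pp 2 (p * p) [2p]! (∤* pp (>⇒∤ 2<p) (proj₂ (proj₂ wq))) (u + u) 2u<p
    w₄ = proj₁ w₃
    p∤w₄ = proj₂ (proj₂ w₃)
    eq : bin (p + u) (p + u) * (w₂ * w₂) ≡ w₄
    eq = *-cancelˡ-≡ _ _ (p * p) (begin
      p * p * (B * (w₂ * w₂))        ≡⟨ lem₁ p B w₂ ⟩
      B * (p * w₂ * (p * w₂))        ≡⟨ cong (λ x → B * (x * x)) w₂-eq ⟨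
      B * ((p + u) ! * (p + u) !)    ≡⟨ bin-! (p + u) (p + u) ⟩
      ((p + u) + (p + u)) !          ≡⟨ cong _! (lem₂ p u) ⟩
      (p * 2 + (u + u)) !            ≡⟨ proj₁ (proj₂ w₃) ⟩
      p * p * w₄                     ∎)
      where
      open ≡-Reasoning
      B = bin (p + u) (p + u)
      lem₁ : ∀ p b w → p * p * (b * (w * w)) ≡ b * (p * w * (p * w))
      lem₁ = solve-∀
      lem₂ : ∀ p u → (p + u) + (p + u) ≡ p * 2 + (u + u)
      lem₂ = solve-∀

-- Erdős' upper bounds for the primorial and for the central binomial coefficient.

module CentralBinomial where

  open Binomial
  open PrimeDivisors
  open import Data.Nat using (ℕ; zero; suc; _+_; _*_; _∸_; _^_; _!; _≤_; _<_; _≤?_; _<?_; z≤n; s≤s; >-nonZero)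
  open import Data.Nat.Properties
  open import Data.Nat.Divisibility
  open import Data.Nat.Induction using (<-rec)
  open import Data.Nat.Primality using (Prime; prime?; prime⇒nonZero)
  open import Data.Nat.Tactic.RingSolver using (solve-∀)
  open import Data.Product using (∃-syntax; _×_; _,_)
  open import Data.Sum using (_⊎_; inj₁; inj₂)
  open import Relation.Nullary using (¬_; yes; no; contradiction)
  open import Relation.Nullary.Decidable using (_×-dec_)
  open import Relation.Binary.PropositionalEquality

  primesIn : ℕ → ℕ → ℕ → ℕ
  primesIn a b i with prime? i ×-dec a <? i ×-dec i ≤? b
  ... | yes _ = i
  ... | no  _ = 1

  primesIn-dich : ∀ a b i → primesIn a b i ≡ 1 ⊎ primesIn a b i ≡ i × Prime i × a < i × i ≤ b
  primesIn-dich a b i with prime? i ×-dec a <? i ×-dec i ≤? b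
  ... | yes h = inj₂ (refl , h)
  ... | no  _ = inj₁ refl

  primesIn-≡ : ∀ {a b i} → Prime i → a < i → i ≤ b → primesIn a b i ≡ i
  primesIn-≡ {a} {b} {i} p l u with prime? i ×-dec a <? i ×-dec i ≤? b
  ... | yes _ = refl
  ... | no ¬h = contradiction (p , l , u) ¬h

  primesIn>0 : ∀ a b i → 0 < primesIn a b i
  primesIn>0 a b i with primesIn-dich a b i
  ... | inj₁ e = ≤-reflexive (sym e)
  ... | inj₂ (e , p , _) = subst (0 <_) (sym e) (<⇒≤ (prime>1 p))

  -- Because b ≤ a, a prime above a divides neither factorial of the denominator.
  ∏primesIn-∣bin : ∀ a b → b ≤ a → ∀ N → ∏ (primesIn a (b + a)) N ∣ bin b a
  ∏primesIn-∣bin a b b≤a = ∏-∣ dich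
    where
    dich : ∀ i → primesIn a (b + a) i ≡ 1 ⊎ primesIn a (b + a) i ≡ i × Prime i × i ∣ bin b a
    dich i with primesIn-dich a (b + a) i
    ... | inj₁ e = inj₁ e
    ... | inj₂ (e , p , l , u) = inj₂ (e , p , prime∣bin p b a (≤-<-trans b≤a l) l u)

  ∏primesIn-≤bin : ∀ a b → b ≤ a → ∀ N → ∏ (primesIn a (b + a)) N ≤ bin b a
  ∏primesIn-≤bin a b b≤a N = ∣⇒≤ {{>-nonZero (bin>0 b a)}} (∏primesIn-∣bin a b b≤a N)

  ∏primesIn-tail : ∀ m N → suc m ≤ N → ∏ (primesIn 0 m) N ≤ ∏ (primesIn 0 m) (suc m)
  ∏primesIn-tail m N le = subst (λ n → ∏ (primesIn 0 m) n ≤ _) (m∸n+n≡m le)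
    (∏-tail (suc m) (N ∸ suc m) λ i m<i → small i m<i)
    where
    small : ∀ i → suc m ≤ i → primesIn 0 m i ≤ 1
    small i m<i with primesIn-dich 0 m i
    ... | inj₁ e = ≤-reflexive e
    ... | inj₂ (_ , _ , _ , i≤m) = contradiction i≤m (<⇒≱ m<i)

  primorial : ℕ → ℕ
  primorial n = ∏ (primesIn 0 n) (suc n)

  primorial-+ : ∀ m b → b ≤ m → primorial (b + m) ≤ primorial m * bin b m
  primorial-+ m b b≤m = begin
    ∏ (primesIn 0 (b + m)) (suc (b + m))
      ≤⟨ ∏-cong-≤ (suc (b + m)) (λ i _ → split i) ⟩
    ∏ (λ i → primesIn 0 m i * primesIn m (b + m) i) (suc (b + m))
      ≡⟨ ∏-* (primesIn 0 m) (primesIn m (b + m)) (suc (b + m)) ⟩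
    ∏ (primesIn 0 m) (suc (b + m)) * ∏ (primesIn m (b + m)) (suc (b + m))
      ≤⟨ *-mono-≤ (∏primesIn-tail m (suc (b + m)) (s≤s (m≤n+m m b))) (∏primesIn-≤bin m b b≤m (suc (b + m))) ⟩
    primorial m * bin b m ∎
    where
    open ≤-Reasoning
    split : ∀ i → primesIn 0 (b + m) i ≤ primesIn 0 m i * primesIn m (b + m) i
    split i with primesIn-dich 0 (b + m) i
    ... | inj₁ e = subst (_≤ primesIn 0 m i * primesIn m (b + m) i) (sym e) (*-mono-≤ {1} {_} {1} (primesIn>0 0 m i) (primesIn>0 m (b + m) i))
    ... | inj₂ (e , p , l , u) with ≤-<-connex i m
    ...   | inj₁ i≤m = ≤-trans (≤-reflexive (trans e (sym (primesIn-≡ p l i≤m))))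
              (m≤m*n _ _ {{>-nonZero (primesIn>0 m (b + m) i)}})
    ...   | inj₂ m<i = ≤-trans (≤-reflexive (trans e (sym (primesIn-≡ p m<i u))))
              (m≤n*m _ _ {{>-nonZero (primesIn>0 0 m i)}})

  -- The saving of a factor 2 over 4^(m + 1) is needed for `bin-half-≤`: C(2m + 1, m) is half of
  -- this coefficient and has to stay below 4^m.
  central-suc-≤ : ∀ m → bin (suc m) (suc m) ≤ 2 * 4 ^ m
  central-suc-≤ zero    = s≤s (s≤s z≤n)
  central-suc-≤ (suc m) = *-cancelˡ-≤ (suc (suc m)) (begin
    suc n * bin (suc n) (suc n)            ≡⟨ cong (λ z → suc n * (z + bin (suc n) n)) (bin-sym n (suc n)) ⟩
    suc n * (bin (suc n) n + bin (suc n) n) ≡⟨ lem₃ n (bin (suc n) n) ⟩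
    2 * (suc n * bin (suc n) n)            ≡⟨ cong (2 *_) (bin-absorb n n) ⟩
    2 * (suc (n + n) * bin n n)            ≤⟨ *-monoʳ-≤ 2 (*-mono-≤ (≤-trans (n≤1+n _) (≤-reflexive (cong suc (sym (+-suc n n))))) (central-suc-≤ m)) ⟩
    2 * ((suc n + suc n) * (2 * 4 ^ m))      ≡⟨ lem₄ n (4 ^ m) ⟩
    suc n * (2 * (4 * 4 ^ m))              ∎)
    where
    open ≤-Reasoning
    n = suc m
    lem₃ : ∀ m x → suc m * (x + x) ≡ 2 * (suc m * x)
    lem₃ = solve-∀
    lem₄ : ∀ n x → 2 * ((suc n + suc n) * (2 * x)) ≡ suc n * (2 * (4 * x))
    lem₄ = solve-∀

  bin-half-≤ : ∀ m → bin m (suc m) ≤ 4 ^ m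
  bin-half-≤ m = *-cancelˡ-≤ 2 (begin
    2 * bin m (suc m)                ≡⟨ cong (bin m (suc m) +_) (+-identityʳ _) ⟩
    bin m (suc m) + bin m (suc m)    ≡⟨ cong (bin m (suc m) +_) (bin-sym m (suc m)) ⟩
    bin (suc m) (suc m)              ≤⟨ central-suc-≤ m ⟩
    2 * 4 ^ m                        ∎)
    where open ≤-Reasoning

  central-≤ : ∀ m → bin m m ≤ 4 ^ m
  central-≤ zero    = ≤-refl
  central-≤ (suc m) = ≤-trans (central-suc-≤ m) (*-monoˡ-≤ (4 ^ m) {2} {4} (s≤s (s≤s z≤n)))

  parity : ∀ n → ∃[ m ] (n ≡ m + m ⊎ n ≡ m + suc m)
  parity zero = 0 , inj₁ refl
  parity (suc n) with parity n
  ... | m , inj₁ e = m , inj₂ (trans (cong suc e) (sym (+-suc m m)))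
  ... | m , inj₂ e = suc m , inj₁ (cong suc e)

  -- Halving: n = 2m is split at m and n = 2m + 1 at m + 1. In both cases the primes above the cut
  -- divide a binomial coefficient that is at most 4^m.
  primorial-≤ : ∀ n → primorial n ≤ 4 ^ n
  primorial-≤ = <-rec _ go
    where
    go : ∀ n → (∀ {m} → m < n → primorial m ≤ 4 ^ m) → primorial n ≤ 4 ^ n
    go n rec with parity n
    ... | zero , inj₁ refl = ≤-refl
    ... | zero , inj₂ refl = s≤s z≤n
    ... | m@(suc m') , inj₁ refl = begin
      primorial (m + m)      ≤⟨ primorial-+ m m ≤-refl ⟩
      primorial m * bin m m  ≤⟨ *-mono-≤ (rec (m<m+n m (s≤s z≤n))) (central-≤ m) ⟩
      4 ^ m * 4 ^ m          ≡⟨ ^-distribˡ-+-* 4 m m ⟨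
      4 ^ (m + m)            ∎
      where open ≤-Reasoning
    ... | m@(suc m') , inj₂ refl = begin
      primorial (m + suc m)             ≤⟨ primorial-+ (suc m) m (n≤1+n m) ⟩
      primorial (suc m) * bin m (suc m) ≤⟨ *-mono-≤ (rec (m<n+m (suc m) (s≤s z≤n))) (bin-half-≤ m) ⟩
      4 ^ suc m * 4 ^ m                 ≡⟨ *-comm (4 ^ suc m) _ ⟩
      4 ^ m * 4 ^ suc m                 ≡⟨ ^-distribˡ-+-* 4 m (suc m) ⟨
      4 ^ (m + suc m)                   ∎
      where open ≤-Reasoning

  below : ℕ → ℕ → ℕ → ℕ
  below s c i with i <? s
  ... | yes _ = c
  ... | no  _ = 1

  below-< : ∀ {s c i} → i < s → below s c i ≡ c
  below-< {s} {c} {i} lt with i <? s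
  ... | yes _ = refl
  ... | no ¬h = contradiction lt ¬h

  below-≥ : ∀ {s c i} → s ≤ i → below s c i ≡ 1
  below-≥ {s} {c} {i} ge with i <? s
  ... | yes h = contradiction ge (<⇒≱ h)
  ... | no _ = refl

  below>0 : ∀ s {c} i → 0 < c → 0 < below s c i
  below>0 s i 0<c with i <? s
  ... | yes _ = 0<c
  ... | no  _ = s≤s z≤n

  ∏below : ∀ s c N → s ≤ N → ∏ (below s c) N ≤ c ^ s
  ∏below s c N le = begin
    ∏ (below s c) N             ≡⟨ cong (∏ (below s c)) (m∸n+n≡m le) ⟨
    ∏ (below s c) (N ∸ s + s)   ≤⟨ ∏-tail s (N ∸ s) (λ i h → ≤-reflexive (below-≥ h)) ⟩
    ∏ (below s c) s             ≤⟨ ∏-cong-≤ s (λ i h → ≤-reflexive (below-< h)) ⟩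
    ∏ (λ _ → c) s               ≡⟨ ∏-const c s ⟩
    c ^ s                       ∎
    where open ≤-Reasoning

  -- If no prime lies in (D + M, 2M], then a prime p dividing C(2M, M) is at most
  -- A, where A ≥ 2M / 3, or lies in (M, D + M] and divides C(D + M, D); only the p < s
  -- can divide it more than once.
  central-≤-if-prime-free : ∀ A D M s → 2 ≤ A → D ≤ M → M + M ≤ A + A + A → A ≤ M →
    suc (M + M) < s * s → s ≤ M + M →
    (∀ p → Prime p → D + M < p → ¬ p ≤ M + M) →
    bin M M ≤ suc (M + M) ^ s * (4 ^ A * bin D M)
  central-≤-if-prime-free A D M s 2≤A D≤M 2M≤3A A≤M N<s² s≤ noPrime = begin
    bin M M           ≤⟨ ≤-∏ {f} f>0 (suc N) (bin M M) (bin>0 M M) small bound ⟩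
    ∏ f (suc N)       ≡⟨ trans (∏-* f₁ f₂₃ (suc N)) (cong (∏ f₁ (suc N) *_) (∏-* f₂ f₃ (suc N))) ⟩
    ∏ f₁ (suc N) * (∏ f₂ (suc N) * ∏ f₃ (suc N))
      ≤⟨ *-mono-≤ (∏below s N (suc N) (m≤n⇒m≤1+n (m≤n⇒m≤1+n s≤)))
           (*-mono-≤ (≤-trans (∏primesIn-tail A (suc N) (s≤s (≤-trans A≤M (≤-trans (m≤m+n M M) (n≤1+n _))))) (primorial-≤ A))
                     (∏primesIn-≤bin M D D≤M (suc N))) ⟩
    N ^ s * (4 ^ A * bin D M) ∎
    where
    open ≤-Reasoning
    N = suc (M + M)
    -- Three caps for the prime powers in C(2M, M): N for p < s, and p itself for p ≤ A and for M <
    -- p ≤ D + M. They may overlap, but all values are at least 1, so the product dominates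
    -- whichever cap applies.
    f₁ = below s N
    f₂ = primesIn 0 A
    f₃ = primesIn M (D + M)
    f₂₃ : ℕ → ℕ
    f₂₃ i = f₂ i * f₃ i
    f : ℕ → ℕ
    f i = f₁ i * f₂₃ i
    f₁>0 : ∀ i → 0 < f₁ i
    f₁>0 i = below>0 s i (s≤s z≤n)
    f₂₃>0 : ∀ i → 0 < f₂₃ i
    f₂₃>0 i = *-mono-≤ (primesIn>0 0 A i) (primesIn>0 M (D + M) i)
    f>0 : ∀ i → 0 < f i
    f>0 i = *-mono-≤ (f₁>0 i) (f₂₃>0 i)
    f₁≤f : ∀ i → f₁ i ≤ f i
    f₁≤f i = m≤m*n (f₁ i) (f₂₃ i) {{>-nonZero (f₂₃>0 i)}}
    f₂≤f : ∀ i → f₂ i ≤ f i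
    f₂≤f i = ≤-trans (m≤m*n (f₂ i) (f₃ i) {{>-nonZero (primesIn>0 M (D + M) i)}}) (m≤n*m (f₂₃ i) (f₁ i) {{>-nonZero (f₁>0 i)}})
    f₃≤f : ∀ i → f₃ i ≤ f i
    f₃≤f i = ≤-trans (m≤n*m (f₃ i) (f₂ i) {{>-nonZero (primesIn>0 0 A i)}}) (m≤n*m (f₂₃ i) (f₁ i) {{>-nonZero (f₁>0 i)}})
    small : ∀ p → Prime p → p ∣ bin M M → p < suc N
    small p pp d = s≤s (subst (_≤ N) (*-identityʳ p) (prime^∣bin⇒≤ pp 1 M M (subst (_∣ bin M M) (sym (*-identityʳ p)) d)))
    divisor-≤ : ∀ p → Prime p → p ∣ bin M M → p ≤ f p
    divisor-≤ p pp d with ≤-<-connex p A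
    ... | inj₁ p≤A = subst (_≤ f p) (primesIn-≡ pp (<⇒≤ (prime>1 pp)) p≤A) (f₂≤f p)
    ... | inj₂ A<p with ≤-<-connex p M
    -- For A < p ≤ M write M = p + u; then 2u < p, because 2M ≤ 3A < 3p.
    ...   | inj₁ p≤M = contradiction (subst (λ m → p ∣ bin m m) (sym (m+[n∸m]≡n p≤M)) d)
              (prime∤central pp (M ∸ p) (≤-<-trans 2≤A A<p) lt)
      where
      lt : (M ∸ p) + (M ∸ p) < p
      lt = +-cancelˡ-< (p + p) _ _ (begin-strict
        p + p + ((M ∸ p) + (M ∸ p))    ≡⟨ lem p (M ∸ p) ⟩
        (p + (M ∸ p)) + (p + (M ∸ p))  ≡⟨ cong (λ m → m + m) (m+[n∸m]≡n p≤M) ⟩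
        M + M                          ≤⟨ 2M≤3A ⟩
        A + A + A                      <⟨ +-mono-< (+-mono-< A<p A<p) A<p ⟩
        p + p + p                      ∎)
        where
        lem : ∀ p u → p + p + (u + u) ≡ (p + u) + (p + u)
        lem = solve-∀
    ...   | inj₂ M<p with ≤-<-connex p (D + M)
    ...     | inj₁ p≤ = subst (_≤ f p) (primesIn-≡ pp M<p p≤) (f₃≤f p)
    ...     | inj₂ <p with ≤-<-connex p (M + M)
    ...       | inj₁ p≤2M = contradiction p≤2M (noPrime p pp <p)
    ...       | inj₂ 2M<p = contradiction
                (∣-trans d (subst (bin M M ∣_) (bin-! M M) (m∣m*n (M ! * M !))))
                (∤! pp (M + M) 2M<p)
    bound : ∀ p e → Prime p → p ^ e ∣ bin M M → p ^ e ≤ f p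
    bound p e pp d with <-≤-connex p s | e
    ... | inj₁ p<s | e = ≤-trans (subst (p ^ e ≤_) (sym (below-< p<s)) (prime^∣bin⇒≤ pp e M M d)) (f₁≤f p)
    ... | inj₂ s≤p | 0 = f>0 p
    ... | inj₂ s≤p | 1 = subst (_≤ f p) (sym (*-identityʳ p)) (divisor-≤ p pp (subst (_∣ bin M M) (*-identityʳ p) d))
    ... | inj₂ s≤p | suc (suc e) = contradiction (prime^∣bin⇒≤ pp (suc (suc e)) M M d) (<⇒≱ (begin-strict
      N                <⟨ N<s² ⟩
      s * s            ≤⟨ *-mono-≤ s≤p (≤-trans s≤p (m≤m*n p (p ^ e) {{m^n≢0 p e {{prime⇒nonZero pp}}}})) ⟩
      p * (p * p ^ e)  ∎))

-- A prime between 48t and 84t.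

module PrimeInInterval where

  open Binomial
  open PrimeDivisors
  open CentralBinomial
  open import Data.Nat using (zero; suc; _+_; _*_; _^_; _≤_; _<_; _<?_; z≤n; s≤s; >-nonZero)
  open import Data.Nat.Properties
  open import Data.Nat.Primality using (Prime; prime?)
  open import Data.Nat.Tactic.RingSolver using (solve-∀)
  open import Data.Product using (∃-syntax; _×_; _,_)
  open import Relation.Nullary using (¬_; yes; no; contradiction)
  open import Relation.Nullary.Decidable using (_×-dec_)
  open import Relation.Binary.PropositionalEquality
  open import Data.Unit using (tt)

  ^-distribʳ : ∀ a b t → (a * b) ^ t ≡ a ^ t * b ^ t
  ^-distribʳ a b zero    = refl
  ^-distribʳ a b (suc t) = trans (cong (a * b *_) (^-distribʳ a b t)) (lem a b (a ^ t) (b ^ t))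
    where
    lem : ∀ a b c d → a * b * (c * d) ≡ a * c * (b * d)
    lem = solve-∀

  -- The constants are those of 4^42 7^42 ≥ 2 · 4^28 8^48.
  2^t≤ : ∀ t s → 1 ≤ t → suc (42 * t + 42 * t) < s * s → s ≤ 42 * t + 42 * t →
    (∀ p → Prime p → 48 * t < p → ¬ p ≤ 42 * t + 42 * t) →
    2 ^ t ≤ suc (42 * t + 42 * t) ^ suc s
  2^t≤ t s 1≤t N<s² s≤ none = *-cancelʳ-≤ _ _ (4 ^ A * 8 ^ C) {{m*n≢0 _ _ {{m^n≢0 4 A}} {{m^n≢0 8 C}}}} (begin
    2 ^ t * (4 ^ A * 8 ^ C)
      ≡⟨ cong (2 ^ t *_) (cong₂ _*_ (sym (^-*-assoc 4 28 t)) (sym (^-*-assoc 8 48 t))) ⟩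
    2 ^ t * ((4 ^ 28) ^ t * (8 ^ 48) ^ t)
      ≡⟨ trans (cong (2 ^ t *_) (sym (^-distribʳ (4 ^ 28) (8 ^ 48) t))) (sym (^-distribʳ 2 (4 ^ 28 * 8 ^ 48) t)) ⟩
    (2 * (4 ^ 28 * 8 ^ 48)) ^ t
      ≤⟨ ^-monoˡ-≤ t (≤ᵇ⇒≤ (2 * (4 ^ 28 * 8 ^ 48)) (4 ^ 42 * 7 ^ 42) tt) ⟩
    (4 ^ 42 * 7 ^ 42) ^ t
      ≡⟨ trans (^-distribʳ (4 ^ 42) (7 ^ 42) t) (cong₂ _*_ (^-*-assoc 4 42 t) (^-*-assoc 7 42 t)) ⟩
    4 ^ M * 7 ^ M
      ≤⟨ *-monoˡ-≤ (7 ^ M) (4^≤central M) ⟩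
    suc (M + M) * bin M M * 7 ^ M
      ≤⟨ *-monoˡ-≤ (7 ^ M) (*-monoʳ-≤ (suc (M + M)) (central-≤-if-prime-free A D M s 2≤A D≤M 2M≤3A A≤M N<s² s≤ none')) ⟩
    N * (N ^ s * (4 ^ A * bin D M)) * 7 ^ M
      ≡⟨ lem N (N ^ s) (4 ^ A) (bin D M) (7 ^ M) ⟩
    N * N ^ s * (4 ^ A * (bin D M * (1 * 7 ^ M)))
      ≡⟨ cong (λ z → N * N ^ s * (4 ^ A * (bin D M * (z * 7 ^ M)))) (^-zeroˡ D) ⟨
    N * N ^ s * (4 ^ A * (bin D M * (1 ^ D * 7 ^ M)))
      ≤⟨ *-monoʳ-≤ (N ^ suc s) (*-monoʳ-≤ (4 ^ A) (bin-^-≤ 1 7 D M)) ⟩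
    N ^ suc s * (4 ^ A * 8 ^ (D + M))
      ≡⟨ cong (λ n → N ^ suc s * (4 ^ A * 8 ^ n)) (*-distribʳ-+ t 6 42) ⟨
    N ^ suc s * (4 ^ A * 8 ^ C) ∎)
    where
    open ≤-Reasoning
    A = 28 * t
    C = 48 * t
    D = 6 * t
    M = 42 * t
    N = suc (M + M)
    lem : ∀ n x a b c → n * (x * (a * b)) * c ≡ n * x * (a * (b * (1 * c)))
    lem = solve-∀
    mono : ∀ {a b} → a ≤ b → a * t ≤ b * t
    mono = *-monoˡ-≤ t
    2≤A : 2 ≤ A
    2≤A = *-mono-≤ {2} {28} {1} {t} (≤ᵇ⇒≤ 2 28 tt) 1≤t
    D≤M : D ≤ M
    D≤M = mono (≤ᵇ⇒≤ 6 42 tt)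
    A≤M : A ≤ M
    A≤M = mono (≤ᵇ⇒≤ 28 42 tt)
    2M≤3A : M + M ≤ A + A + A
    2M≤3A = ≤-reflexive (trans (sym (*-distribʳ-+ t 42 42)) (trans (*-distribʳ-+ t 56 28) (cong (_+ 28 * t) (*-distribʳ-+ t 28 28))))
    none' : ∀ p → Prime p → D + M < p → ¬ p ≤ M + M
    none' p pp lt = none p pp (subst (_< p) (sym (*-distribʳ-+ t 6 42)) lt)

  -- When q is the integer fourth root of t, the logarithm of 84t + 1 is at most 4q + 7 and its
  -- square root at most 10 (q + 1)². Both are polynomial in q, and their product is of order q³, to
  -- be compared with q^4 ≤ t.
  quartic-bound : ∀ q → 60 ≤ q → suc ((4 * q + 7) * suc (10 * (suc q * suc q))) ≤ q ^ 4
  quartic-bound q@(suc r) 60≤q = begin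
    suc ((4 * q + 7) * suc (10 * (suc q * suc q)))
      ≤⟨ m+n≤o⇒m≤o _ (≤-reflexive (lem r)) ⟩
    40 * (q * (q * q)) + 412 * (q * q)
      -- q ≥ 60 absorbs 412 q² into 20 q³, and the resulting 60 q³ into q^4.
      ≤⟨ +-monoʳ-≤ (40 * (q * (q * q))) (*-monoˡ-≤ (q * q) (≤-trans (≤ᵇ⇒≤ 412 1200 tt) (*-monoʳ-≤ 20 60≤q))) ⟩
    40 * (q * (q * q)) + 20 * q * (q * q)
      ≡⟨ lem′ q (q * q) ⟩
    60 * (q * (q * q))
      ≤⟨ *-monoˡ-≤ (q * (q * q)) 60≤q ⟩
    q * (q * (q * q))
      ≡⟨ cong (λ m → q * (q * (q * m))) (*-identityʳ q) ⟨
    q ^ 4 ∎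
    where
    open ≤-Reasoning
    lem : ∀ r → suc ((4 * suc r + 7) * suc (10 * (suc (suc r) * suc (suc r)))) + (340 * r + 262 * (r * r))
        ≡ 40 * (suc r * (suc r * suc r)) + 412 * (suc r * suc r)
    lem = solve-∀
    lem′ : ∀ a b → 40 * (a * b) + 20 * a * b ≡ 60 * (a * b)
    lem′ = solve-∀

  -- With 84 t + 1 ≤ 2^(4q + 7), s = 10 (q + 1)² and q⁴ ≤ t < (q + 1)⁴ the bound
  -- (84 t + 1)^(s + 1) is below 2^t for q ≥ 60.
  ∃-prime : ∀ t → 60 ^ 4 ≤ t → ∃[ p ] Prime p × 48 * t < p × p ≤ 84 * t
  ∃-prime t big with anyUpTo? (λ p → prime? p ×-dec 48 * t <? p) (suc (84 * t))
  ... | yes (p , lt , pp , gt) = p , pp , gt , ≤-pred lt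
  ... | no none with bracket (_^ 4) z≤n (suc t) (m≤m*n (suc t) (suc t ^ 3) {{m^n≢0 (suc t) 3}})
  ... | q , lo , hi = contradiction
    (2^t≤ t s 1≤t N<s² s≤ λ p pp gt le → none (p , s≤s (subst (p ≤_) (sym (*-distribʳ-+ t 42 42)) le) , pp , gt))
    (<⇒≱ (begin-strict
      suc (42 * t + 42 * t) ^ suc s ≤⟨ ^-monoˡ-≤ (suc s) N≤ ⟩
      (2 ^ (4 * q + 7)) ^ suc s     ≡⟨ ^-*-assoc 2 (4 * q + 7) (suc s) ⟩
      2 ^ ((4 * q + 7) * suc s)     <⟨ ^-monoʳ-< 2 (s≤s (s≤s z≤n)) (quartic-bound q 60≤q) ⟩
      2 ^ (q ^ 4)                   ≤⟨ ^-monoʳ-≤ 2 lo ⟩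
      2 ^ t                         ∎))
    where
    open ≤-Reasoning
    s = 10 * (suc q * suc q)
    60≤q : 60 ≤ q
    60≤q = ≮⇒≥ λ q<60 → <-irrefl refl (<-≤-trans hi (≤-trans (^-monoˡ-≤ 4 q<60) big))
    1≤t : 1 ≤ t
    1≤t = ≤-trans (≤ᵇ⇒≤ 1 (60 ^ 4) tt) big
    2M≡ : 42 * t + 42 * t ≡ 84 * t
    2M≡ = sym (*-distribʳ-+ t 42 42)
    sq : suc q ^ 4 ≡ (suc q * suc q) * (suc q * suc q)
    sq = lem (suc q)
      where
      lem : ∀ a → a * (a * (a * (a * 1))) ≡ (a * a) * (a * a)
      lem = solve-∀
    N≤100 : suc (42 * t + 42 * t) ≤ 84 * suc t
    N≤100 = begin
      suc (42 * t + 42 * t) ≡⟨ cong suc 2M≡ ⟩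
      1 + 84 * t            ≤⟨ +-monoˡ-≤ (84 * t) (≤ᵇ⇒≤ 1 84 tt) ⟩
      84 + 84 * t           ≡⟨ *-suc 84 t ⟨
      84 * suc t            ∎
    N<s² : suc (42 * t + 42 * t) < s * s
    N<s² = begin-strict
      suc (42 * t + 42 * t)     ≤⟨ N≤100 ⟩
      84 * suc t                <⟨ *-monoˡ-< (suc t) (≤ᵇ⇒≤ 85 100 tt) ⟩
      100 * suc t               ≤⟨ *-monoʳ-≤ 100 hi ⟩
      100 * suc q ^ 4           ≡⟨ cong (100 *_) sq ⟩
      100 * ((suc q * suc q) * (suc q * suc q)) ≡⟨ lem (suc q * suc q) ⟩
      s * s                     ∎
      where
      lem : ∀ a → 100 * (a * a) ≡ 10 * a * (10 * a)
      lem = solve-∀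
    s≤ : s ≤ 42 * t + 42 * t
    s≤ = begin
      s                          ≤⟨ n≤1+n s ⟩
      suc s                      ≤⟨ m≤n*m (suc s) (4 * q + 7) {{nz}} ⟩
      (4 * q + 7) * suc s        ≤⟨ <⇒≤ (quartic-bound q 60≤q) ⟩
      q ^ 4                      ≤⟨ lo ⟩
      t                          ≤⟨ m≤n*m t 84 ⟩
      84 * t                     ≡⟨ 2M≡ ⟨
      42 * t + 42 * t            ∎
      where
      nz = >-nonZero (≤-trans (≤ᵇ⇒≤ 1 7 tt) (m≤n+m 7 (4 * q)))
    N≤ : suc (42 * t + 42 * t) ≤ 2 ^ (4 * q + 7)
    N≤ = begin
      suc (42 * t + 42 * t)     ≤⟨ N≤100 ⟩
      84 * suc t                ≤⟨ *-mono-≤ (≤ᵇ⇒≤ 84 128 tt) hi ⟩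
      128 * suc q ^ 4           ≤⟨ *-monoʳ-≤ 128 (^-monoˡ-≤ 4 (n<p^n (s≤s (s≤s z≤n)) q)) ⟩
      128 * (2 ^ q) ^ 4         ≡⟨ cong (128 *_) (^-*-assoc 2 q 4) ⟩
      128 * 2 ^ (q * 4)         ≡⟨ cong (λ n → 128 * 2 ^ n) (*-comm q 4) ⟩
      2 ^ 7 * 2 ^ (4 * q)       ≡⟨ *-comm (2 ^ 7) (2 ^ (4 * q)) ⟩
      2 ^ (4 * q) * 2 ^ 7       ≡⟨ ^-distribˡ-+-* 2 (4 * q) 7 ⟨
      2 ^ (4 * q + 7)           ∎

-- From copies of paths and cycles to embeddings, and to periodic walks over ℕ.

module Copies where

  open import Defs
  open import Data.Empty using (⊥-elim)
  open import Data.Fin using (Fin; zero; suc; toℕ; fromℕ; opposite)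
  open import Data.Fin.Properties using (any?; toℕ-injective; toℕ<n; toℕ-fromℕ; toℕ-fromℕ<; opposite-prop) renaming (_≟_ to _≟ᶠ_)
  open import Data.Fin.Subset using (Subset; _∈_)
  open import Data.Fin.Subset.Properties using (x∈⁅x⁆; x∈⁅y⁆⇒x≡y; p⊆p∪q; q⊆p∪q)
  open import Data.List as List using (List; []; _∷_; length; map; filter; concatMap; _++_)
  open import Data.List.Membership.Propositional using () renaming (_∈_ to _∈ᴸ_)
  open import Data.List.Membership.Propositional.Properties using (∈-filter⁺; ∈-map⁺; ∈-map⁻; ∈-concatMap⁺; ∈-∃++; ∈-++⁻; ∈-++⁺ˡ; ∈-++⁺ʳ)
  open import Data.List.Properties using (length-++; length-map)
  open import Data.List.Extrema.Nat using (xs≤max)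
  open import Data.List.Relation.Unary.All as All using (All; []; _∷_)
  open import Data.List.Relation.Unary.Any as Any using (here; there)
  open import Data.List.Relation.Unary.AllPairs using ([]; _∷_)
  open import Data.List.Relation.Unary.Unique.Propositional using (Unique)
  open import Data.Nat using (ℕ; zero; suc; _+_; _*_; _≤_; _<_; z≤n; s≤s; NonZero; >-nonZero)
  open import Data.Nat.DivMod using (_mod_; _%_; _/_; m≡m%n+[m/n]*n; m%n<n; m<n⇒m%n≡m; [m+kn]%n≡m%n; n%n≡0; [m+n]%n≡m%n)
  open import Data.Nat.Divisibility using (divides; ∣m+n∣m⇒∣n; n∣m*n; >⇒∤)
  open import Data.Nat.Properties
  open import Data.Product using (∃-syntax; _×_; _,_; proj₁; proj₂)
  import Data.Sum
  open import Data.Sum using (_⊎_; inj₁; inj₂)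
  open import Data.Unit using (⊤)
  open import Data.Vec as Vec using (Vec; []; _∷_; lookup; tabulate)
  open import Data.Vec.Properties using (lookup∘tabulate; lookup⇒[]=; []=⇒lookup; lookup-map; tabulate∘lookup; tabulate-cong)
  open import Function using (_∘_)
  open import Relation.Binary.PropositionalEquality
  open import Relation.Nullary using (¬_; Dec; does; yes; no; contradiction)
  open import Relation.Nullary.Decidable using (_×-dec_; dec-true)

  private
    variable
      A B : Set
      h n : ℕ

  subsetOf : {P : Fin n → Set} → (∀ x → Dec (P x)) → Subset n
  subsetOf P? = tabulate λ x → does (P? x)

  ∈-subsetOf⁺ : {P : Fin n → Set} (P? : ∀ x → Dec (P x)) → ∀ {x} → P x → x ∈ subsetOf P?
  ∈-subsetOf⁺ P? {x} px = lookup⇒[]= x _ (trans (lookup∘tabulate _ x) (dec-true (P? x) px))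

  ∈-subsetOf⁻ : {P : Fin n → Set} (P? : ∀ x → Dec (P x)) → ∀ {x} → x ∈ subsetOf P? → P x
  ∈-subsetOf⁻ P? {x} x∈ with P? x | trans (sym (lookup∘tabulate (λ x → does (P? x)) x)) ([]=⇒lookup x∈)
  ... | yes px | _ = px
  ... | no _   | ()

  -- R is consulted only at pairs i < j, hence the symmetry assumption in the two adjacency lemmas
  -- that follow.
  graphOf : {R : Fin n → Fin n → Set} → (∀ i j → Dec (R i j)) → Graph n
  graphOf {zero}  R? = ∅
  graphOf {suc n} R? = subsetOf (λ j → R? zero (suc j)) ◃ graphOf (λ i j → R? (suc i) (suc j))

  adj-graphOf⁺ : {R : Fin n → Fin n → Set} (R? : ∀ i j → Dec (R i j)) →
    (∀ i j → R i j → R j i) → (∀ i → ¬ R i i) → ∀ i j → R i j → Adj (graphOf R?) i j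
  adj-graphOf⁺ R? s irr zero    zero    r = irr zero r
  adj-graphOf⁺ R? s irr zero    (suc j) r = ∈-subsetOf⁺ (λ j → R? zero (suc j)) r
  adj-graphOf⁺ R? s irr (suc i) zero    r = ∈-subsetOf⁺ (λ j → R? zero (suc j)) (s _ _ r)
  adj-graphOf⁺ R? s irr (suc i) (suc j) r =
    adj-graphOf⁺ (λ i j → R? (suc i) (suc j)) (λ _ _ → s _ _) (λ _ → irr _) i j r

  adj-graphOf⁻ : {R : Fin n → Fin n → Set} (R? : ∀ i j → Dec (R i j)) →
    (∀ i j → R i j → R j i) → ∀ i j → Adj (graphOf R?) i j → R i j
  adj-graphOf⁻ R? s zero    (suc j) a = ∈-subsetOf⁻ (λ j → R? zero (suc j)) a
  adj-graphOf⁻ R? s (suc i) zero    a = s _ _ (∈-subsetOf⁻ (λ j → R? zero (suc j)) a)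
  adj-graphOf⁻ R? s (suc i) (suc j) a = adj-graphOf⁻ (λ i j → R? (suc i) (suc j)) (λ _ _ → s _ _) i j a

  path-adj⁺ : ∀ l (i j : Fin l) → toℕ j ≡ suc (toℕ i) → Adj (path l) i j
  path-adj⁺ (suc (suc l)) zero    (suc zero)    e = x∈⁅x⁆ zero
  path-adj⁺ (suc (suc l)) (suc i) (suc j)       e = path-adj⁺ (suc l) i j (cong Data.Nat.pred e)

  path-adj⁻ : ∀ l (i j : Fin l) → Adj (path l) i j → toℕ j ≡ suc (toℕ i) ⊎ toℕ i ≡ suc (toℕ j)
  path-adj⁻ (suc zero)    zero    zero    ()
  path-adj⁻ (suc (suc l)) zero    (suc j) a with refl ← x∈⁅y⁆⇒x≡y zero a = inj₁ refl
  path-adj⁻ (suc (suc l)) (suc i) zero    a with refl ← x∈⁅y⁆⇒x≡y zero a = inj₂ refl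
  path-adj⁻ (suc (suc l)) (suc i) (suc j) a with path-adj⁻ (suc l) i j a
  ... | inj₁ e = inj₁ (cong suc e)
  ... | inj₂ e = inj₂ (cong suc e)

  cycle-adj⁺ : ∀ k (i j : Fin (2 + k)) → toℕ j ≡ suc (toℕ i) → Adj (cycle (2 + k)) i j
  cycle-adj⁺ k zero    (suc zero) e = p⊆p∪q _ (x∈⁅x⁆ zero)
  cycle-adj⁺ k (suc i) (suc j)    e = path-adj⁺ (suc k) i j (cong Data.Nat.pred e)

  cycle-close : ∀ k (i j : Fin (2 + k)) → suc (toℕ i) ≡ 2 + k → toℕ j ≡ 0 → Adj (cycle (2 + k)) i j
  cycle-close k i@(suc i′) zero e refl = subst (λ x → Adj (cycle (2 + k)) x zero)
    (toℕ-injective {i = suc (fromℕ k)} {i} (trans (cong suc (toℕ-fromℕ k)) (cong Data.Nat.pred (sym e))))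
    (q⊆p∪q _ _ (x∈⁅x⁆ (fromℕ k)))

  record Embedding (H : Graph h) (G : Graph n) (v : Vec (Fin n) h) : Set where
    field
      injective : ∀ i j → lookup v i ≡ lookup v j → i ≡ j
      preserves : ∀ i j → Adj H i j → Adj G (lookup v i) (lookup v j)

  copy⇒embedding : {H : Graph h} {G : Graph n} → ∃[ X ] IsCopy H G X → ∃[ v ] Embedding H G v
  copy⇒embedding (X , sub , v , iso) = v , record
    { injective = injective
    ; preserves = λ i j a → proj₂ (proj₂ (sub _ _ (preserves i j a)))
    }
    where open IsIso iso

  module _ (H : Graph h) (v : Vec (Fin n) h) where

    private
      EdgeImage : Fin n → Fin n → Set
      EdgeImage x y = ∃[ i ] ∃[ j ] lookup v i ≡ x × lookup v j ≡ y × Adj H i j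

      edgeImage? : ∀ x y → Dec (EdgeImage x y)
      edgeImage? x y = any? λ i → any? λ j → (lookup v i ≟ᶠ x) ×-dec (lookup v j ≟ᶠ y) ×-dec adj? H i j

      vertexImage? : ∀ x → Dec (∃[ i ] lookup v i ≡ x)
      vertexImage? x = any? λ i → lookup v i ≟ᶠ x

      edgeImage-sym : ∀ x y → EdgeImage x y → EdgeImage y x
      edgeImage-sym x y (i , j , p , q , a) = j , i , q , p , adj-sym H i j a

    -- Only images of edges of H are kept, so that the candidate is isomorphic to H even where G has
    -- further edges among its vertices.
    image : Candidate n
    image = subsetOf vertexImage? , graphOf edgeImage?

    image-iso : (∀ i j → lookup v i ≡ lookup v j → i ≡ j) → IsIso H image v
    image-iso inj = record
      { injective = inj
      ; into      = λ i → ∈-subsetOf⁺ vertexImage? (i , refl)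
      ; onto      = λ x → ∈-subsetOf⁻ vertexImage?
      ; preserves = λ i j a → adj-graphOf⁺ edgeImage? edgeImage-sym irr _ _ (i , j , refl , refl , a)
      ; reflects  = λ i j a → refl′ i j (adj-graphOf⁻ edgeImage? edgeImage-sym _ _ a)
      }
      where
      irr : ∀ x → ¬ EdgeImage x x
      irr x (i , j , p , q , a) with refl ← inj i j (trans p (sym q)) = adj-irrefl H i a
      refl′ : ∀ i j → EdgeImage (lookup v i) (lookup v j) → Adj H i j
      refl′ i j (i′ , j′ , p , q , a) with refl ← inj i′ i p | refl ← inj j′ j q = a

    image-sub : (G : Graph n) → (∀ i j → Adj H i j → Adj G (lookup v i) (lookup v j)) → IsSubgraph G image
    image-sub G pres x y a with adj-graphOf⁻ edgeImage? edgeImage-sym x y a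
    ... | i , j , refl , refl , a′ =
      ∈-subsetOf⁺ vertexImage? (i , refl) , ∈-subsetOf⁺ vertexImage? (j , refl) , pres i j a′

  module _ (b : ℕ → ℕ) (N : ℕ)
    (step : ∀ i → suc i < N → b (suc i) ≡ suc (b i) ⊎ b i ≡ suc (b (suc i)))
    (noReturn : ∀ i → suc (suc i) < N → b i ≢ b (suc (suc i))) where

    -- A turn would bring the walk back to where it was two steps earlier. The induction carries two
    -- consecutive values because excluding a turn compares the next value with the last but one.
    ascend : b 1 ≡ suc (b 0) → ∀ i → i < N → b i ≡ i + b 0 × (suc i < N → b (suc i) ≡ suc i + b 0)
    ascend e zero lt = refl , λ _ → e
    ascend e (suc i) lt with ascend e i (<⇒≤ lt)
    ... | e₀ , e₁ = e₁ lt , next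
      where
      next : suc (suc i) < N → b (suc (suc i)) ≡ suc (suc i) + b 0
      next lt′ with step (suc i) lt′
      ... | inj₁ h = trans h (cong suc (e₁ lt))
      ... | inj₂ h = contradiction (trans e₀ (suc-injective (trans (sym (e₁ lt)) h))) (noReturn i lt′)

    descend : b 0 ≡ suc (b 1) → ∀ i → i < N → i + b i ≡ b 0 × (suc i < N → suc i + b (suc i) ≡ b 0)
    descend e zero lt = refl , λ _ → sym e
    descend e (suc i) lt with descend e i (<⇒≤ lt)
    ... | e₀ , e₁ = e₁ lt , next
      where
      next : suc (suc i) < N → suc (suc i) + b (suc (suc i)) ≡ b 0
      next lt′ with step (suc i) lt′
      ... | inj₂ h = trans (sym (+-suc (suc i) _)) (trans (cong (suc i +_) (sym h)) (e₁ lt))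
      ... | inj₁ h = contradiction (+-cancelˡ-≡ i _ _ (trans e₀ (trans (sym (e₁ lt)) (trans (sym (+-suc i _)) (cong (i +_) (sym h)))))) (noReturn i lt′)

  toℕ-mod : ∀ i m .{{_ : NonZero m}} → toℕ (i mod m) ≡ i % m
  toℕ-mod i m = toℕ-fromℕ< (m%n<n i m)

  mod-toℕ : ∀ m .{{_ : NonZero m}} (i : Fin m) → toℕ i mod m ≡ i
  mod-toℕ m i = toℕ-injective (trans (toℕ-mod (toℕ i) m) (m<n⇒m%n≡m (toℕ<n i)))

  -- Read along the path, π moves by ±1 and, being injective, never turns back, so it is monotone;
  -- running through l consecutive values below l, it must start at an end.
  path-rigid : ∀ l (π : Fin l → Fin l) → (∀ i j → π i ≡ π j → i ≡ j) →
    (∀ i j → Adj (path l) i j → Adj (path l) (π i) (π j)) →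
    (∀ i → π i ≡ i) ⊎ (∀ i → π i ≡ opposite i)
  path-rigid zero π inj pres = inj₁ λ ()
  path-rigid (suc zero) π inj pres = inj₁ λ { zero → lem (π zero) }
    where
    lem : (x : Fin 1) → x ≡ zero
    lem zero = refl
  path-rigid l@(suc (suc m)) π inj pres = go (step 0 (s≤s (s≤s z≤n)))
    where
    b : ℕ → ℕ
    b i = toℕ (π (i mod l))
    b-toℕ : ∀ i → b (toℕ i) ≡ toℕ (π i)
    b-toℕ i = cong (toℕ ∘ π) (mod-toℕ l i)
    step : ∀ i → suc i < l → b (suc i) ≡ suc (b i) ⊎ b i ≡ suc (b (suc i))
    step i lt = path-adj⁻ l _ _ (pres _ _ (path-adj⁺ l (i mod l) (suc i mod l)
      (trans (toℕ-mod (suc i) l) (trans (m<n⇒m%n≡m lt) (cong suc (sym (trans (toℕ-mod i l) (m<n⇒m%n≡m (<⇒≤ lt)))))))))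
    noReturn : ∀ i → suc (suc i) < l → b i ≢ b (suc (suc i))
    noReturn i lt e = m≢1+n+m i {1} (trans (sym (trans (toℕ-mod i l) (m<n⇒m%n≡m (<-trans (n<1+n i) (<⇒≤ lt)))))
      (trans (cong toℕ (inj _ _ (toℕ-injective e))) (trans (toℕ-mod (suc (suc i)) l) (m<n⇒m%n≡m lt))))
    b<l : ∀ i → b i < l
    b<l i = toℕ<n (π (i mod l))
    go : b 1 ≡ suc (b 0) ⊎ b 0 ≡ suc (b 1) → _
    go (inj₁ e) = inj₁ λ i → toℕ-injective (trans (sym (b-toℕ i)) (trans (proj₁ (up (toℕ i) (toℕ<n i))) (trans (cong (toℕ i +_) b0≡0) (+-identityʳ _))))
      where
      up = ascend b l step noReturn e
      b0≡0 : b 0 ≡ 0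
      b0≡0 = n≤0⇒n≡0 (+-cancelˡ-≤ (suc m) _ _ (≤-trans (≤-reflexive (sym (proj₁ (up (suc m) ≤-refl)))) (≤-trans (≤-pred (b<l (suc m))) (≤-reflexive (sym (+-identityʳ _))))))
    go (inj₂ e) = inj₂ λ i → toℕ-injective (+-cancelˡ-≡ (toℕ i) _ _
        (trans (cong (toℕ i +_) (sym (b-toℕ i))) (trans (proj₁ (down (toℕ i) (toℕ<n i)))
          (trans b0≡ (sym (trans (cong (toℕ i +_) (opposite-prop i)) (m+[n∸m]≡n (≤-pred (toℕ<n i)))))))))
      where
      down = descend b l step noReturn e
      b0≡ : b 0 ≡ suc m
      b0≡ = ≤-antisym (≤-pred (b<l 0)) (≤-trans (m≤m+n (suc m) _) (≤-reflexive (proj₁ (down (suc m) ≤-refl))))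

  reverseVec : Vec A n → Vec A n
  reverseVec v = tabulate λ i → lookup v (opposite i)

  lookup-ext : (v w : Vec A n) → (∀ i → lookup v i ≡ lookup w i) → v ≡ w
  lookup-ext v w e = trans (sym (tabulate∘lookup v)) (trans (tabulate-cong e) (tabulate∘lookup w))

  path-isos : ∀ {l} {X : Candidate n} {f v} → IsIso (path l) X f → IsIso (path l) X v → v ≡ f ⊎ v ≡ reverseVec f
  path-isos {l = l} {X} {f} {v} F V with path-rigid l π π-inj π-pres
    where
    module F = IsIso F
    module V = IsIso V
    π : Fin l → Fin l
    π i = proj₁ (F.onto (lookup v i) (V.into i))
    π-eq : ∀ i → lookup f (π i) ≡ lookup v i
    π-eq i = proj₂ (F.onto (lookup v i) (V.into i))
    π-inj : ∀ i j → π i ≡ π j → i ≡ j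
    π-inj i j e = V.injective i j (trans (sym (π-eq i)) (trans (cong (lookup f) e) (π-eq j)))
    π-pres : ∀ i j → Adj (path l) i j → Adj (path l) (π i) (π j)
    π-pres i j a = F.reflects _ _ (subst₂ (Adj (proj₂ X)) (sym (π-eq i)) (sym (π-eq j)) (V.preserves i j a))
  ... | inj₁ e = inj₁ (lookup-ext v f λ i → trans (sym (proj₂ (IsIso.onto F (lookup v i) (IsIso.into V i)))) (cong (lookup f) (e i)))
  ... | inj₂ e = inj₂ (lookup-ext v (reverseVec f) λ i → trans (sym (proj₂ (IsIso.onto F (lookup v i) (IsIso.into V i))))
          (trans (cong (lookup f) (e i)) (sym (lookup∘tabulate (λ i → lookup f (opposite i)) i))))

  unique-⊆-length : (xs ys : List A) → Unique xs → (∀ {x} → x ∈ᴸ xs → x ∈ᴸ ys) → length xs ≤ length ys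
  unique-⊆-length []       ys u sub = z≤n
  unique-⊆-length (x ∷ xs) ys (x∉ ∷ u) sub with ∈-∃++ (sub (here refl))
  ... | as , bs , refl = begin
    suc (length xs)             ≤⟨ s≤s (unique-⊆-length xs (as ++ bs) u sub′) ⟩
    suc (length (as ++ bs))     ≡⟨ cong suc (length-++ as) ⟩
    suc (length as + length bs) ≡⟨ +-suc (length as) _ ⟨
    length as + suc (length bs) ≡⟨ length-++ as ⟨
    length (as ++ x ∷ bs)       ∎
    where
    open ≤-Reasoning
    sub′ : ∀ {y} → y ∈ᴸ xs → y ∈ᴸ as ++ bs
    sub′ y∈ with ∈-++⁻ as (sub (there y∈))
    ... | inj₁ p = ∈-++⁺ˡ p
    ... | inj₂ (here refl) = ⊥-elim (All.lookup x∉ y∈ refl)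
    ... | inj₂ (there p) = ∈-++⁺ʳ as p

  length-concatMap-≤ : (g : A → List B) (c : ℕ) → (∀ x → length (g x) ≤ c) → ∀ xs → length (concatMap g xs) ≤ c * length xs
  length-concatMap-≤ g c h []       = z≤n
  length-concatMap-≤ g c h (x ∷ xs) = begin
    length (g x ++ concatMap g xs)        ≡⟨ length-++ (g x) ⟩
    length (g x) + length (concatMap g xs) ≤⟨ +-mono-≤ (h x) (length-concatMap-≤ g c h xs) ⟩
    c + c * length xs                     ≡⟨ *-suc c (length xs) ⟨
    c * suc (length xs)                   ∎
    where open ≤-Reasoning

  -- A copy of a path is the image of at most two embeddings, an embedding and its reversal.
  embeddings≤2*copies : ∀ {l} (G : Graph n) (L : List (Vec (Fin n) l)) → Unique L → All (Embedding (path l) G) L →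
    length L ≤ 2 * copies (path l) G
  embeddings≤2*copies {n} {l} G L u emb = ≤-trans (unique-⊆-length L _ u sub) (length-concatMap-≤ traversals 2 short cs)
    where
    cs : List (Candidate n)
    cs = filter (isCopy? (path l) G) (candidates n)
    traversals : Candidate n → List (Vec (Fin n) l)
    traversals X with isomorphic? (path l) X
    ... | yes (f , _) = f ∷ reverseVec f ∷ []
    ... | no _        = []
    short : ∀ X → length (traversals X) ≤ 2
    short X with isomorphic? (path l) X
    ... | yes _ = ≤-refl
    ... | no _  = z≤n
    ∈-traversals : ∀ {X v} → IsIso (path l) X v → v ∈ᴸ traversals X
    ∈-traversals {X} {v} iso with isomorphic? (path l) X
    ... | no ¬iso = contradiction (v , iso) ¬iso
    ... | yes (f , isoF) with path-isos isoF iso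
    ...   | inj₁ e = here e
    ...   | inj₂ e = there (here e)
    sub : ∀ {v} → v ∈ᴸ L → v ∈ᴸ concatMap traversals cs
    sub {v} v∈ = ∈-concatMap⁺ traversals {xs = cs} (Any.map (λ { refl → ∈-traversals iso }) X∈)
      where
      open Embedding (All.lookup emb v∈)
      iso = image-iso (path l) v injective
      X∈ : image (path l) v ∈ᴸ cs
      X∈ = ∈-filter⁺ (isCopy? (path l) G) (∈-candidates (image (path l) v)) (image-sub (path l) v G preserves , v , iso)

  copies≤ex : ∀ {f} (H : Graph h) (F : Graph f) (G : Graph n) → Free F G → copies H G ≤ ex n H F
  copies≤ex H F G free = All.lookup (xs≤max 0 _) (∈-map⁺ (copies H) (∈-filter⁺ (free? F) (∈-graphs G) free))

  -- A cycle on m vertices unrolled over ℕ: arguments can start anywhere and run past the end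
  -- without modular arithmetic.
  record CyclicWalk (m : ℕ) (R : A → A → Set) : Set where
    field
      at       : ℕ → A
      adjacent : ∀ i → R (at i) (at (suc i))
      periodic : ∀ i → at (i + m) ≡ at i
      distinct : ∀ i j → 0 < j → j < m → at i ≢ at (i + j)

  suc-% : ∀ i m .{{_ : NonZero m}} → suc (i % m) < m × suc i % m ≡ suc (i % m) ⊎ suc (i % m) ≡ m × suc i % m ≡ 0
  suc-% i m = Data.Sum.map
    (λ lt → lt , trans eq (m<n⇒m%n≡m lt))
    (λ e → e , trans eq (trans (cong (_% m) e) (n%n≡0 m)))
    (m≤n⇒m<n∨m≡n (m%n<n i m))
    where
    eq : suc i % m ≡ suc (i % m) % m
    eq = trans (cong (λ x → suc x % m) (m≡m%n+[m/n]*n i m)) ([m+kn]%n≡m%n (suc (i % m)) (i / m) m)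

  %-injective : ∀ i j m .{{_ : NonZero m}} → 0 < j → j < m → i % m ≢ (i + j) % m
  %-injective i j m 0<j j<m e = >⇒∤ {{>-nonZero 0<j}} j<m (∣m+n∣m⇒∣n (divides ((i + j) / m) eq) (n∣m*n (i / m)))
    where
    eq : i / m * m + j ≡ (i + j) / m * m
    eq = +-cancelˡ-≡ (i % m) _ _ (trans (sym (+-assoc (i % m) _ j))
      (trans (cong (_+ j) (sym (m≡m%n+[m/n]*n i m)))
        (trans (m≡m%n+[m/n]*n (i + j) m) (cong (_+ (i + j) / m * m) (sym e)))))

  embedding⇒walk : ∀ k {G : Graph n} {v} → Embedding (cycle (2 + k)) G v → CyclicWalk (2 + k) (Adj G)
  embedding⇒walk k {G} {v} emb = record
    { at       = at
    ; adjacent = adjacent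
    ; periodic = λ i → cong (lookup v) (toℕ-injective (trans (toℕ-mod (i + m) m)
        (trans ([m+n]%n≡m%n i m) (sym (toℕ-mod i m)))))
    ; distinct = λ i j 0<j j<m e → %-injective i j m 0<j j<m
        (trans (sym (toℕ-mod i m)) (trans (cong toℕ (injective _ _ e)) (toℕ-mod (i + j) m)))
    }
    where
    open Embedding emb
    m = 2 + k
    at : ℕ → Fin _
    at i = lookup v (i mod m)
    adjacent : ∀ i → Adj G (at i) (at (suc i))
    adjacent i with suc-% i m
    ... | inj₁ (_ , e) = preserves _ _ (cycle-adj⁺ k (i mod m) (suc i mod m)
            (trans (toℕ-mod (suc i) m) (trans e (cong suc (sym (toℕ-mod i m))))))
    ... | inj₂ (e , e′) = preserves _ _ (cycle-close k (i mod m) (suc i mod m)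
            (trans (cong suc (toℕ-mod i m)) e) (trans (toℕ-mod (suc i) m) e′))

  no-walk⇒free : ∀ k {G : Graph n} → ¬ CyclicWalk (2 + k) (Adj G) → Free (cycle (2 + k)) G
  no-walk⇒free k {G} ¬walk copy =
    let v , emb = copy⇒embedding {H = cycle (2 + k)} {G} copy in ¬walk (embedding⇒walk k emb)

  Link : (ℕ → ℕ → Set) → ℕ → Vec ℕ n → Set
  Link R c []      = ⊤
  Link R c (x ∷ _) = R c x

  -- The head is the newest vertex, so that a path is prolonged by consing.
  IsPath : (ℕ → ℕ → Set) → Vec ℕ n → Set
  IsPath R []      = ⊤
  IsPath R (c ∷ v) = (∀ j → c ≢ lookup v j) × Link R c v × IsPath R v

  isPath-injective : ∀ {R} (v : Vec ℕ n) → IsPath R v → ∀ i j → lookup v i ≡ lookup v j → i ≡ j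
  isPath-injective (c ∷ v) (fresh , _ , p) zero    zero    e = refl
  isPath-injective (c ∷ v) (fresh , _ , p) zero    (suc j) e = ⊥-elim (fresh j e)
  isPath-injective (c ∷ v) (fresh , _ , p) (suc i) zero    e = ⊥-elim (fresh i (sym e))
  isPath-injective (c ∷ v) (fresh , _ , p) (suc i) (suc j) e = cong suc (isPath-injective v p i j e)

  isPath-adj : ∀ {R l} → (∀ x y → R x y → R y x) → (v : Vec ℕ l) → IsPath R v →
    ∀ i j → Adj (path l) i j → R (lookup v i) (lookup v j)
  isPath-adj s (c ∷ [])    p zero zero ()
  isPath-adj s (c ∷ x ∷ v) (_ , r , p) zero    (suc j) a with refl ← x∈⁅y⁆⇒x≡y zero a = r
  isPath-adj s (c ∷ x ∷ v) (_ , r , p) (suc i) zero    a with refl ← x∈⁅y⁆⇒x≡y zero a = s _ _ r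
  isPath-adj s (c ∷ x ∷ v) (_ , r , p) (suc i) (suc j) a = isPath-adj s (x ∷ v) p i j a

  unique-map : {P : A → Set} (f : A → B) → (∀ {x y} → P x → P y → f x ≡ f y → x ≡ y) →
    ∀ xs → All P xs → Unique xs → Unique (map f xs)
  unique-map f inj []       []         []       = []
  unique-map {P = P} f inj (x ∷ xs) (px ∷ pxs) (x∉ ∷ u) = go xs pxs x∉ ∷ unique-map f inj xs pxs u
    where
    go : ∀ ys → All P ys → All (x ≢_) ys → All (f x ≢_) (map f ys)
    go []       []         []       = []
    go (y ∷ ys) (py ∷ pys) (n ∷ ns) = (λ e → n (inj px py e)) ∷ go ys pys ns

  module _ {R : ℕ → ℕ → Set} (R? : ∀ x y → Dec (R x y))
    (R-sym : ∀ x y → R x y → R y x) (R-irrefl : ∀ x → ¬ R x x) where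

    private
      graphOn : ∀ n → Graph n
      graphOn n = graphOf λ i j → R? (toℕ i) (toℕ j)

    -- The interface for the constructions: each is a relation on ℕ, cut down to the vertices below
    -- n, and what remains is to exclude cyclic walks and to list many paths.
    paths≤2*ex : ∀ n .{{_ : NonZero n}} k l →
      ((w : CyclicWalk (2 + k) R) → ¬ (∀ i → CyclicWalk.at w i < n)) →
      (L : List (Vec ℕ l)) → Unique L → (∀ {v} → v ∈ᴸ L → IsPath R v × (∀ i → lookup v i < n)) →
      length L ≤ 2 * ex n (path l) (cycle (2 + k))
    paths≤2*ex n k l noWalk L u ok = begin
      length L                 ≡⟨ length-map toFin L ⟨
      length (map toFin L)     ≤⟨ embeddings≤2*copies G (map toFin L) (unique-map toFin toFin-inj L (All.tabulate λ v∈ → proj₂ (ok v∈)) u)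
                                    (All.tabulate emb) ⟩
      2 * copies (path l) G    ≤⟨ *-monoʳ-≤ 2 (copies≤ex (path l) (cycle (2 + k)) G free) ⟩
      2 * ex n (path l) (cycle (2 + k)) ∎
      where
      open ≤-Reasoning
      G = graphOn n
      R-sym′ : ∀ (i j : Fin n) → R (toℕ i) (toℕ j) → R (toℕ j) (toℕ i)
      R-sym′ i j = R-sym _ _
      adj⁻ : ∀ i j → Adj G i j → R (toℕ i) (toℕ j)
      adj⁻ = adj-graphOf⁻ (λ i j → R? (toℕ i) (toℕ j)) R-sym′
      free : Free (cycle (2 + k)) G
      free = no-walk⇒free k {G} λ w → let open CyclicWalk w in noWalk (record
        { at       = λ i → toℕ (at i)
        ; adjacent = λ i → adj⁻ _ _ (adjacent i)
        ; periodic = λ i → cong toℕ (periodic i)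
        ; distinct = λ i j 0<j j<m e → distinct i j 0<j j<m (toℕ-injective e)
        }) (λ i → toℕ<n (at i))
      toFin : Vec ℕ l → Vec (Fin n) l
      toFin = Vec.map (_mod n)
      toℕ-toFin : ∀ v i → lookup v i < n → toℕ (lookup (toFin v) i) ≡ lookup v i
      toℕ-toFin v i lt = trans (cong toℕ (lookup-map i (_mod n) v)) (trans (toℕ-mod _ n) (m<n⇒m%n≡m lt))
      toFin-inj : ∀ {v w} → (∀ i → lookup v i < n) → (∀ i → lookup w i < n) → toFin v ≡ toFin w → v ≡ w
      toFin-inj {v} {w} bv bw e = lookup-ext v w λ i → trans (sym (toℕ-toFin v i (bv i)))
        (trans (cong (λ z → toℕ (lookup z i)) e) (toℕ-toFin w i (bw i)))
      emb : ∀ {x} → x ∈ᴸ map toFin L → Embedding (path l) G x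
      emb x∈ with ∈-map⁻ toFin x∈
      ... | v , v∈ , refl = record
        { injective = λ i j e → isPath-injective v isP i j
            (trans (sym (toℕ-toFin v i (bd i))) (trans (cong toℕ e) (toℕ-toFin v j (bd j))))
        ; preserves = λ i j a → adj-graphOf⁺ (λ i j → R? (toℕ i) (toℕ j)) R-sym′ (λ i → R-irrefl (toℕ i)) _ _
            (subst₂ R (sym (toℕ-toFin v i (bd i))) (sym (toℕ-toFin v j (bd j))) (isPath-adj R-sym v isP i j a))
        }
        where
        isP = proj₁ (ok v∈)
        bd = proj₂ (ok v∈)

-- Greedy counting of vectors built one entry at a time.

module Growth where

  open PrimeDivisors using (∏)
  open Copies using (unique-⊆-length)
  open import Data.List as List using (List; []; _∷_; length; map; filter; _++_)
  open import Data.List.Membership.Propositional using (_∈_; _∉_)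
  open import Data.List.Membership.Propositional.Properties using (∈-filter⁺; ∈-filter⁻; ∈-map⁻; ∈-++⁻; ∈-++⁺ˡ; ∈-++⁺ʳ)
  open import Data.List.Membership.DecPropositional using () renaming (_∈?_ to mem?)
  open import Data.List.Properties using (length-++; length-map)
  open import Data.List.Relation.Unary.Any using (here; there)
  open import Data.List.Relation.Unary.All as All using ([]; _∷_)
  open import Data.List.Relation.Unary.AllPairs using ([]; _∷_)
  open import Data.List.Relation.Unary.Unique.Propositional using (Unique)
  open import Data.List.Relation.Unary.Unique.Propositional.Properties using (filter⁺; map⁺; ++⁺)
  open import Data.Nat using (ℕ; zero; suc; _+_; _*_; _∸_; _≤_; _<_; z≤n; s≤s; _≟_)
  open import Data.Nat.Properties
  open import Data.Product using (_×_; _,_; proj₁; proj₂)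
  open import Data.Sum using (inj₁; inj₂)
  open import Data.Vec as Vec using (Vec; []; _∷_)
  open import Relation.Binary.PropositionalEquality
  open import Relation.Nullary using (yes; no)
  open import Relation.Nullary.Decidable using (¬?)

  record Choices (A : Set) (d : ℕ) (Q : A → Set) : Set where
    constructor choices
    field
      list   : List A
      unique : Unique list
      many   : d ≤ length list
      valid  : ∀ {c} → c ∈ list → Q c

  open Choices

  weaken : ∀ {A d d′} {Q Q′ : A → Set} → d′ ≤ d → (∀ {c} → Q c → Q′ c) → Choices A d Q → Choices A d′ Q′
  weaken le f (choices cs u m v) = choices cs u (≤-trans le m) λ c∈ → f (v c∈)

  avoiding : ∀ {xs : List ℕ} → Unique xs → (as : List ℕ) →
    Choices ℕ (length xs ∸ length as) (λ c → c ∈ xs × c ∉ as)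
  avoiding {xs} u as = choices (filter new? xs) (filter⁺ new? u)
    (m≤n+o⇒m∸n≤o (length xs) (length as) (begin
      length xs                             ≤⟨ unique-⊆-length xs (as ++ filter new? xs) u split ⟩
      length (as ++ filter new? xs)         ≡⟨ length-++ as ⟩
      length as + length (filter new? xs)   ∎))
    (∈-filter⁻ new?)
    where
    open ≤-Reasoning
    new? = λ c → ¬? (mem? _≟_ c as)
    split : ∀ {c} → c ∈ xs → c ∈ as ++ filter new? xs
    split {c} c∈ with mem? _≟_ c as
    ... | yes c∈as = ∈-++⁺ˡ c∈as
    ... | no  c∉as = ∈-++⁺ʳ as (∈-filter⁺ new? c∈ c∉as)

  module _ (P : ∀ {i} → Vec ℕ i → Set) where

    -- The clause on `Vec.tail w` is carried along because it makes the extensions of different v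
    -- disjoint.
    extend : ∀ {i} d (vs : List (Vec ℕ i)) → Unique vs → (∀ {v} → v ∈ vs → Choices ℕ d (λ c → P (c ∷ v))) →
      Choices (Vec ℕ (suc i)) (length vs * d) (λ w → P w × Vec.tail w ∈ vs)
    extend d [] u step = choices [] [] z≤n λ ()
    extend d (v ∷ vs) (v∉ ∷ u) step =
      choices (map (_∷ v) (list C) ++ list Cs)
        (++⁺ (map⁺ (λ { refl → refl }) (unique C)) (unique Cs) disjoint)
        (≤-trans (+-mono-≤ (≤-trans (many C) (≤-reflexive (sym (length-map (_∷ v) (list C))))) (many Cs))
          (≤-reflexive (sym (length-++ (map (_∷ v) (list C))))))
        ok
      where
      C = step (here refl)
      Cs = extend d vs u (λ w∈ → step (there w∈))
      disjoint : ∀ {w} → w ∈ map (_∷ v) (list C) × w ∈ list Cs → _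
      disjoint (w∈ , w∈′) with ∈-map⁻ (_∷ v) w∈
      ... | c , c∈ , refl = All.lookup v∉ (proj₂ (valid Cs w∈′)) refl
      ok : ∀ {w} → w ∈ map (_∷ v) (list C) ++ list Cs → P w × Vec.tail w ∈ v ∷ vs
      ok w∈ with ∈-++⁻ (map (_∷ v) (list C)) w∈
      ... | inj₂ w∈′ = proj₁ (valid Cs w∈′) , there (proj₂ (valid Cs w∈′))
      ... | inj₁ w∈′ with ∈-map⁻ (_∷ v) w∈′
      ...   | c , c∈ , refl = valid C c∈ , here refl

    -- Every lower bound on a number of paths comes from here; P is the invariant that guarantees
    -- enough choices for the next vertex.
    grow : (d : ℕ → ℕ) → P [] → ∀ l →
      (∀ {i} (v : Vec ℕ i) → i < l → P v → Choices ℕ (d i) (λ c → P (c ∷ v))) →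
      Choices (Vec ℕ l) (∏ d l) P
    grow d p[] zero step = choices ([] ∷ []) ([] ∷ []) (s≤s z≤n) λ { (here refl) → p[] }
    grow d p[] (suc l) step = weaken (*-monoˡ-≤ (d l) (many Vs)) proj₁
      (extend (d l) (list Vs) (unique Vs) λ v∈ → step _ ≤-refl (valid Vs v∈))
      where
      Vs = grow d p[] l λ v i<l → step v (<-trans i<l (n<1+n l))

-- Alternating paths, and the complete bipartite graph for l < 2k.

module Alternating where

  open import Defs using (path; cycle; ex)
  open PrimeDivisors using (∏)
  open Copies
  open Growth
  open import Data.Bool using (Bool; true; false; if_then_else_)
  open import Data.Fin using (Fin; toℕ; fromℕ<)
  open import Data.Fin.Properties using (pigeonhole; toℕ<n; toℕ-fromℕ<)
  open import Data.List as List using (List; []; _∷_; length; upTo)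
  open import Data.List.Membership.Propositional using (_∈_; _∉_)
  open import Data.List.Membership.Propositional.Properties using (∈-upTo⁻; ∈-map⁻; ∈-tabulate⁺)
  open import Data.List.Properties using (length-map; length-upTo; length-tabulate)
  open import Data.List.Relation.Unary.Any using (here; there)
  open import Data.List.Relation.Unary.Unique.Propositional.Properties using (upTo⁺; map⁺)
  open import Data.Nat using (ℕ; zero; suc; _+_; _*_; _∸_; _^_; _≤_; _<_; _≤?_; _<?_; z≤n; s≤s; NonZero; ⌊_/2⌋; ⌈_/2⌉)
  open import Data.Nat.Combinatorics.Base using (_P′_)
  open import Data.Nat.Properties
  open import Data.Nat.Tactic.RingSolver using (solve-∀)
  open import Data.Product using (∃-syntax; _×_; _,_; proj₁; proj₂)
  open import Data.Sum using (_⊎_; inj₁; inj₂; swap)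
  open import Data.Unit using (⊤; tt)
  open import Data.Vec as Vec using (Vec; []; _∷_; lookup)
  open import Relation.Binary.PropositionalEquality
  open import Relation.Nullary using (¬_; Dec; contradiction)
  open import Relation.Nullary.Decidable using (_×-dec_; _⊎-dec_)

  isEven : ℕ → Bool
  isEven zero          = true
  isEven (suc zero)    = false
  isEven (suc (suc n)) = isEven n

  even-⌊/2⌋ : ∀ n → isEven n ≡ true → ⌊ suc n /2⌋ ≡ ⌊ n /2⌋
  even-⌊/2⌋ zero          e = refl
  even-⌊/2⌋ (suc (suc n)) e = cong suc (even-⌊/2⌋ n e)

  odd-⌊/2⌋ : ∀ n → isEven n ≡ false → ⌊ suc n /2⌋ ≡ suc ⌊ n /2⌋
  odd-⌊/2⌋ (suc zero)    e = refl
  odd-⌊/2⌋ (suc (suc n)) e = cong suc (odd-⌊/2⌋ n e)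

  isEven-suc : ∀ n → isEven (suc n) ≡ (if isEven n then false else true)
  isEven-suc zero          = refl
  isEven-suc (suc zero)    = refl
  isEven-suc (suc (suc n)) = isEven-suc n

  -- The choices along a path that alternates between the sides of a bipartite graph. It starts on
  -- the large side and so has ⌈l/2⌉ vertices there.
  alternate : ℕ → (ℕ → ℕ) → ℕ → ℕ
  alternate B g i = if isEven i then B else g ⌊ i /2⌋

  ∏-alternate : ∀ B g l → ∏ (alternate B g) l ≡ B ^ ⌈ l /2⌉ * ∏ g ⌊ l /2⌋
  ∏-alternate B g zero = refl
  ∏-alternate B g (suc l) with isEven l in eq
  ... | true = begin
    ∏ (alternate B g) l * B                ≡⟨ cong (_* B) (∏-alternate B g l) ⟩
    B ^ ⌈ l /2⌉ * ∏ g ⌊ l /2⌋ * B          ≡⟨ lem (B ^ ⌈ l /2⌉) (∏ g ⌊ l /2⌋) B ⟩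
    B * B ^ ⌈ l /2⌉ * ∏ g ⌊ l /2⌋          ≡⟨ cong₂ (λ x y → B * B ^ x * ∏ g y) (even-⌊/2⌋ l eq) (sym (even-⌊/2⌋ l eq)) ⟩
    B * B ^ ⌊ l /2⌋ * ∏ g ⌊ suc l /2⌋      ∎
    where
    open ≡-Reasoning
    lem : ∀ x y b → x * y * b ≡ b * x * y
    lem = solve-∀
  ... | false = begin
    ∏ (alternate B g) l * g ⌊ l /2⌋        ≡⟨ cong (_* g ⌊ l /2⌋) (∏-alternate B g l) ⟩
    B ^ ⌈ l /2⌉ * ∏ g ⌊ l /2⌋ * g ⌊ l /2⌋  ≡⟨ *-assoc (B ^ ⌈ l /2⌉) _ _ ⟩
    B ^ ⌈ l /2⌉ * ∏ g (suc ⌊ l /2⌋)        ≡⟨ cong₂ (λ x y → B ^ x * ∏ g y) (odd-⌊/2⌋ l eq) (sym (odd-⌊/2⌋ l eq)) ⟩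
    B ^ suc ⌊ l /2⌋ * ∏ g ⌊ suc l /2⌋      ∎
    where open ≡-Reasoning

  HeadIs : ∀ {n} → (ℕ → Set) → Vec ℕ n → Set
  HeadIs Q []      = ⊤
  HeadIs Q (c ∷ _) = Q c

  entries : ∀ {n} → Vec ℕ n → List ℕ
  entries v = List.tabulate (lookup v)

  length-entries : ∀ {n} (v : Vec ℕ n) → length (entries v) ≡ n
  length-entries v = length-tabulate (lookup v)

  ∉-entries : ∀ {n c} (v : Vec ℕ n) → c ∉ entries v → ∀ j → c ≢ lookup v j
  ∉-entries v c∉ j e = c∉ (subst (_∈ entries v) (sym e) (∈-tabulate⁺ {f = lookup v} j))

  link : ∀ {R : ℕ → ℕ → Set} {Q : ℕ → Set} {n c} (v : Vec ℕ n) → HeadIs Q v → (∀ {x} → Q x → R c x) → Link R c v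
  link []      _ f = tt
  link (x ∷ _) q f = f q

  ∀-cons : ∀ {n c} {Q : ℕ → Set} {v : Vec ℕ n} → Q c → (∀ j → Q (lookup v j)) → ∀ j → Q (lookup (c ∷ v) j)
  ∀-cons q qs Fin.zero    = q
  ∀-cons q qs (Fin.suc j) = qs j

  module CompleteBipartite (D n : ℕ) (D≤n : D ≤ n) where

    R : ℕ → ℕ → Set
    R x y = (x < D × D ≤ y) ⊎ (y < D × D ≤ x)

    R? : ∀ x y → Dec (R x y)
    R? x y = (x <? D ×-dec D ≤? y) ⊎-dec (y <? D ×-dec D ≤? x)

    R-sym : ∀ x y → R x y → R y x
    R-sym x y = swap

    R-irrefl : ∀ x → ¬ R x x
    R-irrefl x (inj₁ (lt , ge)) = <⇒≱ lt ge
    R-irrefl x (inj₂ (lt , ge)) = <⇒≱ lt ge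

    hubIn : ∀ {m} (w : CyclicWalk m R) i → ∃[ q ] (i + i ≤ q × q ≤ suc (i + i)) × CyclicWalk.at w q < D
    hubIn w i with CyclicWalk.adjacent w (i + i)
    ... | inj₁ (lt , _) = i + i , (≤-refl , n≤1+n _) , lt
    ... | inj₂ (lt , _) = suc (i + i) , (n≤1+n _ , ≤-refl) , lt

    -- The positions 2i and 2i + 1 with i ≤ D form D + 1 disjoint edges of the cycle, each
    -- containing one of the D hubs.
    no-walk : ¬ CyclicWalk (2 + (D + D)) R
    no-walk w with pigeonhole (n<1+n D) (λ i → fromℕ< (proj₂ (proj₂ (hubIn w (toℕ i)))))
    ... | i , j , i<j , e = distinct q (q′ ∸ q) (m<n⇒0<n∸m q<q′) (≤-<-trans (m∸n≤m q′ q) q′<m)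
      (trans (trans (sym (toℕ-fromℕ< _)) (trans (cong toℕ e) (toℕ-fromℕ< _))) (cong at (sym (m+[n∸m]≡n (<⇒≤ q<q′)))))
      where
      open CyclicWalk w
      small = hubIn w
      q = proj₁ (small (toℕ i))
      q′ = proj₁ (small (toℕ j))
      open ≤-Reasoning
      q<q′ : q < q′
      q<q′ = begin-strict
        q                        ≤⟨ proj₂ (proj₁ (proj₂ (small (toℕ i)))) ⟩
        suc (toℕ i + toℕ i)      <⟨ ≤-reflexive (cong suc (sym (+-suc (toℕ i) (toℕ i)))) ⟩
        suc (toℕ i) + suc (toℕ i) ≤⟨ +-mono-≤ i<j i<j ⟩
        toℕ j + toℕ j            ≤⟨ proj₁ (proj₁ (proj₂ (small (toℕ j)))) ⟩
        q′                       ∎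
      q′<m : q′ < 2 + (D + D)
      q′<m = s≤s (≤-trans (proj₂ (proj₁ (proj₂ (small (toℕ j))))) (s≤s (+-mono-≤ (≤-pred (toℕ<n j)) (≤-pred (toℕ<n j)))))

    module _ (l : ℕ) where

      -- Here i is the length reached, so the head sits at position i - 1 and is a hub exactly when
      -- i is even.
      HeadOK : ℕ → ℕ → Set
      HeadOK i c = if isEven i then c < D else D ≤ c

      -- The list `as` contains the hubs already used. When the next hub is chosen, only these at
      -- most ⌊i/2⌋ vertices are avoided, which gives the factors D - ⌊i/2⌋ of the falling factorial
      -- without loss.
      P : ∀ {i} → Vec ℕ i → Set
      P {i} v = IsPath R v × (∀ j → lookup v j < n) × HeadIs (HeadOK i) v ×
        (∃[ as ] length as ≤ ⌊ i /2⌋ × (∀ j → lookup v j < D → lookup v j ∈ as))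

      step : ∀ {i} (v : Vec ℕ i) → i < l → P v → Choices ℕ (alternate (n ∸ D ∸ l) (D ∸_) i) (λ c → P (c ∷ v))
      step {i} v i<l (isP , bd , head , as , len , small) with isEven i in eq
      ... | true = weaken
        (subst₂ (λ x y → n ∸ D ∸ l ≤ x ∸ y) (sym (trans (length-map (D +_) (upTo (n ∸ D))) (length-upTo (n ∸ D)))) (sym (length-entries v)) (∸-monoʳ-≤ (n ∸ D) (<⇒≤ i<l)))
        (λ {c} (c∈ , c∉) → big c (∈-map⁻ (D +_) c∈) c∉)
        (avoiding {List.map (D +_) (upTo (n ∸ D))} (map⁺ (+-cancelˡ-≡ D _ _) (upTo⁺ (n ∸ D))) (entries v))
        where
        big : ∀ c → ∃[ x ] x ∈ upTo (n ∸ D) × c ≡ D + x → c ∉ entries v → P (c ∷ v)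
        big c (x , x∈ , refl) c∉ =
          (∉-entries v c∉ , link v head (λ lt → inj₂ (lt , m≤m+n D x)) , isP) ,
          ∀-cons {Q = _< n} (subst (D + x <_) (m+[n∸m]≡n D≤n) (+-monoʳ-< D (∈-upTo⁻ x∈))) bd ,
          subst (λ b → if b then D + x < D else D ≤ D + x) (sym (trans (isEven-suc i) (cong (λ b → if b then false else true) eq))) (m≤m+n D x) ,
          as , subst (length as ≤_) (sym (even-⌊/2⌋ i eq)) len ,
          ∀-cons {Q = λ y → y < D → y ∈ as} (λ lt → contradiction (m≤m+n D x) (<⇒≱ lt)) small
      ... | false = weaken
        (≤-trans (∸-monoʳ-≤ D len) (≤-reflexive (cong (_∸ length as) (sym (length-upTo D)))))
        (λ {c} (c∈ , c∉) → hub c (∈-upTo⁻ c∈) c∉)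
        (avoiding {upTo D} (upTo⁺ D) as)
        where
        hub : ∀ c → c < D → c ∉ as → P (c ∷ v)
        hub c c<D c∉ =
          ((λ j e → c∉ (subst (_∈ as) (sym e) (small j (subst (_< D) e c<D)))) , link v head (λ ge → inj₁ (c<D , ge)) , isP) ,
          ∀-cons {Q = _< n} (<-≤-trans c<D D≤n) bd ,
          subst (λ b → if b then c < D else D ≤ c) (sym (trans (isEven-suc i) (cong (λ b → if b then false else true) eq))) c<D ,
          c ∷ as , subst (suc (length as) ≤_) (sym (odd-⌊/2⌋ i eq)) (s≤s len) ,
          ∀-cons {Q = λ y → y < D → y ∈ c ∷ as} (λ _ → here refl) (λ j lt → there (small j lt))

      ∏-P′ : ∀ m → ∏ (D ∸_) m ≡ D P′ m
      ∏-P′ zero    = refl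
      ∏-P′ (suc m) = trans (cong (_* (D ∸ m)) (∏-P′ m)) (*-comm (D P′ m) _)

      paths : .{{_ : NonZero n}} → (n ∸ D ∸ l) ^ ⌈ l /2⌉ * (D P′ ⌊ l /2⌋) ≤ 2 * ex n (path l) (cycle (2 + (D + D)))
      paths = ≤-trans (≤-reflexive (trans (cong ((n ∸ D ∸ l) ^ ⌈ l /2⌉ *_) (sym (∏-P′ ⌊ l /2⌋))) (sym (∏-alternate (n ∸ D ∸ l) (D ∸_) l))))
        (≤-trans (Choices.many L) (paths≤2*ex R? R-sym R-irrefl n (D + D) l (λ w _ → no-walk w) (Choices.list L) (Choices.unique L)
          λ v∈ → let isP , bd , _ = Choices.valid L v∈ in isP , bd))
        where
        L = grow P (alternate (n ∸ D ∸ l) (D ∸_)) (tt , (λ ()) , tt , [] , z≤n , λ ()) l step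

-- The blown-up path for k ≥ 3.

module HubGraph where

  open import Defs using (path; cycle; ex)
  open PrimeDivisors using (∏; ∏-const)
  open Copies
  open Growth
  open Alternating using (isEven; even-⌊/2⌋; odd-⌊/2⌋; isEven-suc; alternate; ∏-alternate; HeadIs; entries; length-entries; ∉-entries; link; ∀-cons)
  open import Data.Bool using (true; false; if_then_else_)
  open import Data.Empty using (⊥)
  open import Data.List as List using (List; []; _∷_; upTo)
  open import Data.List.Membership.Propositional using (_∈_; _∉_)
  open import Data.List.Membership.Propositional.Properties using (∈-upTo⁻; ∈-map⁻)
  open import Data.List.Properties using (length-map; length-upTo)
  open import Data.List.Relation.Unary.All using ([])
  open import Data.List.Relation.Unary.AllPairs using ([]; _∷_)
  open import Data.List.Relation.Unary.Any using (here)
  open import Data.List.Relation.Unary.Unique.Propositional.Properties using (upTo⁺; map⁺)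
  open import Data.Nat using (ℕ; zero; suc; pred; _+_; _*_; _∸_; _^_; _⊓_; _≤_; _<_; _≟_; _≤?_; _<?_; z≤n; s≤s; NonZero; ⌊_/2⌋; ⌈_/2⌉)
  open import Data.Nat.DivMod using (_%_; [m+kn]%n≡m%n; m<n⇒m%n≡m)
  open import Data.Nat.Properties
  open import Data.Product using (∃-syntax; _×_; _,_; proj₁; proj₂)
  open import Data.Sum using (_⊎_; inj₁; inj₂; swap)
  open import Data.Unit using (tt)
  open import Data.Vec as Vec using (Vec; []; _∷_; lookup)
  open import Relation.Binary.PropositionalEquality
  open import Relation.Nullary using (¬_; Dec; contradiction)
  open import Relation.Nullary.Decidable using (_×-dec_; _⊎-dec_)

  -- The vertices below r + 2 are hubs, the others fall into r + 1 classes,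
  -- class a being joined to the hubs a and a + 1.
  module BlownUpPath (r : ℕ) where

    j = suc (suc r)

    class : ℕ → ℕ
    class v = (v ∸ j) % suc r

    E : ℕ → ℕ → Set
    E h v = h < j × j ≤ v × (h ≡ class v ⊎ h ≡ suc (class v))

    R : ℕ → ℕ → Set
    R x y = E x y ⊎ E y x

    R? : ∀ x y → Dec (R x y)
    R? x y = E? x y ⊎-dec E? y x
      where
      E? : ∀ x y → Dec (E x y)
      E? h v = h <? j ×-dec j ≤? v ×-dec (h ≟ class v ⊎-dec h ≟ suc (class v))

    R-sym : ∀ x y → R x y → R y x
    R-sym x y = swap

    R-irrefl : ∀ x → ¬ R x x
    R-irrefl x (inj₁ (lt , ge , _)) = <⇒≱ lt ge
    R-irrefl x (inj₂ (lt , ge , _)) = <⇒≱ lt ge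

    hub-E : ∀ {h v} → h < j → R h v → E h v
    hub-E h<j (inj₁ e) = e
    hub-E h<j (inj₂ (_ , ge , _)) = contradiction ge (<⇒≱ h<j)

    nonHub-E : ∀ {h v} → j ≤ v → R h v → E h v
    nonHub-E j≤v (inj₁ e) = e
    nonHub-E j≤v (inj₂ (lt , _ , _)) = contradiction j≤v (<⇒≱ lt)

    two-hubs : ∀ {b c v} → E b v → E c v → b ≢ c → c ≡ suc b ⊎ b ≡ suc c
    two-hubs (_ , _ , inj₁ refl) (_ , _ , inj₁ refl) b≢c = contradiction refl b≢c
    two-hubs (_ , _ , inj₁ refl) (_ , _ , inj₂ refl) b≢c = inj₁ refl
    two-hubs (_ , _ , inj₂ refl) (_ , _ , inj₁ refl) b≢c = inj₂ refl
    two-hubs (_ , _ , inj₂ refl) (_ , _ , inj₂ refl) b≢c = contradiction refl b≢c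

    module _ {k} (2<k : 2 < k) (w : CyclicWalk (2 + k) R) where
      open CyclicWalk w

      nextHub : ∀ i → at i < j → E (at i) (at (1 + i)) × E (at (2 + i)) (at (1 + i))
      nextHub i lt = e , nonHub-E (proj₁ (proj₂ e)) (R-sym (at (1 + i)) (at (2 + i)) (adjacent (1 + i)))
        where e = hub-E lt (adjacent i)

      hub-step : ∀ i → at i < j → at (2 + i) ≡ suc (at i) ⊎ at i ≡ suc (at (2 + i))
      hub-step i lt = two-hubs (proj₁ (nextHub i lt)) (proj₂ (nextHub i lt))
        (subst (λ x → at i ≢ at x) (+-comm i 2) (distinct i 2 (s≤s z≤n) (s≤s (s≤s (<⇒≤ (<⇒≤ 2<k))))))

      prevHub : ∀ i → at (2 + i) < j → at i < j
      prevHub i lt = proj₁ (nonHub-E (proj₁ (proj₂ (hub-E lt (R-sym (at (1 + i)) (at (2 + i)) (adjacent (1 + i)))))) (adjacent i))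

      -- The two hubs at distance two from hub b on the walk are distinct and among b ± 1.
      no-hub : ∀ b i → at (2 + i) ≡ b → ¬ at (2 + i) < j
      no-hub b i e lt with hub-step (2 + i) lt | hub-step i (prevHub i lt)
      ... | inj₁ up | inj₂ down =
        distinct i 4 (s≤s z≤n) (s≤s (s≤s 2<k)) (trans down (trans (sym up) (cong at (+-comm 4 i))))
      -- One of the two hubs is therefore b - 1; moving to it, forwards or backwards, is a descent
      -- that fails at b = 0.
      no-hub zero    i e lt | inj₂ down | _ = 0≢1+n (trans (sym e) down)
      no-hub (suc c) i e lt | inj₂ down | _ = no-hub c (2 + i) (suc-injective (trans (sym down) e))
        (proj₁ (proj₂ (nextHub (2 + i) lt)))
      no-hub zero    i e lt | inj₁ _ | inj₁ up = 0≢1+n (trans (sym e) up)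
      -- With period 2 + k, going back by two positions is going forward by k.
      no-hub (suc c) i e lt | inj₁ _ | inj₁ up = no-hub c (i + k)
        (trans around (suc-injective (trans (sym up) e))) (subst (_< j) (sym around) (prevHub i lt))
        where
        around : at (2 + (i + k)) ≡ at i
        around = trans (cong at (trans (cong suc (sym (+-suc i k))) (sym (+-suc i (suc k))))) (periodic i)

      no-walk : ⊥
      no-walk with adjacent 2
      ... | inj₁ (lt , _) = no-hub _ 0 refl lt
      ... | inj₂ (lt , _) = no-hub _ 1 refl lt

    module _ (n m l : ℕ) (fits : j + m * suc r ≤ n) (⌊l/2⌋≤j : ⌊ l /2⌋ ≤ j) where

      -- The paths meet the classes 0, 0, 1, ..., r, r in this order, with the hubs 0, ..., r + 1 in
      -- between: `pred` repeats the first class and `_⊓ r` the last.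
      classAt : ℕ → ℕ
      classAt q = pred q ⊓ r

      HeadOK : ℕ → ℕ → Set
      HeadOK i c = if isEven i then (c < j × suc c ≡ ⌊ i /2⌋) else (j ≤ c × class c ≡ classAt ⌊ i /2⌋)

      P : ∀ {i} → Vec ℕ i → Set
      P {i} v = IsPath R v × (∀ x → lookup v x < n) × HeadIs (HeadOK i) v ×
        (∀ x → lookup v x < j → lookup v x < ⌊ i /2⌋)

      toClass : ∀ {h} → h < j → h ≡ classAt (suc h) ⊎ h ≡ suc (classAt (suc h))
      toClass {h} (s≤s h≤1+r) with m≤n⇒m<n∨m≡n h≤1+r
      ... | inj₁ (s≤s h≤r) = inj₁ (sym (m≤n⇒m⊓n≡m h≤r))
      ... | inj₂ refl      = inj₂ (cong suc (sym (m≥n⇒m⊓n≡n (n≤1+n r))))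

      fromClass : ∀ {q} → q < j → q ≡ classAt q ⊎ q ≡ suc (classAt q)
      fromClass {zero}  lt            = inj₁ refl
      fromClass {suc p} (s≤s (s≤s p≤r)) = inj₂ (cong suc (sym (m≤n⇒m⊓n≡m p≤r)))

      member : ℕ → ℕ → ℕ
      member q x = j + (classAt q + x * suc r)

      class-member : ∀ q x → class (member q x) ≡ classAt q
      class-member q x = trans (cong (_% suc r) (m+n∸m≡n j (classAt q + x * suc r)))
        (trans ([m+kn]%n≡m%n (classAt q) x (suc r)) (m<n⇒m%n≡m (s≤s (m⊓n≤n (pred q) r))))

      member-< : ∀ q {x} → x < m → member q x < n
      member-< q {x} x<m = <-≤-trans (+-monoʳ-< j (<-≤-trans (+-monoˡ-< (x * suc r) (s≤s (m⊓n≤n (pred q) r))) (*-monoˡ-≤ (suc r) x<m))) fits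

      step : ∀ {i} (v : Vec ℕ i) → i < l → P v → Choices ℕ (alternate (m ∸ l) (λ _ → 1) i) (λ c → P (c ∷ v))
      step {i} v i<l (isP , bd , head , small) with isEven i in eq
      ... | true = weaken
        (subst₂ (λ x y → m ∸ l ≤ x ∸ y) (sym (trans (length-map (member q) (upTo m)) (length-upTo m))) (sym (length-entries v)) (∸-monoʳ-≤ m (<⇒≤ i<l)))
        (λ {c} (c∈ , c∉) → big c (∈-map⁻ (member q) c∈) c∉)
        (avoiding {List.map (member q) (upTo m)} (map⁺ (λ {x} {y} e → *-cancelʳ-≡ x y (suc r) (+-cancelˡ-≡ (classAt q) _ _ (+-cancelˡ-≡ j _ _ e))) (upTo⁺ m)) (entries v))
        where
        q = ⌊ i /2⌋
        big : ∀ c → ∃[ x ] x ∈ upTo m × c ≡ member q x → c ∉ entries v → P (c ∷ v)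
        big c (x , x∈ , refl) c∉ =
          (∉-entries v c∉ , link v head adj , isP) ,
          ∀-cons {Q = _< n} (member-< q (∈-upTo⁻ x∈)) bd ,
          subst (λ b → if b then (c < j × suc c ≡ ⌊ suc i /2⌋) else (j ≤ c × class c ≡ classAt ⌊ suc i /2⌋))
            (sym (trans (isEven-suc i) (cong (λ b → if b then false else true) eq)))
            (m≤m+n j _ , trans (class-member q x) (cong classAt (sym (even-⌊/2⌋ i eq)))) ,
          ∀-cons {Q = λ y → y < j → y < ⌊ suc i /2⌋} (λ lt → contradiction (m≤m+n j _) (<⇒≱ lt))
            (λ y lt → subst (lookup v y <_) (sym (even-⌊/2⌋ i eq)) (small y lt))
          where
          adj : ∀ {h} → h < j × suc h ≡ q → R (member q x) h
          adj {h} (h<j , e) = inj₂ (h<j , m≤m+n j _ ,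
            subst (λ a → h ≡ a ⊎ h ≡ suc a) (trans (cong classAt e) (sym (class-member q x))) (toClass h<j))
      ... | false = choices (q ∷ []) ([] ∷ []) (s≤s z≤n) λ { (here refl) → hub }
        where
        q = ⌊ i /2⌋
        q<j : q < j
        q<j = ≤-trans (≤-reflexive (sym (odd-⌊/2⌋ i eq))) (≤-trans (⌊n/2⌋-mono i<l) ⌊l/2⌋≤j)
        hub : P (q ∷ v)
        hub =
          ((λ x e → <-irrefl (sym e) (small x (subst (_< j) e q<j))) , link v head adj , isP) ,
          ∀-cons {Q = _< n} (<-≤-trans q<j (≤-trans (m≤m+n j _) fits)) bd ,
          subst (λ b → if b then (q < j × suc q ≡ ⌊ suc i /2⌋) else (j ≤ q × class q ≡ classAt ⌊ suc i /2⌋))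
            (sym (trans (isEven-suc i) (cong (λ b → if b then false else true) eq)))
            (q<j , sym (odd-⌊/2⌋ i eq)) ,
          ∀-cons {Q = λ y → y < j → y < ⌊ suc i /2⌋} (λ _ → ≤-reflexive (sym (odd-⌊/2⌋ i eq)))
            (λ y lt → <-trans (small y lt) (≤-reflexive (sym (odd-⌊/2⌋ i eq))))
          where
          adj : ∀ {c} → j ≤ c × class c ≡ classAt q → R q c
          adj {c} (j≤c , e) = inj₁ (q<j , j≤c , subst (λ a → q ≡ a ⊎ q ≡ suc a) (sym e) (fromClass q<j))

      paths : .{{_ : NonZero n}} → ∀ {k} → 2 < k → (m ∸ l) ^ ⌈ l /2⌉ ≤ 2 * ex n (path l) (cycle (2 + k))
      paths {k} 2<k = ≤-trans (≤-reflexive product) (≤-trans (Choices.many L)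
        (paths≤2*ex R? R-sym R-irrefl n k l (λ w _ → no-walk 2<k w) (Choices.list L) (Choices.unique L)
          λ v∈ → let isP , bd , _ = Choices.valid L v∈ in isP , bd))
        where
        L = grow P (alternate (m ∸ l) (λ _ → 1)) (tt , (λ ()) , tt , (λ ())) l step
        product : (m ∸ l) ^ ⌈ l /2⌉ ≡ ∏ (alternate (m ∸ l) (λ _ → 1)) l
        product = sym (trans (∏-alternate (m ∸ l) (λ _ → 1) l)
          (trans (cong ((m ∸ l) ^ ⌈ l /2⌉ *_) (trans (∏-const 1 ⌊ l /2⌋) (^-zeroˡ ⌊ l /2⌋))) (*-identityʳ _)))

-- The polarity graph over a prime field, for k = 2.

module Polarity where

  open import Defs using (path; cycle; ex)
  open PrimeDivisors using (∏)
  open Copies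
  open Growth
  open Alternating using (entries; length-entries; ∉-entries; ∀-cons)
  open import Data.List as List using (List; []; _∷_; upTo)
  open import Data.List.Membership.Propositional using (_∈_; _∉_)
  open import Data.List.Membership.Propositional.Properties using (∈-upTo⁻; ∈-map⁻)
  open import Data.List.Properties using (length-map; length-upTo)
  open import Data.List.Relation.Unary.Unique.Propositional.Properties using (upTo⁺; map⁺)
  open import Data.Nat using (ℕ; zero; suc; _+_; _*_; _∸_; _^_; _≤_; _<_; _≟_; _<?_; z≤n; s≤s; NonZero)
  open import Data.Nat.DivMod
  open import Data.Nat.Divisibility using (_∣_; divides; ∣m+n∣m⇒∣n; n∣m*n; >⇒∤)
  open import Data.Nat.Primality using (Prime; euclidsLemma; prime⇒nonZero)
  open import Data.Nat.Properties
  open import Data.Nat.Tactic.RingSolver using (solve-∀)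
  open import Data.Product using (∃-syntax; _×_; _,_; proj₁; proj₂)
  import Data.Sum
  import Data.Fin
  open import Data.Sum using (_⊎_; inj₁; inj₂)
  open import Data.Unit using (tt)
  open import Data.Vec as Vec using (Vec; []; _∷_; lookup)
  open import Relation.Binary.PropositionalEquality
  open import Relation.Nullary using (¬_; Dec; contradiction)
  open import Relation.Nullary.Decidable using (_×-dec_; ¬?)

  module _ (p : ℕ) .{{_ : NonZero p}} where

    %-congˡ-+ : ∀ {a b} c → a % p ≡ b % p → (a + c) % p ≡ (b + c) % p
    %-congˡ-+ {a} {b} c e = trans (%-distribˡ-+ a c p) (trans (cong (λ z → (z + c % p) % p) e) (sym (%-distribˡ-+ b c p)))

    %-cong-+ : ∀ {a b c d} → a % p ≡ b % p → c % p ≡ d % p → (a + c) % p ≡ (b + d) % p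
    %-cong-+ {a} {b} {c} {d} e f = trans (%-distribˡ-+ a c p) (trans (cong₂ (λ x y → (x + y) % p) e f) (sym (%-distribˡ-+ b d p)))

    %-cancelʳ-+ : ∀ {a b} c → c ≤ p → (a + c) % p ≡ (b + c) % p → a % p ≡ b % p
    %-cancelʳ-+ {a} {b} c c≤p e = trans (sym (drop a)) (trans (%-congˡ-+ (p ∸ c) e) (drop b))
      where
      drop : ∀ a → (a + c + (p ∸ c)) % p ≡ a % p
      drop a = trans (cong (_% p) (trans (+-assoc a c (p ∸ c)) (cong (a +_) (m+[n∸m]≡n c≤p)))) ([m+n]%n≡m%n a p)

    %-≡⇒∣ : ∀ a b → (a + b) % p ≡ a % p → p ∣ b
    %-≡⇒∣ a b e = ∣m+n∣m⇒∣n (divides ((a + b) / p) (+-cancelˡ-≡ (a % p) _ _ (begin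
      a % p + (a / p * p + b)      ≡⟨ +-assoc (a % p) _ b ⟨
      a % p + a / p * p + b        ≡⟨ cong (_+ b) (m≡m%n+[m/n]*n a p) ⟨
      a + b                        ≡⟨ m≡m%n+[m/n]*n (a + b) p ⟩
      (a + b) % p + (a + b) / p * p ≡⟨ cong (_+ (a + b) / p * p) e ⟩
      a % p + (a + b) / p * p      ∎))) (n∣m*n (a / p))
      where open ≡-Reasoning

  -- The vertex x p + y with y < p stands for the point (x, y); two points are
  -- joined if y + y′ ≡ x x′ modulo p.
  module PolarityGraph {p : ℕ} (p-prime : Prime p) (s : ℕ) (s≤p : s ≤ p) where

    private
      instance
        p≢0 : NonZero p
        p≢0 = prime⇒nonZero p-prime

    Incident : ℕ → ℕ → Set
    Incident u v = (u % p + v % p) % p ≡ (u / p * (v / p)) % p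

    R : ℕ → ℕ → Set
    R u v = u ≢ v × Incident u v

    R? : ∀ u v → Dec (R u v)
    R? u v = ¬? (u ≟ v) ×-dec ((u % p + v % p) % p ≟ (u / p * (v / p)) % p)

    incident-sym : ∀ u v → Incident u v → Incident v u
    incident-sym u v e = trans (cong (_% p) (+-comm (v % p) (u % p))) (trans e (cong (_% p) (*-comm (u / p) (v / p))))

    R-sym : ∀ u v → R u v → R v u
    R-sym u v (ne , e) = (λ e′ → ne (sym e′)) , incident-sym u v e

    R-irrefl : ∀ u → ¬ R u u
    R-irrefl u (ne , _) = ne refl

    same : ∀ u v w → Incident u w → Incident v w → u / p ≡ v / p → u ≡ v
    same u v w e f x = begin
      u                   ≡⟨ m≡m%n+[m/n]*n u p ⟩
      u % p + u / p * p   ≡⟨ cong₂ (λ a b → a + b * p) y x ⟩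
      v % p + v / p * p   ≡⟨ m≡m%n+[m/n]*n v p ⟨
      v                   ∎
      where
      open ≡-Reasoning
      y : u % p ≡ v % p
      y = trans (sym (m%n%n≡m%n u p)) (trans
        (%-cancelʳ-+ p (w % p) (<⇒≤ (m%n<n w p)) (trans e (trans (cong (λ a → (a * (w / p)) % p) x) (sym f))))
        (m%n%n≡m%n v p))

    -- First coordinates are below s ≤ p, so congruent ones are equal.
    /-gap : ∀ {u v} → v < s * p → u / p ≤ v / p → p ∣ v / p ∸ u / p → u / p ≡ v / p
    /-gap {u} {v} v< le d with v / p ∸ u / p in eq
    ... | zero  = ≤-antisym le (m∸n≡0⇒m≤n eq)
    ... | suc g = contradiction d (>⇒∤ (subst (_< p) eq (≤-<-trans (m∸n≤m (v / p) (u / p)) (<-≤-trans (m<n*o⇒m/o<n v<) s≤p))))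

    -- Adding the incidences crosswise cancels the second coordinates and shows that p divides the
    -- product of the differences of first coordinates. The order assumptions make both differences
    -- natural numbers.
    rectangle-ordered : ∀ u w v z → v < s * p → z < s * p → u / p ≤ v / p → w / p ≤ z / p →
      Incident u w → Incident v w → Incident u z → Incident v z → u ≡ v ⊎ w ≡ z
    rectangle-ordered u w v z v< z< u≤v w≤z uw vw uz vz with euclidsLemma a b p-prime p∣ab
      where
      x = u / p
      t = w / p
      a = v / p ∸ x
      b = z / p ∸ t
      x+a : v / p ≡ x + a
      x+a = sym (m+[n∸m]≡n u≤v)
      t+b : z / p ≡ t + b
      t+b = sym (m+[n∸m]≡n w≤z)
      lem : ∀ x t a b → x * t + (x + a) * (t + b) ≡ (x + a) * t + x * (t + b) + a * b
      lem = solve-∀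
      swap₂ : ∀ a b c d → (a + b) + (c + d) ≡ (c + b) + (a + d)
      swap₂ = solve-∀
      open ≡-Reasoning
      p∣ab : p ∣ a * b
      p∣ab = %-≡⇒∣ p ((x + a) * t + x * (t + b)) (a * b) (begin
        ((x + a) * t + x * (t + b) + a * b) % p        ≡⟨ cong (_% p) (lem x t a b) ⟨
        (x * t + (x + a) * (t + b)) % p                ≡⟨ cong₂ (λ c d → (x * t + c * d) % p) x+a t+b ⟨
        (x * t + v / p * (z / p)) % p                  ≡⟨ %-cong-+ p uw vz ⟨
        ((u % p + w % p) + (v % p + z % p)) % p        ≡⟨ cong (_% p) (swap₂ (u % p) (w % p) (v % p) (z % p)) ⟩
        ((v % p + w % p) + (u % p + z % p)) % p        ≡⟨ %-cong-+ p vw uz ⟩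
        (v / p * t + x * (z / p)) % p                  ≡⟨ cong₂ (λ c d → (c * t + x * d) % p) x+a t+b ⟩
        ((x + a) * t + x * (t + b)) % p                ∎)
    ... | inj₁ d = inj₁ (same u v w uw vw (/-gap {u} {v} v< u≤v d))
    ... | inj₂ d = inj₂ (same w z u (incident-sym u w uw) (incident-sym u z uz) (/-gap {w} {z} z< w≤z d))

    rectangle : ∀ u w v z → u < s * p → w < s * p → v < s * p → z < s * p →
      Incident u w → Incident v w → Incident u z → Incident v z → u ≡ v ⊎ w ≡ z
    rectangle u w v z u< w< v< z< uw vw uz vz with ≤-total (u / p) (v / p) | ≤-total (w / p) (z / p)
    ... | inj₁ le | inj₁ le′ = rectangle-ordered u w v z v< z< le le′ uw vw uz vz
    ... | inj₂ ge | inj₁ le′ = Data.Sum.map₁ sym (rectangle-ordered v w u z u< z< ge le′ vw uw vz uz)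
    ... | inj₁ le | inj₂ ge′ = Data.Sum.map₂ sym (rectangle-ordered u z v w v< w< le ge′ uz vz uw vw)
    ... | inj₂ ge | inj₂ ge′ = Data.Sum.map sym sym (rectangle-ordered v z u w u< w< ge ge′ vz uz vw uw)

    -- Restricts to the points with x < s; all other vertices below n are isolated.
    R′ : ℕ → ℕ → Set
    R′ u v = R u v × u < s * p × v < s * p

    R′? : ∀ u v → Dec (R′ u v)
    R′? u v = R? u v ×-dec u <? s * p ×-dec v <? s * p

    R′-sym : ∀ u v → R′ u v → R′ v u
    R′-sym u v (r , bu , bv) = R-sym u v r , bv , bu

    no-walk : ¬ CyclicWalk 4 R′
    no-walk w with rectangle (at 0) (at 1) (at 2) (at 3)
        (proj₁ (proj₂ (adjacent 0))) (proj₁ (proj₂ (adjacent 1))) (proj₁ (proj₂ (adjacent 2))) (proj₁ (proj₂ (adjacent 3)))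
        (proj₂ (proj₁ (adjacent 0))) (incident-sym (at 1) (at 2) (proj₂ (proj₁ (adjacent 1))))
        (incident-sym (at 3) (at 0) (subst (Incident (at 3)) (periodic 0) (proj₂ (proj₁ (adjacent 3)))))
        (proj₂ (proj₁ (adjacent 2)))
      where open CyclicWalk w
    ... | inj₁ e = CyclicWalk.distinct w 0 2 (s≤s z≤n) (s≤s (s≤s (s≤s z≤n))) e
    ... | inj₂ e = CyclicWalk.distinct w 1 2 (s≤s z≤n) (s≤s (s≤s (s≤s z≤n))) e

    -- The only point with first coordinate x incident with u, where p - y plays the role of -y. It
    -- may be u itself; this is excluded in `step`, since u is among the entries avoided.
    neighbour : ℕ → ℕ → ℕ
    neighbour u x = (u / p * x + (p ∸ u % p)) % p + x * p

    neighbour-/ : ∀ u x → neighbour u x / p ≡ x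
    neighbour-/ u x = trans (+-distrib-/-∣ʳ _ (n∣m*n x)) (cong₂ _+_ (m<n⇒m/n≡0 (m%n<n _ p)) (m*n/n≡m x p))

    neighbour-% : ∀ u x → neighbour u x % p ≡ (u / p * x + (p ∸ u % p)) % p
    neighbour-% u x = trans ([m+kn]%n≡m%n _ x p) (m%n%n≡m%n (u / p * x + (p ∸ u % p)) p)

    neighbour-incident : ∀ u x → Incident u (neighbour u x)
    neighbour-incident u x = begin
      (u % p + neighbour u x % p) % p                        ≡⟨ cong (λ z → (u % p + z) % p) (neighbour-% u x) ⟩
      (u % p + (u / p * x + (p ∸ u % p)) % p) % p            ≡⟨ %-cong-+ p {u % p} refl (m%n%n≡m%n (u / p * x + (p ∸ u % p)) p) ⟩
      (u % p + (u / p * x + (p ∸ u % p))) % p                ≡⟨ cong (_% p) (lem (u % p) (u / p * x) (p ∸ u % p)) ⟩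
      (u / p * x + (u % p + (p ∸ u % p))) % p                ≡⟨ cong (λ z → (u / p * x + z) % p) (m+[n∸m]≡n (<⇒≤ (m%n<n u p))) ⟩
      (u / p * x + p) % p                                    ≡⟨ [m+n]%n≡m%n (u / p * x) p ⟩
      (u / p * x) % p                                        ≡⟨ cong (λ z → (u / p * z) % p) (neighbour-/ u x) ⟨
      (u / p * (neighbour u x / p)) % p                      ∎
      where
      open ≡-Reasoning
      lem : ∀ a b c → a + (b + c) ≡ b + (a + c)
      lem = solve-∀

    neighbour-< : ∀ u {x} → x < s → neighbour u x < s * p
    neighbour-< u {x} x<s = <-≤-trans (+-monoˡ-< (x * p) (m%n<n _ p)) (*-monoˡ-≤ p x<s)

    module _ (l : ℕ) where

      P : ∀ {i} → Vec ℕ i → Set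
      P v = IsPath R′ v × (∀ j → lookup v j < s * p)

      degree : ℕ → ℕ
      degree zero    = s * p
      degree (suc _) = s ∸ l

      step : ∀ {i} (v : Vec ℕ i) → i < l → P v → Choices ℕ (degree i) (λ c → P (c ∷ v))
      step [] i<l _ = choices (upTo (s * p)) (upTo⁺ (s * p)) (≤-reflexive (sym (length-upTo (s * p))))
        λ c∈ → ((λ ()) , tt , tt) , ∀-cons {Q = _< s * p} {v = []} (∈-upTo⁻ c∈) λ ()
      step {suc i} v@(u ∷ _) i<l (isP , bd) = weaken
        (subst₂ (λ x y → s ∸ l ≤ x ∸ y) (sym (trans (length-map (neighbour u) (upTo s)) (length-upTo s))) (sym (length-entries v)) (∸-monoʳ-≤ s (<⇒≤ i<l)))
        (λ {c} (c∈ , c∉) → next c (∈-map⁻ (neighbour u) c∈) c∉)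
        (avoiding {List.map (neighbour u) (upTo s)}
          (map⁺ (λ {x} {y} e → trans (sym (neighbour-/ u x)) (trans (cong (_/ p) e) (neighbour-/ u y))) (upTo⁺ s)) (entries v))
        where
        next : ∀ c → ∃[ x ] x ∈ upTo s × c ≡ neighbour u x → c ∉ entries v → P (c ∷ v)
        next c (x , x∈ , refl) c∉ =
          (fresh , ((fresh Data.Fin.zero , incident-sym u c (neighbour-incident u x)) , c< , bd Data.Fin.zero) , isP) ,
          ∀-cons {Q = _< s * p} c< bd
          where
          fresh = ∉-entries v c∉
          c< = neighbour-< u (∈-upTo⁻ x∈)

      ∏-degree : ∀ i → ∏ degree (suc i) ≡ s * p * (s ∸ l) ^ i
      ∏-degree zero    = trans (+-identityʳ _) (sym (*-identityʳ _))
      ∏-degree (suc i) = trans (cong (_* (s ∸ l)) (∏-degree i)) (lem (s * p) (s ∸ l) ((s ∸ l) ^ i))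
        where
        lem : ∀ a b c → a * c * b ≡ a * (b * c)
        lem = solve-∀

    paths : ∀ n .{{_ : NonZero n}} → s * p ≤ n → ∀ l → s * p * (s ∸ suc l) ^ l ≤ 2 * ex n (path (suc l)) (cycle 4)
    paths n sp≤n l = ≤-trans (≤-reflexive (sym (∏-degree (suc l) l))) (≤-trans (Choices.many L)
      (paths≤2*ex R′? R′-sym (λ u r → R-irrefl u (proj₁ r)) n 2 (suc l) (λ w _ → no-walk w) (Choices.list L) (Choices.unique L)
        λ v∈ → let isP , bd = Choices.valid L v∈ in isP , λ i → <-≤-trans (bd i) sp≤n))
      where
      L = grow (P (suc l)) (degree (suc l)) (tt , λ ()) (suc l) (step (suc l))

-- Inequalities that absorb the factor 2 and the lower-order terms.

module Slack where

  open import Data.Nat using (zero; suc; _+_; _*_; _^_; _≤_; s≤s)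
  open import Data.Nat.Properties
  open import Data.Nat.Tactic.RingSolver using (solve-∀)
  open import Data.Sum using (_⊎_; inj₁; inj₂)
  open import Data.Product using (_×_; _,_)
  open import Relation.Binary.PropositionalEquality
  open PrimeInInterval using (^-distribʳ)

  open ≤-Reasoning

  -- The mean value estimate for the power e + 1 between a and a + c, written without subtraction.
  bernoulli : ∀ a c e → (a + c) ^ suc e ≤ a ^ suc e + suc e * c * (a + c) ^ e
  bernoulli a c zero = ≤-reflexive (lem a c)
    where
    lem : ∀ a c → (a + c) * 1 ≡ a * 1 + 1 * c * 1
    lem = solve-∀
  bernoulli a c (suc e) = begin
    (a + c) * (a + c) ^ suc e
      ≡⟨ *-distribʳ-+ _ a c ⟩
    a * (a + c) ^ suc e + c * (a + c) ^ suc e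
      ≤⟨ +-monoˡ-≤ _ (*-monoʳ-≤ a (bernoulli a c e)) ⟩
    a * (a ^ suc e + suc e * c * y) + c * (a + c) ^ suc e
      ≡⟨ lem₁ a (a ^ suc e) (suc e) c y _ ⟩
    a * a ^ suc e + (suc e * c * (a * y) + c * (a + c) ^ suc e)
      ≤⟨ +-monoʳ-≤ (a * a ^ suc e) (+-monoˡ-≤ _ (*-monoʳ-≤ (suc e * c) (*-monoˡ-≤ y (m≤m+n a c)))) ⟩
    a * a ^ suc e + (suc e * c * (a + c) ^ suc e + c * (a + c) ^ suc e)
      ≡⟨ cong (a * a ^ suc e +_) (lem₂ (suc e) c _) ⟩
    a * a ^ suc e + suc (suc e) * c * (a + c) ^ suc e ∎
    where
    y = (a + c) ^ e
    lem₁ : ∀ a x n c y z → a * (x + n * c * y) + c * z ≡ a * x + (n * c * (a * y) + c * z)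
    lem₁ = solve-∀
    lem₂ : ∀ n c z → n * c * z + c * z ≡ suc n * c * z
    lem₂ = solve-∀

  reverse-bernoulli : ∀ a e → a ^ suc e + suc e * a ^ e ≤ suc a ^ suc e
  reverse-bernoulli a zero = ≤-reflexive (lem a)
    where
    lem : ∀ a → a * 1 + 1 * 1 ≡ suc a * 1
    lem = solve-∀
  reverse-bernoulli a (suc e) = begin
    a * x + suc (suc e) * x               ≤⟨ m≤m+n _ (suc e * a ^ e) ⟩
    a * x + suc (suc e) * x + suc e * a ^ e ≡⟨ lem a (a ^ e) (suc e) ⟩
    suc a * (x + suc e * a ^ e)           ≤⟨ *-monoʳ-≤ (suc a) (reverse-bernoulli a e) ⟩
    suc a * suc a ^ suc e                 ∎
    where
    x = a ^ suc e
    lem : ∀ a y n → a * (a * y) + suc n * (a * y) + n * y ≡ suc a * (a * y + n * y)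
    lem = solve-∀

  -- The first two terms of (r + 1)^e are r^e and e r^(e-1), and e > r makes the second exceed the
  -- first. The 1 is the room into which `blowUp-slack` fits its error term.
  doubling : ∀ r e → 1 ≤ r → suc r ≤ e → 2 * r ^ e + 1 ≤ suc r ^ e
  doubling r@(suc _) (suc e) 1≤r (s≤s r≤e) = begin
    2 * r ^ suc e + 1                  ≤⟨ +-monoʳ-≤ (2 * r ^ suc e) (m^n>0 r e) ⟩
    2 * r ^ suc e + r ^ e              ≡⟨ lem r (r ^ e) ⟩
    r ^ suc e + suc r * r ^ e          ≤⟨ +-monoʳ-≤ (r ^ suc e) (*-monoˡ-≤ (r ^ e) (s≤s r≤e)) ⟩
    r ^ suc e + suc e * r ^ e          ≤⟨ reverse-bernoulli r e ⟩
    suc r ^ suc e                      ∎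
    where
    lem : ∀ r x → 2 * (r * x) + x ≡ r * x + suc r * x
    lem = solve-∀

  -- M is the number of available vertices per class, and r M + c will bound n. The lower bound on M
  -- reduces the effect of c to at most one M^(e + 1), the room left by `doubling`.
  blowUp-slack : ∀ r c e M → 1 ≤ r → suc r ≤ suc e → 2 * (suc e * c) * suc r ^ e ≤ M → c ≤ M →
    2 * (r * M + c) ^ suc e ≤ suc r ^ suc e * M ^ suc e
  blowUp-slack r c e M 1≤r r≤e big c≤M = begin
    2 * (r * M + c) ^ suc e
      ≤⟨ *-monoʳ-≤ 2 (bernoulli (r * M) c e) ⟩
    2 * ((r * M) ^ suc e + suc e * c * (r * M + c) ^ e)
      ≤⟨ *-monoʳ-≤ 2 (+-mono-≤ (≤-reflexive (^-distribʳ r M (suc e))) (*-monoʳ-≤ (suc e * c) (≤-trans (^-monoˡ-≤ e rM+c≤) (≤-reflexive (^-distribʳ (suc r) M e))))) ⟩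
    2 * (r ^ suc e * M ^ suc e + suc e * c * (suc r ^ e * M ^ e))
      ≡⟨ lem₁ (r ^ suc e) (M ^ suc e) (suc e * c) (suc r ^ e) (M ^ e) ⟩
    2 * r ^ suc e * M ^ suc e + 2 * (suc e * c) * suc r ^ e * M ^ e
      ≤⟨ +-monoʳ-≤ (2 * r ^ suc e * M ^ suc e) (*-monoˡ-≤ (M ^ e) big) ⟩
    2 * r ^ suc e * M ^ suc e + M ^ suc e
      ≡⟨ lem₂ (2 * r ^ suc e) (M ^ suc e) ⟩
    (2 * r ^ suc e + 1) * M ^ suc e
      ≤⟨ *-monoˡ-≤ (M ^ suc e) (doubling r (suc e) 1≤r r≤e) ⟩
    suc r ^ suc e * M ^ suc e ∎
    where
    rM+c≤ : r * M + c ≤ suc r * M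
    rM+c≤ = ≤-trans (+-monoʳ-≤ (r * M) c≤M) (≤-reflexive (+-comm (r * M) M))
    lem₁ : ∀ x m n y z → 2 * (x * m + n * (y * z)) ≡ 2 * x * m + 2 * n * y * z
    lem₁ = solve-∀
    lem₂ : ∀ x m → x * m + m ≡ (x + 1) * m
    lem₂ = solve-∀

  -- The second hypothesis on K, a, b is the case j = 2 of the odd case.
  polarity-slack : ∀ K a b → K ≤ 2 * (a * a) → 2 * (K * (K * K)) ≤ 2 * (a * a) * (2 * (a * a) * (2 * b)) → K ≤ b * a →
    ∀ j T w q l e → 2 ≤ j → 1 ≤ T → a * T ≤ w → b * (T * T) ≤ q →
    (l ≡ j + j × e ≡ suc j) ⊎ (suc l ≡ j + j × e ≡ j) →
    2 * (K * (T * T)) ^ e ≤ j ^ e * (q * w ^ l)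
  polarity-slack K a b h₁ h₂ h₃ (suc zero) T w q l e (s≤s ())
  polarity-slack K a b h₁ h₂ h₃ j@(suc (suc i)) T w q l e 2≤j 1≤T aT≤w bTT≤q (inj₁ (refl , refl)) = begin
    2 * (K * U) ^ suc j
      ≡⟨ lem₁ K U ((K * U) ^ i) ⟩
    2 * (K * (K * K)) * (U * (U * U)) * (K * U) ^ i
      -- Three of the j + 1 factors are paid for by `h₂`, each of the remaining j - 2 by `h₁`.
      ≤⟨ *-mono-≤ (*-monoˡ-≤ (U * (U * U)) h₂) (^-monoˡ-≤ i (*-monoˡ-≤ U h₁)) ⟩
    2 * (a * a) * (2 * (a * a) * (2 * b)) * (U * (U * U)) * (2 * (a * a) * U) ^ i
      ≡⟨ lem₂ (a * a) b U ((2 * (a * a) * U) ^ i) ⟩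
    2 * (b * U) * (2 * (a * a) * U) ^ j
      ≤⟨ *-mono-≤ (*-mono-≤ 2≤j bTT≤q) (^-monoˡ-≤ j (*-monoˡ-≤ U (*-monoˡ-≤ (a * a) 2≤j))) ⟩
    j * q * (j * (a * a) * U) ^ j
      ≡⟨ cong (j * q *_) (trans (cong (_^ j) (lem₃ j a T)) (^-distribʳ j (a * T * (a * T)) j)) ⟩
    j * q * (j ^ j * (a * T * (a * T)) ^ j)
      ≤⟨ *-monoʳ-≤ (j * q) (*-monoʳ-≤ (j ^ j) (^-monoˡ-≤ j (*-mono-≤ aT≤w aT≤w))) ⟩
    j * q * (j ^ j * (w * w) ^ j)
      ≡⟨ cong (λ z → j * q * (j ^ j * z)) (trans (^-distribʳ w w j) (sym (^-distribˡ-+-* w j j))) ⟩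
    j * q * (j ^ j * w ^ (j + j))
      ≡⟨ lem₄ j q (j ^ j) (w ^ (j + j)) ⟩
    j ^ suc j * (q * w ^ (j + j)) ∎
    where
    U = T * T
    lem₁ : ∀ K U z → 2 * (K * U * (K * U * (K * U * z))) ≡ 2 * (K * (K * K)) * (U * (U * U)) * z
    lem₁ = solve-∀
    lem₂ : ∀ A b U z → 2 * A * (2 * A * (2 * b)) * (U * (U * U)) * z ≡ 2 * (b * U) * (2 * A * U * (2 * A * U * z))
    lem₂ = solve-∀
    lem₃ : ∀ j a T → j * (a * a) * (T * T) ≡ j * (a * T * (a * T))
    lem₃ = solve-∀
    lem₄ : ∀ j q x y → j * q * (x * y) ≡ j * x * (q * y)
    lem₄ = solve-∀
  polarity-slack K a b h₁ h₂ h₃ j@(suc (suc i)) T w q l e 2≤j 1≤T aT≤w bTT≤q (inj₂ (l-eq , refl)) = begin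
    2 * (K * U) ^ j
      ≡⟨ lem₁ K U ((K * U) ^ h) ⟩
    2 * K * U * (K * U) ^ h
      -- Now l = 2 (j - 1) + 1. The unpaired factor w ≥ a T supplies so much that the crude `h₃`
      -- suffices, even with T bounded below by 1.
      ≤⟨ *-mono-≤ (*-monoˡ-≤ U (*-monoʳ-≤ 2 (≤-trans h₃ (*-monoʳ-≤ b (≤-trans (≤-reflexive (sym (*-identityʳ a))) (*-monoʳ-≤ a 1≤T)))))) (^-monoˡ-≤ h (*-monoˡ-≤ U h₁)) ⟩
    2 * (b * (a * T)) * U * (2 * (a * a) * U) ^ h
      ≡⟨ cong (_* (2 * (a * a) * U) ^ h) (lem₂ b (a * T) U) ⟩
    2 * (b * U * (a * T)) * (2 * (a * a) * U) ^ h
      ≤⟨ *-mono-≤ (*-mono-≤ 2≤j (*-mono-≤ bTT≤q aT≤w)) (^-monoˡ-≤ h (*-monoˡ-≤ U (*-monoˡ-≤ (a * a) 2≤j))) ⟩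
    j * (q * w) * (j * (a * a) * U) ^ h
      ≡⟨ cong (j * (q * w) *_) (trans (cong (_^ h) (lem₃ j a T)) (^-distribʳ j (a * T * (a * T)) h)) ⟩
    j * (q * w) * (j ^ h * (a * T * (a * T)) ^ h)
      ≤⟨ *-monoʳ-≤ (j * (q * w)) (*-monoʳ-≤ (j ^ h) (^-monoˡ-≤ h (*-mono-≤ aT≤w aT≤w))) ⟩
    j * (q * w) * (j ^ h * (w * w) ^ h)
      ≡⟨ cong (λ z → j * (q * w) * (j ^ h * z)) (trans (^-distribʳ w w h) (sym (^-distribˡ-+-* w h h))) ⟩
    j * (q * w) * (j ^ h * w ^ (h + h))
      ≡⟨ lem₄ j q w (j ^ h) (w ^ (h + h)) ⟩
    j ^ j * (q * w ^ suc (h + h))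
      ≡⟨ cong (λ n → j ^ j * (q * w ^ n)) (suc-injective (trans (cong suc (sym (+-suc h h))) (sym l-eq))) ⟩
    j ^ j * (q * w ^ l) ∎
    where
    U = T * T
    h = suc i
    lem₁ : ∀ K U z → 2 * (K * U * z) ≡ 2 * K * U * z
    lem₁ = solve-∀
    lem₂ : ∀ b x U → 2 * (b * x) * U ≡ 2 * (b * U * x)
    lem₂ = solve-∀
    lem₃ : ∀ j a T → j * (a * a) * (T * T) ≡ j * (a * T * (a * T))
    lem₃ = solve-∀
    lem₄ : ∀ j q w x y → j * (q * w) * (x * y) ≡ j * x * (q * (w * y))
    lem₄ = solve-∀

-- Parameters of the three constructions.

module Counting where

  open import Defs using (path; cycle; ex)
  open PrimeDivisors using (bracket)
  open PrimeInInterval using (∃-prime)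
  open Alternating using (isEven; even-⌊/2⌋; odd-⌊/2⌋; module CompleteBipartite)
  open HubGraph using (module BlownUpPath)
  open Polarity using (module PolarityGraph)
  open Slack
  open import Data.Bool using (true; false)
  open import Data.Nat using (ℕ; zero; suc; _+_; _*_; _∸_; _^_; _≤_; _<_; z≤n; s≤s; NonZero; >-nonZero; ⌊_/2⌋; ⌈_/2⌉; _≤ᵇ_)
  open import Data.Nat.Combinatorics using (_P_)
  open import Data.Nat.Combinatorics.Base using (_P′_)
  open import Data.Nat.DivMod using (_/_; _%_; m/n*n≤m; m%n<n; m≡m%n+[m/n]*n)
  open import Data.Nat.Primality using (Prime; prime⇒nonZero)
  open import Data.Nat.Properties
  open import Data.Nat.Tactic.RingSolver using (solve-∀)
  open import Data.Product using (∃-syntax; _×_; _,_)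
  import Data.Sum
  open import Data.Sum using (_⊎_; inj₁; inj₂)
  open import Data.Unit using (tt)
  open import Relation.Binary.PropositionalEquality

  open ≤-Reasoning

  P≤P′ : ∀ n k → n P k ≤ n P′ k
  P≤P′ n k with k ≤ᵇ n
  ... | true  = ≤-refl
  ... | false = z≤n

  ⌈l/2⌉-cases : ∀ l → ⌈ l /2⌉ ≡ ⌊ l /2⌋ ⊎ ⌈ l /2⌉ ≡ suc ⌊ l /2⌋
  ⌈l/2⌉-cases l with isEven l in eq
  ... | true  = inj₁ (even-⌊/2⌋ l eq)
  ... | false = inj₂ (odd-⌊/2⌋ l eq)

  -- This is 2 ex ≥ (1 - c / n) F multiplied by n, to stay within ℕ. The loss comes from replacing n
  -- by n - C, where C = k - 1 + l counts the hubs and the entries avoided.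
  ∃-short : ∀ k l → 1 ≤ k → 2 ≤ l → ∃[ c ] ∃[ N ] ∀ n → N ≤ n →
    let F = ((k ∸ 1) P ⌊ l /2⌋) * n ^ ⌈ l /2⌉ in n * F ≤ 2 * (n * ex n (path l) (cycle (2 * k))) + c * F
  ∃-short (suc D) l@(suc (suc l′)) 1≤k (s≤s (s≤s _)) = suc e * C , suc C , bound
    where
    e = ⌊ suc l′ /2⌋
    C = D + l
    g = D P ⌊ l /2⌋
    bound : ∀ n → suc C ≤ n → n * (g * n ^ suc e) ≤ 2 * (n * ex n (path l) (cycle (2 * suc D))) + suc e * C * (g * n ^ suc e)
    bound n C<n = begin
      n * (g * n ^ suc e)
        ≤⟨ *-monoʳ-≤ n (*-monoʳ-≤ g n^e≤) ⟩
      n * (g * ((n ∸ C) ^ suc e + suc e * C * n ^ e))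
        ≡⟨ lem₁ n g ((n ∸ C) ^ suc e) (suc e * C) (n ^ e) ⟩
      n * ((n ∸ C) ^ suc e * g) + suc e * C * (g * n ^ suc e)
        ≤⟨ +-monoˡ-≤ _ (*-monoʳ-≤ n paths) ⟩
      n * (2 * X) + suc e * C * (g * n ^ suc e)
        ≡⟨ cong (_+ suc e * C * (g * n ^ suc e)) (lem₂ n X) ⟩
      2 * (n * X) + suc e * C * (g * n ^ suc e) ∎
      where
      X = ex n (path l) (cycle (2 * suc D))
      C≤n : C ≤ n
      C≤n = <⇒≤ C<n
      n^e≤ : n ^ suc e ≤ (n ∸ C) ^ suc e + suc e * C * n ^ e
      n^e≤ = subst (λ m → m ^ suc e ≤ (n ∸ C) ^ suc e + suc e * C * m ^ e) (m∸n+n≡m C≤n) (bernoulli (n ∸ C) C e)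
      order : ∀ D → 2 + (D + D) ≡ 2 * suc D
      order = solve-∀
      paths : (n ∸ C) ^ suc e * g ≤ 2 * X
      paths = begin
        (n ∸ C) ^ suc e * g                    ≤⟨ *-monoʳ-≤ ((n ∸ C) ^ suc e) (P≤P′ D ⌊ l /2⌋) ⟩
        (n ∸ C) ^ suc e * (D P′ ⌊ l /2⌋)       ≡⟨ cong (λ m → m ^ suc e * (D P′ ⌊ l /2⌋)) (∸-+-assoc n D l) ⟨
        (n ∸ D ∸ l) ^ suc e * (D P′ ⌊ l /2⌋)   ≤⟨ CompleteBipartite.paths D n (≤-trans (m≤m+n D l) C≤n) l {{>-nonZero (≤-trans (s≤s z≤n) C<n)}} ⟩
        2 * ex n (path l) (cycle (2 + (D + D))) ≡⟨ cong (λ m → 2 * ex n (path l) (cycle m)) (order D) ⟩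
        2 * X                                  ∎
      lem₁ : ∀ n g x c y → n * (g * (x + c * y)) ≡ n * (x * g) + c * (g * (n * y))
      lem₁ = solve-∀
      lem₂ : ∀ n x → n * (2 * x) ≡ 2 * (n * x)
      lem₂ = solve-∀

  -- There is no error term: for large n the surplus of the constructions pays for all rounding.
  LongBound : ℕ → ℕ → Set
  LongBound k l = ∃[ N ] ∀ n → N ≤ n → n ^ ⌈ l /2⌉ ≤ ⌊ l /2⌋ ^ ⌈ l /2⌉ * ex n (path l) (cycle k)

  -- With j − 1 classes instead of j each class is larger by the factor j / (j − 1),
  -- whose ⌈l/2⌉-th power exceeds 2 and pays for traversing every path in both directions.
  blownUpPath-bound : ∀ k l → 2 < k → 4 ≤ l → LongBound (2 + k) l
  blownUpPath-bound k l@(suc (suc (suc (suc l′)))) 2<k (s≤s (s≤s (s≤s (s≤s _)))) = r * B + c + suc j , bound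
    where
    r′ = ⌊ l′ /2⌋
    r = suc r′
    j = suc r
    e = suc ⌈ l′ /2⌉
    -- c collects the losses in n ≤ r M + c: l avoided vertices in each of r classes, the remainder
    -- of the division by r, and the j hubs. B is the size that `blowUp-slack` asks of M, and n ≥ r
    -- B + c enforces it.
    c = r * l + r + j
    B = 2 * (suc e * c) * suc r ^ e + c
    suc-r≤ : suc r ≤ suc e
    suc-r≤ = ⌊n/2⌋≤⌈n/2⌉ l
    bound : ∀ n → r * B + c + suc j ≤ n → n ^ suc e ≤ j ^ suc e * ex n (path l) (cycle (2 + k))
    bound n big = *-cancelˡ-≤ 2 (begin
      2 * n ^ suc e               ≤⟨ *-monoʳ-≤ 2 (^-monoˡ-≤ (suc e) n≤) ⟩
      2 * (r * M + c) ^ suc e     ≤⟨ blowUp-slack r c e M (s≤s z≤n) suc-r≤ (≤-trans (m≤m+n _ c) B≤M) (≤-trans (m≤n+m c _) B≤M) ⟩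
      j ^ suc e * M ^ suc e       ≤⟨ *-monoʳ-≤ (j ^ suc e) paths ⟩
      j ^ suc e * (2 * X)         ≡⟨ lem (j ^ suc e) X ⟩
      2 * (j ^ suc e * X)         ∎)
      where
      X = ex n (path l) (cycle (2 + k))
      m = (n ∸ j) / r
      M = m ∸ l
      j<n : j < n
      j<n = ≤-trans (m≤n+m (suc j) (r * B + c)) big
      lem : ∀ a x → a * (2 * x) ≡ 2 * (a * x)
      lem = solve-∀
      n≤ : n ≤ r * M + c
      n≤ = begin
        n                                ≤⟨ m≤n+m∸n n j ⟩
        j + (n ∸ j)                      ≡⟨ cong (j +_) (m≡m%n+[m/n]*n (n ∸ j) r) ⟩
        j + ((n ∸ j) % r + m * r)        ≤⟨ +-monoʳ-≤ j (+-mono-≤ (<⇒≤ (m%n<n (n ∸ j) r)) (*-monoˡ-≤ r (m≤n+m∸n m l))) ⟩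
        j + (r + (l + M) * r)            ≡⟨ lem′ j r l M ⟩
        r * M + c                        ∎
        where
        lem′ : ∀ j r l M → j + (r + (l + M) * r) ≡ r * M + (r * l + r + j)
        lem′ = solve-∀
      B≤M : B ≤ M
      B≤M = *-cancelˡ-≤ r (+-cancelʳ-≤ c (r * B) (r * M) (≤-trans (≤-trans (m≤m+n _ (suc j)) big) n≤))
      paths : M ^ suc e ≤ 2 * X
      paths = BlownUpPath.paths r′ n m l fits ≤-refl {{>-nonZero (≤-trans (s≤s z≤n) j<n)}} 2<k
        where
        fits : j + m * r ≤ n
        fits = ≤-trans (+-monoʳ-≤ j (m/n*n≤m (n ∸ j) r)) (≤-reflexive (m+[n∸m]≡n (<⇒≤ j<n)))
  -- For n close to (600 t)² take a prime p in (480 t, 840 t].  If p ≤ 600 t, all p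
  -- values of x can be used, otherwise only the first (600 t)² / p of them.  The
  -- numerals 477, 427 and 359000 are 480, 428 and 360000 minus room for lower order terms.
  module _ (l : ℕ) (4≤l : 4 ≤ suc l) where

    private
      K = 360000
      j = ⌊ suc l /2⌋
      e = ⌈ suc l /2⌉

    parity-cases : (l ≡ j + j × e ≡ suc j) ⊎ (suc l ≡ j + j × e ≡ j)
    parity-cases with ⌈l/2⌉-cases (suc l)
    ... | inj₁ eq = inj₂ (trans (sym (⌊n/2⌋+⌈n/2⌉≡n (suc l))) (cong (j +_) eq) , eq)
    ... | inj₂ eq = inj₁ (suc-injective (trans (sym (⌊n/2⌋+⌈n/2⌉≡n (suc l))) (trans (cong (j +_) eq) (+-suc j j))) , eq)

    -- The common end of both cases: a and b measure the usable degree in units of T and its product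
    -- with p in units of T², so that only numerical checks on a and b remain.
    from-prime : ∀ {p} → Prime p → ∀ n T s a b → 1 ≤ T → n ≤ K * (T * T) → s ≤ p → s * p ≤ n →
      a * T ≤ s ∸ suc l → b * (T * T) ≤ (s ∸ suc l) * p →
      K ≤ 2 * (a * a) → 2 * (K * (K * K)) ≤ 2 * (a * a) * (2 * (a * a) * (2 * b)) → K ≤ b * a →
      0 < n → n ^ e ≤ j ^ e * ex n (path (suc l)) (cycle 4)
    from-prime {p} pp n T s a b 1≤T n≤ s≤p sp≤n aT≤ bTT≤ h₁ h₂ h₃ 0<n = *-cancelˡ-≤ 2 (begin
      2 * n ^ e                    ≤⟨ *-monoʳ-≤ 2 (^-monoˡ-≤ e n≤) ⟩
      2 * (K * (T * T)) ^ e        ≤⟨ polarity-slack K a b h₁ h₂ h₃ j T w (w * p) l e (⌊n/2⌋-mono 4≤l) 1≤T aT≤ bTT≤ parity-cases ⟩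
      j ^ e * (w * p * w ^ l)      ≤⟨ *-monoʳ-≤ (j ^ e) (*-monoˡ-≤ (w ^ l) (*-monoˡ-≤ p (m∸n≤m s (suc l)))) ⟩
      j ^ e * (s * p * w ^ l)      ≤⟨ *-monoʳ-≤ (j ^ e) (PolarityGraph.paths pp s s≤p n {{>-nonZero 0<n}} sp≤n l) ⟩
      j ^ e * (2 * X)              ≡⟨ lem (j ^ e) X ⟩
      2 * (j ^ e * X)              ∎)
      where
      w = s ∸ suc l
      X = ex n (path (suc l)) (cycle 4)
      lem : ∀ a x → a * (2 * x) ≡ 2 * (a * x)
      lem = solve-∀

    smallPrime : ∀ t p → 478 + l ≤ 3 * t → 480 * t < p → 477 * suc t ≤ p ∸ suc l
    smallPrime t p big lt = m+n≤o⇒m≤o∸n (477 * suc t) (begin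
      477 * suc t + suc l     ≡⟨ lem t l ⟩
      478 + l + 477 * t       ≤⟨ +-monoˡ-≤ (477 * t) big ⟩
      3 * t + 477 * t         ≡⟨ *-distribʳ-+ t 3 477 ⟨
      480 * t                 ≤⟨ <⇒≤ lt ⟩
      p                       ∎)
      where
      lem : ∀ t l → 477 * suc t + suc l ≡ 478 + l + 477 * t
      lem = solve-∀

    -- Rounding s down costs p, the avoided entries cost (l + 1) p, and passing from t to t + 1
    -- costs at most 1077000 t. With p ≤ 1000 t this is at most 1000 (1079 + l) t, covered by the
    -- 1000 t² between 359000 t² and K t².
    largePrime : ∀ t p s → 1 ≤ t → 1079 + l ≤ t → p ≤ 840 * t → K * (t * t) ≤ s * p + p →
      359000 * (suc t * suc t) ≤ (s ∸ suc l) * p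
    largePrime t p s 1≤t big p≤ Ktt≤ = ≤-trans (m+n≤o⇒m≤o∸n (359000 * (suc t * suc t)) (+-cancelʳ-≤ p (359000 * (suc t * suc t) + suc l * p) (s * p) (begin
      359000 * (suc t * suc t) + suc l * p + p           ≡⟨ lem₀ (359000 * (suc t * suc t)) l p ⟩
      359000 * (suc t * suc t) + (2 + l) * p             ≤⟨ +-mono-≤ (square 359000) (*-monoʳ-≤ (2 + l) (≤-trans p≤ (*-monoˡ-≤ t (≤ᵇ⇒≤ 840 1000 tt)))) ⟩
      359000 * (t * t) + 1077000 * t + (2 + l) * (1000 * t) ≡⟨ lem₂ 1000 359000 t l ⟩
      359000 * (t * t) + 1000 * ((1079 + l) * t)         ≤⟨ +-monoʳ-≤ (359000 * (t * t)) (*-monoʳ-≤ 1000 (*-monoˡ-≤ t big)) ⟩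
      359000 * (t * t) + 1000 * (t * t)                  ≡⟨ *-distribʳ-+ (t * t) 359000 1000 ⟨
      K * (t * t)                                        ≤⟨ Ktt≤ ⟩
      s * p + p                                          ∎))) (≤-reflexive (sym (*-distribʳ-∸ p s (suc l))))
      where
      lem₀ : ∀ x l p → x + suc l * p + p ≡ x + (2 + l) * p
      lem₀ = solve-∀
      lem₁ : ∀ c t → c * (suc t * suc t) ≡ c * (t * t) + c * (2 * t + 1)
      lem₁ = solve-∀
      lem₂ : ∀ c d t l → d * (t * t) + 1077 * c * t + (2 + l) * (c * t) ≡ d * (t * t) + c * ((1079 + l) * t)
      lem₂ = solve-∀
      lem₃ : ∀ t → 2 * t + t ≡ 3 * t
      lem₃ = solve-∀
      square : ∀ c → c * (suc t * suc t) ≤ c * (t * t) + c * 3 * t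
      square c = begin
        c * (suc t * suc t)              ≡⟨ lem₁ c t ⟩
        c * (t * t) + c * (2 * t + 1)    ≤⟨ +-monoʳ-≤ (c * (t * t)) (*-monoʳ-≤ c (+-monoʳ-≤ (2 * t) 1≤t)) ⟩
        c * (t * t) + c * (2 * t + t)    ≡⟨ cong (λ z → c * (t * t) + c * z) (lem₃ t) ⟩
        c * (t * t) + c * (3 * t)        ≡⟨ cong (c * (t * t) +_) (*-assoc c 3 t) ⟨
        c * (t * t) + c * 3 * t          ∎

    -- 427 · 840 = 358680 falls just short of 359000.
    largePrime-degree : ∀ T w p → p ≤ 840 * T → 1 ≤ T → 359000 * (T * T) ≤ w * p → 427 * T ≤ w
    largePrime-degree T w p p≤ 1≤T h = ≮⇒≥ λ w< → <⇒≱ (begin-strict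
      w * p                     ≤⟨ *-mono-≤ (<⇒≤ w<) p≤ ⟩
      427 * T * (840 * T)       ≡⟨ lem 427 840 T ⟩
      427 * 840 * (T * T)       <⟨ *-monoˡ-< (T * T) {{>-nonZero (*-mono-≤ 1≤T 1≤T)}} (≤ᵇ⇒≤ 358681 359000 tt) ⟩
      359000 * (T * T)          ∎) h
      where
      lem : ∀ a b T → a * T * (b * T) ≡ a * b * (T * T)
      lem = solve-∀

    smallPrime-bound : ∀ {p} → Prime p → ∀ n T → 1 ≤ T → n ≤ K * (T * T) → p * p ≤ n → 477 * T ≤ p ∸ suc l → 0 < n →
      n ^ e ≤ j ^ e * ex n (path (suc l)) (cycle 4)
    smallPrime-bound {p} pp n T 1≤T n≤ pp≤n deg = from-prime pp n T p 477 (477 * 477) 1≤T n≤ ≤-refl pp≤n deg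
      (square 477 T (p ∸ suc l) p deg (m∸n≤m p (suc l)))
      (≤ᵇ⇒≤ K (2 * (477 * 477)) tt)
      -- This says (600 / 477)^6 ≤ 4, the loss that l = 5 allows; 476 would already fail.
      (≤ᵇ⇒≤ (2 * (K * (K * K))) (2 * (477 * 477) * (2 * (477 * 477) * (2 * (477 * 477)))) tt)
      (≤ᵇ⇒≤ K (477 * 477 * 477) tt)
      where
      lem : ∀ a t → a * a * (t * t) ≡ a * t * (a * t)
      lem = solve-∀
      square : ∀ a T w p → a * T ≤ w → w ≤ p → a * a * (T * T) ≤ w * p
      square a T w p h h′ = ≤-trans (≤-reflexive (lem a T)) (*-mono-≤ h (≤-trans h h′))

    largePrime-bound : ∀ {p} → Prime p → ∀ n T s → 1 ≤ T → n ≤ K * (T * T) → s ≤ p → s * p ≤ n → p ≤ 840 * T →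
      359000 * (T * T) ≤ (s ∸ suc l) * p → 0 < n → n ^ e ≤ j ^ e * ex n (path (suc l)) (cycle 4)
    largePrime-bound {p} pp n T s 1≤T n≤ s≤p sp≤n p≤ mass = from-prime pp n T s 427 359000 1≤T n≤ s≤p sp≤n
      (largePrime-degree T (s ∸ suc l) p p≤ 1≤T mass) mass
      (≤ᵇ⇒≤ K (2 * (427 * 427)) tt)
      -- This says (600 / 427)^4 · 360000 / 359000 ≤ 4.
      (≤ᵇ⇒≤ (2 * (K * (K * K))) (2 * (427 * 427) * (2 * (427 * 427) * (2 * 359000))) tt)
      (≤ᵇ⇒≤ K (359000 * 427) tt)

    Large : ℕ → Set
    Large t = 60 ^ 4 ≤ 10 * t × 478 + l ≤ 3 * t × 1079 + l ≤ t

    large : ∀ c t → 60 ^ 4 ≤ c → c + l ≤ t → Large t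
    large c t h le =
      ≤-trans (≤-trans h (≤-trans (m≤m+n c l) le)) (m≤n*m t 10) ,
      ≤-trans (≤-trans (+-monoˡ-≤ l (≤-trans (≤ᵇ⇒≤ 478 (60 ^ 4) tt) h)) le) (m≤n*m t 3) ,
      ≤-trans (+-monoˡ-≤ l (≤-trans (≤ᵇ⇒≤ 1079 (60 ^ 4) tt) h)) le

    at-scale : ∀ n t T → T ≡ suc t → Large t → K * (t * t) ≤ n → n ≤ K * (T * T) → 1 ≤ t → 0 < n →
      n ^ e ≤ j ^ e * ex n (path (suc l)) (cycle 4)
    -- The argument 10 t turns 48 and 84 into 480 and 840, that is, 0.8 and 1.4 times 600.
    at-scale n t T T≡ (10t≥ , 3t≥ , t≥) lo hi 1≤t 0<n = choose (∃-prime (10 * t) 10t≥)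
      where
      Goal = n ^ e ≤ j ^ e * ex n (path (suc l)) (cycle 4)
      1≤T : 1 ≤ T
      1≤T = subst (1 ≤_) (sym T≡) (s≤s z≤n)
      lem : ∀ a t → a * t * (a * t) ≡ a * a * (t * t)
      lem = solve-∀
      small : ∀ {p} → Prime p → 480 * t < p → p ≤ 600 * t → Goal
      small {p} pp gt p≤ = smallPrime-bound pp n T 1≤T hi
        (≤-trans (*-mono-≤ p≤ p≤) (≤-trans (≤-reflexive (lem 600 t)) lo))
        (subst (λ T → 477 * T ≤ p ∸ suc l) (sym T≡) (smallPrime t p 3t≥ gt)) 0<n
      large′ : ∀ {p} → Prime p → 600 * t ≤ p → p ≤ 840 * t → Goal
      large′ {p} pp p≥ p≤ = largePrime-bound pp n T s 1≤T hi s≤p (≤-trans (m/n*n≤m (K * (t * t)) p) lo)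
        (≤-trans p≤ (*-monoʳ-≤ 840 (subst (t ≤_) (sym T≡) (n≤1+n t))))
        (subst (λ T → 359000 * (T * T) ≤ (s ∸ suc l) * p) (sym T≡) (largePrime t p s 1≤t t≥ p≤ Ktt≤)) 0<n
        where
        instance
          p≢0 : NonZero p
          p≢0 = prime⇒nonZero pp
        s = K * (t * t) / p
        Ktt≤ : K * (t * t) ≤ s * p + p
        Ktt≤ = begin
          K * (t * t)                    ≡⟨ m≡m%n+[m/n]*n (K * (t * t)) p ⟩
          K * (t * t) % p + s * p        ≡⟨ +-comm (K * (t * t) % p) (s * p) ⟩
          s * p + K * (t * t) % p        ≤⟨ +-monoʳ-≤ (s * p) (<⇒≤ (m%n<n (K * (t * t)) p)) ⟩
          s * p + p                      ∎
        s≤p : s ≤ p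
        s≤p = *-cancelʳ-≤ s p p (≤-trans (m/n*n≤m (K * (t * t)) p) (≤-trans (≤-reflexive (sym (lem 600 t))) (*-mono-≤ p≥ p≥)))
      choose : ∃[ p ] Prime p × 48 * (10 * t) < p × p ≤ 84 * (10 * t) → Goal
      choose (p , pp , gt , le) = Data.Sum.[ small pp (subst (_< p) (sym (*-assoc 48 10 t)) gt) ,
        (λ p≥ → large′ pp p≥ (subst (p ≤_) (sym (*-assoc 84 10 t)) le)) ] (≤-total p (600 * t))

    -- The scale t is the integer part of √(n / K).
    eventually : ∀ K t₀ .{{_ : NonZero K}} {Q : ℕ → Set} → 1 ≤ t₀ →
      (∀ n t T → T ≡ suc t → t₀ ≤ t → K * (t * t) ≤ n → n ≤ K * (T * T) → 1 ≤ t → 0 < n → Q n) →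
      ∀ n → K * (t₀ * t₀) ≤ n → Q n
    eventually K t₀ 1≤t₀ scale n big with bracket (λ q → K * (q * q)) {n} (≤-trans (≤-reflexive (*-zeroʳ K)) z≤n) (suc n)
        (≤-trans (m≤m*n (suc n) (suc n)) (m≤n*m (suc n * suc n) K))
    ... | t , lo , hi = scale n t (suc t) refl t₀≤t lo (<⇒≤ hi) 1≤t (≤-trans (≤-trans (*-mono-≤ 1≤t 1≤t) (m≤n*m (t * t) K)) lo)
      where
      t₀≤t : t₀ ≤ t
      t₀≤t = ≮⇒≥ λ t<t₀ → <⇒≱ hi (≤-trans (*-monoʳ-≤ K (*-mono-≤ t<t₀ t<t₀)) big)
      1≤t : 1 ≤ t
      1≤t = ≤-trans 1≤t₀ t₀≤t

    from-scale : ∀ c → 60 ^ 4 ≤ c → LongBound 4 (suc l)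
    from-scale c h = K * ((c + l) * (c + l)) ,
      eventually K (c + l) (≤-trans (≤-trans (≤ᵇ⇒≤ 1 (60 ^ 4) tt) h) (m≤m+n c l))
        λ n t T T≡ le → at-scale n t T T≡ (large c t h le)

    polarity-bound : LongBound 4 (suc l)
    polarity-bound = from-scale (60 ^ 4) ≤-refl

  ∃-long : ∀ k l → 2 ≤ k → 2 * k ≤ l → LongBound (2 * k) l
  ∃-long (suc (suc zero))    (suc l) _ 4≤l = polarity-bound l 4≤l
  ∃-long (suc (suc (suc k))) l       _ 2k≤l = subst (λ m → LongBound m l) (order k)
    (blownUpPath-bound (4 + (k + k)) l (s≤s (s≤s (s≤s z≤n))) (≤-trans (s≤s (s≤s (s≤s (s≤s z≤n)))) (≤-trans (≤-reflexive (order k)) 2k≤l)))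
    where
    order : ∀ k → 2 + (4 + (k + k)) ≡ 2 * (3 + k)
    order = solve-∀
  ∃-long (suc zero) l (s≤s ()) _

-- Transfer to rational bounds and o(1).

module Asymptotics where

  open import Defs
  open import Data.Integer as ℤ using (+_; +<+; +≤+)
  import Data.Integer.Properties as ℤ
  open import Data.Nat as ℕ using (ℕ; zero; suc; ⌊_/2⌋; ⌈_/2⌉)
  import Data.Nat.Properties as ℕ
  open import Data.Nat.Combinatorics using (k>n⇒nPk≡0)
  open import Data.Product using (_,_)
  open import Data.Rational as ℚ using (ℚ; mkℚ; 0ℚ; 1ℚ; ½; _+_; _*_; _-_; -_; _≤_; _<_; _⊔_; Positive; toℚᵘ)
  open import Data.Rational.Properties
  open import Data.Rational.Solver using (module +-*-Solver)
  open import Data.Rational.Unnormalised as ℚᵘ using (mkℚᵘ; *≡*; *≤*; *<*) renaming (_≃_ to _≃ᵘ_)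
  import Data.Rational.Unnormalised.Properties as ℚᵘ
  open import Relation.Binary.PropositionalEquality

  toℚᵘ-ℕ→ℚ : ∀ m → toℚᵘ (ℕ→ℚ m) ≃ᵘ mkℚᵘ (+ m) 0
  toℚᵘ-ℕ→ℚ m = toℚᵘ-fromℚᵘ (mkℚᵘ (+ m) 0)

  ℕ→ℚ-+ : ∀ m n → ℕ→ℚ (m ℕ.+ n) ≡ ℕ→ℚ m + ℕ→ℚ n
  ℕ→ℚ-+ m n = toℚᵘ-injective (begin
    toℚᵘ (ℕ→ℚ (m ℕ.+ n))                 ≈⟨ toℚᵘ-ℕ→ℚ (m ℕ.+ n) ⟩
    mkℚᵘ (+ (m ℕ.+ n)) 0                 ≈⟨ *≡* (cong (ℤ._* + 1) (cong₂ ℤ._+_ (sym (ℤ.*-identityʳ (+ m))) (sym (ℤ.*-identityʳ (+ n))))) ⟩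
    mkℚᵘ (+ m) 0 ℚᵘ.+ mkℚᵘ (+ n) 0       ≈⟨ ℚᵘ.+-cong (toℚᵘ-ℕ→ℚ m) (toℚᵘ-ℕ→ℚ n) ⟨
    toℚᵘ (ℕ→ℚ m) ℚᵘ.+ toℚᵘ (ℕ→ℚ n)       ≈⟨ toℚᵘ-homo-+ (ℕ→ℚ m) (ℕ→ℚ n) ⟨
    toℚᵘ (ℕ→ℚ m + ℕ→ℚ n)                 ∎)
    where open import Relation.Binary.Reasoning.Setoid ℚᵘ.≃-setoid

  ℕ→ℚ-* : ∀ m n → ℕ→ℚ (m ℕ.* n) ≡ ℕ→ℚ m * ℕ→ℚ n
  ℕ→ℚ-* m n = toℚᵘ-injective (begin
    toℚᵘ (ℕ→ℚ (m ℕ.* n))                 ≈⟨ toℚᵘ-ℕ→ℚ (m ℕ.* n) ⟩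
    mkℚᵘ (+ (m ℕ.* n)) 0                 ≈⟨ *≡* (cong (ℤ._* + 1) (ℤ.pos-* m n)) ⟩
    mkℚᵘ (+ m) 0 ℚᵘ.* mkℚᵘ (+ n) 0       ≈⟨ ℚᵘ.*-cong (toℚᵘ-ℕ→ℚ m) (toℚᵘ-ℕ→ℚ n) ⟨
    toℚᵘ (ℕ→ℚ m) ℚᵘ.* toℚᵘ (ℕ→ℚ n)       ≈⟨ toℚᵘ-homo-* (ℕ→ℚ m) (ℕ→ℚ n) ⟨
    toℚᵘ (ℕ→ℚ m * ℕ→ℚ n)                 ∎)
    where open import Relation.Binary.Reasoning.Setoid ℚᵘ.≃-setoid

  ℕ→ℚ-^ : ∀ m n → ℕ→ℚ (m ℕ.^ n) ≡ ℕ→ℚ m ^ℚ n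
  ℕ→ℚ-^ m zero    = refl
  ℕ→ℚ-^ m (suc n) = trans (ℕ→ℚ-* m (m ℕ.^ n)) (cong (ℕ→ℚ m *_) (ℕ→ℚ-^ m n))

  ℕ→ℚ-mono : ∀ {m n} → m ℕ.≤ n → ℕ→ℚ m ≤ ℕ→ℚ n
  ℕ→ℚ-mono {m} {n} le = toℚᵘ-cancel-≤ (ℚᵘ.≤-respˡ-≃ (ℚᵘ.≃-sym (toℚᵘ-ℕ→ℚ m)) (ℚᵘ.≤-respʳ-≃ (ℚᵘ.≃-sym (toℚᵘ-ℕ→ℚ n))
    (*≤* (ℤ.*-monoʳ-≤-nonNeg (+ 1) (+≤+ le)))))

  ℕ→ℚ-pos : ∀ n → Positive (ℕ→ℚ (suc n))
  ℕ→ℚ-pos n = normalize-pos (suc n) 1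

  ÷-* : ∀ a b → (a ÷ suc b) * ℕ→ℚ (suc b) ≡ ℕ→ℚ a
  ÷-* a b = toℚᵘ-injective (begin
    toℚᵘ ((a ÷ suc b) * ℕ→ℚ (suc b))              ≈⟨ toℚᵘ-homo-* (a ÷ suc b) (ℕ→ℚ (suc b)) ⟩
    toℚᵘ (a ÷ suc b) ℚᵘ.* toℚᵘ (ℕ→ℚ (suc b))      ≈⟨ ℚᵘ.*-cong (toℚᵘ-fromℚᵘ (mkℚᵘ (+ a) b)) (toℚᵘ-ℕ→ℚ (suc b)) ⟩
    mkℚᵘ (+ a) b ℚᵘ.* mkℚᵘ (+ suc b) 0            ≈⟨ *≡* (trans (ℤ.*-identityʳ (+ a ℤ.* + suc b)) (cong (λ d → + a ℤ.* + d) (sym (ℕ.*-identityʳ (suc b))))) ⟩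
    mkℚᵘ (+ a) 0                                  ≈⟨ toℚᵘ-ℕ→ℚ a ⟨
    toℚᵘ (ℕ→ℚ a)                                  ∎)
    where open import Relation.Binary.Reasoning.Setoid ℚᵘ.≃-setoid

  ÷-nonNeg : ∀ c n → 0ℚ ≤ c ÷ n
  ÷-nonNeg c zero    = ≤-refl
  ÷-nonNeg c (suc n) = nonNegative⁻¹ (c ÷ suc n) {{normalize-nonNeg c (suc n)}}

  ÷-tendsToZero : ∀ c → TendsToZero (λ n → - (c ÷ n))
  ÷-tendsToZero c ε@(mkℚ (ℤ.+_ zero) d _) (ℚ.*<* (+<+ ()))
  -- Since ε ≥ 1 / (d + 1), it is enough that n > c (d + 1).
  ÷-tendsToZero c ε@(mkℚ (+ suc a) d _) _ = suc (c ℕ.* suc d) , small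
    where
    small : ∀ n → suc (c ℕ.* suc d) ℕ.≤ n → ℚ.∣ - (c ÷ n) ∣ < ε
    small (suc n) le = subst (_< ε) (sym (trans (∣-p∣≡∣p∣ (c ÷ suc n)) (0≤p⇒∣p∣≡p (÷-nonNeg c (suc n)))))
      (toℚᵘ-cancel-< (ℚᵘ.<-respˡ-≃ (ℚᵘ.≃-sym (toℚᵘ-fromℚᵘ (mkℚᵘ (+ c) n)))
        (*<* (subst₂ ℤ._<_ (ℤ.pos-* c (suc d)) (ℤ.pos-* (suc a) (suc n)) (+<+ (ℕ.≤-trans le (ℕ.m≤n*m (suc n) (suc a))))))))

  0-tendsToZero : TendsToZero (λ _ → 0ℚ)
  0-tendsToZero ε 0<ε = 0 , λ _ _ → 0<ε

  -- The error term is -c / n. The range starts at N + 1 to make n positive, since the comparison is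
  -- made after multiplying by n.
  half-bound : ∀ (a : ℕ → ℕ) (g e c N : ℕ) →
    (∀ n → N ℕ.≤ n → n ℕ.* (g ℕ.* n ℕ.^ e) ℕ.≤ 2 ℕ.* (n ℕ.* a n) ℕ.+ c ℕ.* (g ℕ.* n ℕ.^ e)) →
    (λ n → ℕ→ℚ (a n)) ≳ (λ n → ½ * ℕ→ℚ g * ℕ→ℚ n ^ℚ e)
  half-bound a g e c N h = (λ n → - (c ÷ n)) , ÷-tendsToZero c , suc N , bound
    where
    bound : ∀ n → suc N ℕ.≤ n → (1ℚ + - (c ÷ n)) * (½ * ℕ→ℚ g * ℕ→ℚ n ^ℚ e) ≤ ℕ→ℚ (a n)
    bound n@(suc n′) N<n = *-cancelˡ-≤-pos n⁺ {{ℕ→ℚ-pos n′}} (begin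
      n⁺ * ((1ℚ + - q) * (½ * ℕ→ℚ g * ℕ→ℚ n ^ℚ e))  ≡⟨ cong (λ z → n⁺ * ((1ℚ + - q) * z)) (trans (*-assoc ½ (ℕ→ℚ g) _) (cong (½ *_) (sym F-eq))) ⟩
      n⁺ * ((1ℚ + - q) * (½ * F))                   ≡⟨ lem₁ n⁺ q ½ F ⟩
      ½ * (n⁺ * F + - (q * n⁺ * F))                 ≡⟨ cong (λ z → ½ * (n⁺ * F + - (z * F))) (÷-* c n′) ⟩
      ½ * (n⁺ * F + - (ℕ→ℚ c * F))                  ≤⟨ *-monoˡ-≤-nonNeg ½ (+-monoˡ-≤ (- (ℕ→ℚ c * F)) main) ⟩
      ½ * (Y + Y + ℕ→ℚ c * F + - (ℕ→ℚ c * F))       ≡⟨ lem₂ ½ Y (ℕ→ℚ c * F) ⟩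
      (½ + ½) * Y                                   ≡⟨ *-identityˡ Y ⟩
      Y                                             ∎)
      where
      open ≤-Reasoning
      open +-*-Solver using (solve; _:+_; _:*_; :-_; _:=_; con)
      n⁺ = ℕ→ℚ n
      q = c ÷ n
      F = ℕ→ℚ (g ℕ.* n ℕ.^ e)
      Y = n⁺ * ℕ→ℚ (a n)
      F-eq : F ≡ ℕ→ℚ g * ℕ→ℚ n ^ℚ e
      F-eq = trans (ℕ→ℚ-* g (n ℕ.^ e)) (cong (ℕ→ℚ g *_) (ℕ→ℚ-^ n e))
      lem₁ : ∀ n q h F → n * ((1ℚ + - q) * (h * F)) ≡ h * (n * F + - (q * n * F))
      lem₁ = solve 4 (λ n q h F → n :* ((con 1ℚ :+ :- q) :* (h :* F)) := h :* (n :* F :+ :- (q :* n :* F))) refl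
      lem₂ : ∀ h y z → h * (y + y + z + - z) ≡ (h + h) * y
      lem₂ = solve 3 (λ h y z → h :* (y :+ y :+ z :+ :- z) := (h :+ h) :* y) refl
      doubled : ∀ x → ℕ→ℚ (2 ℕ.* x) ≡ ℕ→ℚ x + ℕ→ℚ x
      doubled x = trans (cong (λ y → ℕ→ℚ (x ℕ.+ y)) (ℕ.+-identityʳ x)) (ℕ→ℚ-+ x x)
      main : n⁺ * F ≤ Y + Y + ℕ→ℚ c * F
      main = subst₂ _≤_ (ℕ→ℚ-* n (g ℕ.* n ℕ.^ e))
        (trans (ℕ→ℚ-+ (2 ℕ.* (n ℕ.* a n)) _) (cong₂ _+_ (trans (doubled (n ℕ.* a n)) (cong₂ _+_ (ℕ→ℚ-* n (a n)) (ℕ→ℚ-* n (a n)))) (ℕ→ℚ-* c _)))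
        (ℕ→ℚ-mono (h n (ℕ.≤-trans (ℕ.n≤1+n N) N<n)))

  ^ℚ-distrib : ∀ x y n → (x * y) ^ℚ n ≡ x ^ℚ n * y ^ℚ n
  ^ℚ-distrib x y zero    = refl
  ^ℚ-distrib x y (suc n) = trans (cong (x * y *_) (^ℚ-distrib x y n))
    (solve 4 (λ x y a b → x :* y :* (a :* b) := x :* a :* (y :* b)) refl x y (x ^ℚ n) (y ^ℚ n))
    where open +-*-Solver using (solve; _:*_; _:=_)

  ÷-^-bound : ∀ n j e X → n ℕ.^ e ℕ.≤ suc j ℕ.^ e ℕ.* X → (n ÷ suc j) ^ℚ e ≤ ℕ→ℚ X
  ÷-^-bound n j e X h = *-cancelʳ-≤-pos Q {{pos}} (begin
    (n ÷ suc j) ^ℚ e * Q                     ≡⟨ cong ((n ÷ suc j) ^ℚ e *_) (ℕ→ℚ-^ (suc j) e) ⟩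
    (n ÷ suc j) ^ℚ e * ℕ→ℚ (suc j) ^ℚ e      ≡⟨ ^ℚ-distrib (n ÷ suc j) (ℕ→ℚ (suc j)) e ⟨
    ((n ÷ suc j) * ℕ→ℚ (suc j)) ^ℚ e         ≡⟨ cong (_^ℚ e) (÷-* n j) ⟩
    ℕ→ℚ n ^ℚ e                               ≡⟨ ℕ→ℚ-^ n e ⟨
    ℕ→ℚ (n ℕ.^ e)                            ≤⟨ ℕ→ℚ-mono h ⟩
    ℕ→ℚ (suc j ℕ.^ e ℕ.* X)                  ≡⟨ ℕ→ℚ-* (suc j ℕ.^ e) X ⟩
    Q * ℕ→ℚ X                                ≡⟨ *-comm Q (ℕ→ℚ X) ⟩
    ℕ→ℚ X * Q                                ∎)
    where
    open ≤-Reasoning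
    Q = ℕ→ℚ (suc j ℕ.^ e)
    pos : Positive Q
    pos = normalize-pos (suc j ℕ.^ e) 1 {{_}} {{ℕ.m^n≢0 (suc j) e}}

  sparseBound≡0 : ∀ k l n → 2 ℕ.≤ k → 2 ℕ.* k ℕ.≤ l → sparseBound k l n ≡ 0ℚ
  sparseBound≡0 (suc k) l n 2≤k 2k≤l = trans (cong (λ f → x * ℕ→ℚ f * y) (k>n⇒nPk≡0 k<)) (trans (cong (_* y) (*-zeroʳ x)) (*-zeroˡ y))
    where
    x = (k ÷ (4 ℕ.* (suc k ℕ.∸ 2) ℕ.^ (suc k ℕ.+ 2))) ^ℚ ⌈ l /2⌉
    y = ℕ→ℚ n ^ℚ ⌈ l /2⌉
    k< : k ℕ.< ⌊ l /2⌋
    k< = subst (ℕ._≤ ⌊ l /2⌋) (trans (cong (λ m → ⌊ suc k ℕ.+ m /2⌋) (ℕ.+-identityʳ (suc k))) (sym (ℕ.n≡⌊n+n/2⌋ (suc k)))) (ℕ.⌊n/2⌋-mono 2k≤l)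

  blowUp-bound : ∀ (a : ℕ → ℕ) k l N → 2 ℕ.≤ k → 2 ℕ.≤ l → 2 ℕ.* k ℕ.≤ l →
    (∀ n → N ℕ.≤ n → n ℕ.^ ⌈ l /2⌉ ℕ.≤ ⌊ l /2⌋ ℕ.^ ⌈ l /2⌉ ℕ.* a n) →
    (λ n → ℕ→ℚ (a n)) ≳ (λ n → blowUpBound l n ⊔ sparseBound k l n)
  blowUp-bound a k (suc zero) N _ (ℕ.s≤s ())
  blowUp-bound a k l@(suc (suc l′)) N 2≤k _ 2k≤l h = (λ _ → 0ℚ) , 0-tendsToZero , N , λ n N≤n →
    ≤-trans (≤-reflexive (*-identityˡ _)) (⊔-lub (÷-^-bound n ⌊ l′ /2⌋ ⌈ l /2⌉ (a n) (h n N≤n))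
      (≤-trans (≤-reflexive (sparseBound≡0 k l n 2≤k 2k≤l)) (ℕ→ℚ-mono {0} {a n} ℕ.z≤n)))

open import Defs
open import Data.Nat using (ℕ; _*_; _≤_; _<_)
open import Data.Product using (_×_)
open import Data.Rational using (_⊔_)
open import Data.Nat using (_∸_; ⌊_/2⌋; ⌈_/2⌉)
open import Data.Nat.Combinatorics using (_P_)
open import Data.Nat.Properties using (<⇒≤)
open import Data.Product using (_,_)

theorem18 : (k l : ℕ) → 2 ≤ k → 2 ≤ l →
    (l < 2 * k →
    (λ n → ℕ→ℚ (ex n (path l) (cycle (2 * k)))) ≳ (λ n → shortPathBound k l n))
    ×
    (2 * k ≤ l →
    (λ n → ℕ→ℚ (ex n (path l) (cycle (2 * k)))) ≳ (λ n → blowUpBound l n ⊔ sparseBound k l n))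
theorem18 k l 2≤k 2≤l =
  (λ _ → let c , N , h = Counting.∃-short k l (<⇒≤ 2≤k) 2≤l in
    Asymptotics.half-bound a ((k ∸ 1) P ⌊ l /2⌋) ⌈ l /2⌉ c N h) ,
  (λ 2k≤l → let N , h = Counting.∃-long k l 2≤k 2k≤l in Asymptotics.blowUp-bound a k l N 2≤k 2≤l 2k≤l h)
  where
  a = λ n → ex n (path l) (cycle (2 * k))
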